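{- The problem Conflict-Pair Removal, restricted to edge-bicoloured graphs $G$ with $m$ edges and $n$ vertices, can be solved in $O(m^{3/2}\log n)$ time.
   Context: An edge-bicoloured graph is a finite simple undirected graph in which each edge has exactly one colour from $\{1,2\}$ (not required to be a proper edge colouring). A conflict pair is a pair of adjacent edges (two distinct edges sharing an end) of different colours. Conflict-Pair Removal: the input is an edge-coloured graph $G$ and a positive integer $k$; the question is whether there is a set $E'$ of at most $k$ edges of $G$ such that $G-E'$ (the graph with the edges of $E'$ deleted) contains no conflict pair. -}

module Defs where

open import Data.Bool.Base using (Bool; if_then_else_)
open import Data.Fin.Base using (Fin; toℕ)
open import Data.Fin.Subset using (Subset; _∈_; ∣_∣; ∁)
open import Data.List.Base using (List; []; _∷_; concat; drop; head; tabulate)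
open import Data.Maybe.Base using (Maybe; just; nothing; fromMaybe)
open import Data.Nat.Base
  using (ℕ; zero; suc; _+_; _*_; _∸_; _^_; _≤_; _⊔_; _≡ᵇ_)
open import Data.Nat.DivMod using (_%_)
open import Data.Nat.Logarithm using (⌊log₂_⌋)
open import Data.Nat.Properties using (m^n≢0)
open import Data.Product.Base using (_×_; ∃-syntax; proj₁; proj₂)
open import Data.Sum.Base using (_⊎_)
open import Function.Bundles using (_⇔_)
open import Relation.Binary.PropositionalEquality.Core using (_≡_; _≢_)
open import Relation.Nullary.Negation.Core using (¬_)
open import Relation.Nullary.Reflects using (Reflects)

-- The order of the two ends of an edge, and the numbering of the edges,
-- carry no graph-theoretic meaning; they fix one edge-list presentation
-- of the graph for use as machine input.
record BicolouredGraph (n m : ℕ) : Set where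
  field
    ends   : Fin m → Fin n × Fin n
    colour : Fin m → Fin 2

  _EndOf_ : Fin n → Fin m → Set
  v EndOf e = v ≡ proj₁ (ends e) ⊎ v ≡ proj₂ (ends e)

  field
    loopless   : ∀ e → proj₁ (ends e) ≢ proj₂ (ends e)
    noParallel : ∀ e f → (∀ v → v EndOf e ⇔ v EndOf f) → e ≡ f

  Adjacent : Fin m → Fin m → Set
  Adjacent e f = e ≢ f × ∃[ v ] (v EndOf e × v EndOf f)

  ConflictPair : Fin m → Fin m → Set
  ConflictPair e f = Adjacent e f × colour e ≢ colour f

  -- A set F of edges stands for the spanning subgraph with edge set F.
  ContainsConflictPair : Subset m → Set
  ContainsConflictPair F = ∃[ e ] ∃[ f ] (e ∈ F × f ∈ F × ConflictPair e f)

-- The graph G − E′ is the spanning subgraph with edge set ∁ E′.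
ConflictPairRemoval : ∀ {n m} → BicolouredGraph n m → ℕ → Set
ConflictPairRemoval {m = m} G k =
  ∃[ E′ ] (∣ E′ ∣ ≤ k × ¬ ContainsConflictPair (∁ E′))
  where open BicolouredGraph G

-- A word RAM with unit-cost instructions and w-bit words.

Reg Label : Set
Reg   = ℕ
Label = ℕ

data Instr : Set where
  const   : Reg → ℕ → Instr
  add sub : Reg → Reg → Reg → Instr   -- the first register is the target
  load    : Reg → Reg → Instr         -- load r a  :  r := mem[a]
  store   : Reg → Reg → Instr         -- store a r :  mem[a] := r
  jpos    : Reg → Label → Instr       -- jump if the register is positive
  halt    : Bool → Instr

Program : Set
Program = List Instr

record State : Set where
  constructor ⟨_,_,_⟩
  field
    pc  : Label
    reg : Reg → ℕ
    mem : ℕ → ℕ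

_[_≔_] : (ℕ → ℕ) → ℕ → ℕ → (ℕ → ℕ)
(f [ i ≔ x ]) j = if j ≡ᵇ i then x else f j

_mod2^_ : ℕ → ℕ → ℕ
x mod2^ w = _%_ x (2 ^ w) {{m^n≢0 2 w}}

-- Sums wrap around at the word length; subtraction is truncated at 0.
-- `run P w t s` is the answer if P, started in s, halts after executing
-- at most t instructions (the halting one included), and `nothing` if it
-- does not, or if control leaves the program.
mutual
  run : Program → (w t : ℕ) → State → Maybe Bool
  run P w zero    s = nothing
  run P w (suc t) s = exec P w t (head (drop (State.pc s) P)) s

  exec : Program → (w t : ℕ) → Maybe Instr → State → Maybe Bool
  exec P w t nothing  s = nothing
  exec P w t (just (const d x)) ⟨ p , r , μ ⟩ =
    run P w t ⟨ suc p , r [ d ≔ x mod2^ w ] , μ ⟩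
  exec P w t (just (add d a b)) ⟨ p , r , μ ⟩ =
    run P w t ⟨ suc p , r [ d ≔ (r a + r b) mod2^ w ] , μ ⟩
  exec P w t (just (sub d a b)) ⟨ p , r , μ ⟩ =
    run P w t ⟨ suc p , r [ d ≔ r a ∸ r b ] , μ ⟩
  exec P w t (just (load d a)) ⟨ p , r , μ ⟩ =
    run P w t ⟨ suc p , r [ d ≔ μ (r a) ] , μ ⟩
  exec P w t (just (store a b)) ⟨ p , r , μ ⟩ =
    run P w t ⟨ suc p , r , μ [ r a ≔ r b ] ⟩
  exec P w t (just (jpos a ℓ)) ⟨ p , r , μ ⟩ =
    run P w t ⟨ (if r a ≡ᵇ 0 then suc p else ℓ) , r , μ ⟩
  exec P w t (just (halt b)) s = just b

-- The input occupies the initial memory cells; everything else is 0.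
initial : List ℕ → State
initial xs = ⟨ 0 , (λ _ → 0) , (λ a → fromMaybe 0 (head (drop a xs))) ⟩

-- n, m, k, then three words per edge: its two ends and its colour (1 or 2).
encode : ∀ {n m} → BicolouredGraph n m → ℕ → List ℕ
encode {n} {m} G k = n ∷ m ∷ k ∷ concat (tabulate edge)
  where
  open BicolouredGraph G
  edge : Fin m → List ℕ
  edge e = toℕ (proj₁ (ends e)) ∷ toℕ (proj₂ (ends e))
         ∷ suc (toℕ (colour e)) ∷ []

DecidesWithin : Program → (w T : ℕ) → List ℕ → Set → Set
DecidesWithin P w T xs Q = ∃[ b ] (run P w T (initial xs) ≡ just b × Reflects Q b)

-- T ≤ C · m^{3/2} · log₂ n, squared.  If m ≥ 1 then n ≥ 2, so the maximum
-- with 1 only matters for edgeless graphs, where the bound would be 0; and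
-- rounding log₂ n down only changes the constant.
WithinTime : (C n m T : ℕ) → Set
WithinTime C n m T = T ^ 2 ≤ C ^ 2 * (1 ⊔ m ^ 3 * ⌊log₂ n ⌋ ^ 2)

-- w ≥ c · log₂ (2 + n + m + k): words of logarithmically many bits suffice.
WordSize : (c n m k w : ℕ) → Set
WordSize c n m k w = (2 + n + m + k) ^ c ≤ 2 ^ w

{-# OPTIONS --safe #-}

-- By König's theorem the answer is whether a maximum matching between the
-- edges of colour 1 ("left") and those of colour 2 ("right"), adjacent when
-- they share an end, has at most k pairs.  That bipartite graph can have m²
-- edges, so it is only represented by the lists of right edges at each vertex.
--
-- An auction with D = ⌈√m⌉ price levels computes a first matching M.  A left
-- edge bids for the cheapest right edge at its two ends; the scanning pointers
-- of the vertices only move forward, so the auction takes O(mD) steps.  Its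
-- prices form a fractional vertex cover showing that every matching has at most
-- |M| + |M|/D ≤ |M| + D pairs.  Hence at most D + 1 searches for an augmenting
-- path remain.  Each is the same scan with a single price level, in which right
-- edges are marked instead of sold, and takes O(m) steps; a search that fails
-- leaves a vertex cover of the size of the matching.

module Submission where

open import Defs
open import Data.Bool.Base using (Bool; true; false; if_then_else_; T)
open import Data.Empty using (⊥; ⊥-elim)
open import Data.Fin.Base using (Fin; toℕ; fromℕ<) renaming (zero to fzero; suc to fsuc)
open import Data.Fin.Properties using (toℕ-injective; toℕ<n; toℕ-fromℕ<)
open import Data.Fin.Subset using (Subset; _∈_; _∉_; ∣_∣; ∁)
open import Data.Fin.Subset.Properties using (x∈∁p⇒x∉p; x∉p⇒x∈∁p)
open import Data.List.Base as List using (List; []; _∷_; _++_)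
open import Data.List.Properties using (++-assoc; length-++)
open import Data.Maybe.Base using (just; fromMaybe)
open import Data.Nat.Base
open import Data.Nat.DivMod using (m<n⇒m%n≡m; _%_; [m+kn]%n≡m%n)
open import Data.Nat.Logarithm using (⌊log₂_⌋; ⌊log₂⌋-mono-≤)
open import Data.Nat.Properties
open import Data.Product.Base using (_×_; _,_; proj₁; proj₂; ∃-syntax)
open import Data.Sum.Base using (_⊎_; inj₁; inj₂)
open import Data.Unit.Base using (⊤; tt)
import Data.Vec.Base as Vec
open import Data.Vec.Properties using (lookup⇒[]=; []=⇒lookup; lookup∘tabulate)
open import Algebra.Properties.CommutativeSemigroup +-commutativeSemigroup using (interchange)
open import Relation.Binary.PropositionalEquality
open import Relation.Nullary.Decidable.Core using (yes; no)
open import Relation.Nullary.Negation.Core using (¬_)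
open import Relation.Nullary.Reflects using (Reflects; ofʸ; ofⁿ)

-- All left edges at a vertex x face the same right edges there, so one scanning pointer per vertex
-- serves them all. Prices only rise. The pointer of x cycles through the list of x, and every slot
-- carries an upper bound `r` on the levels `q` still left to its right edge. The largest of these
-- bounds always sits at the pointer, so reading one slot bounds every offer at x, and a bid is made
-- only when that bound is attained. A buyer may be worse off by one level than its best offer,
-- which is the source of the excess |M|/D; taking D near √m makes the excess, and with it the
-- number of searches, comparable to the number of levels. The machine only adds, subtracts,
-- accesses memory and jumps, and every instruction counts, so direct reasoning about programs would
-- be unwieldy. The algorithm is therefore written in a small structured language with a compiler
-- that is verified once. Straight-line code and branches are treated by weakest preconditions,
-- loops by a rule that turns a decreasing measure into a time bound.

≡ᵇ-refl : ∀ i → (i ≡ᵇ i) ≡ true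
≡ᵇ-refl zero    = refl
≡ᵇ-refl (suc i) = ≡ᵇ-refl i

≢⇒≡ᵇ : ∀ {i j} → i ≢ j → (i ≡ᵇ j) ≡ false
≢⇒≡ᵇ {zero}  {zero}  i≢j = ⊥-elim (i≢j refl)
≢⇒≡ᵇ {zero}  {suc j} i≢j = refl
≢⇒≡ᵇ {suc i} {zero}  i≢j = refl
≢⇒≡ᵇ {suc i} {suc j} i≢j = ≢⇒≡ᵇ {i} {j} (λ eq → i≢j (cong suc eq))

[≔]-same : ∀ f i x {j} → j ≡ i → (f [ i ≔ x ]) j ≡ x
[≔]-same f i x refl rewrite ≡ᵇ-refl i = refl

[≔]-other : ∀ f i x {j} → j ≢ i → (f [ i ≔ x ]) j ≡ f j
[≔]-other f i x j≢i rewrite ≢⇒≡ᵇ j≢i = refl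

[≔]-≤ : ∀ f k {v} → v ≤ f k → ∀ i → (f [ k ≔ v ]) i ≤ f i
[≔]-≤ f k {v} v≤ i with i ≟ k
... | yes refl = ≤-trans (≤-reflexive ([≔]-same f k v {k} refl)) v≤
... | no ne    = ≤-reflexive ([≔]-other f k v ne)

-- Compilation to the word RAM

data Var : Set where
  %m %D %e %u %x %y %s %s′ %p %p′ %d %t %h %o %f %g %i %c %qh %qt %n %z %P : Var

-- #r counts down the levels left to a slot of a list, and #q the price levels
-- left to a right edge, so that untouched memory stands for exhaustion.
data Arr : Set where
  #next #edge #head #cur #r #q #mate #owner #queue #rank : Arr

data Field : Set where
  end₁ end₂ col : Field

codeV : Var → ℕ
codeV %m = 0
codeV %D = 1
codeV %e = 2
codeV %u = 3
codeV %x = 4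
codeV %y = 5
codeV %s = 6
codeV %s′ = 7
codeV %p = 8
codeV %p′ = 9
codeV %d = 10
codeV %t = 11
codeV %h = 12
codeV %o = 13
codeV %f = 14
codeV %g = 15
codeV %i = 16
codeV %c = 17
codeV %qh = 18
codeV %qt = 19
codeV %n = 20
codeV %z = 21
codeV %P = 22

codeA : Arr → ℕ
codeA #next = 0
codeA #edge = 1
codeA #head = 2
codeA #cur = 3
codeA #r = 4
codeA #q = 5
codeA #mate = 6
codeA #owner = 7
codeA #queue = 8
codeA #rank = 9

codeA<16 : ∀ A → codeA A < 16
codeA<16 A = <ᵇ⇒< (codeA A) 16 (go A)
  where
  go : ∀ A → T (codeA A <ᵇ 16)
  go #next = tt
  go #edge = tt
  go #head = tt
  go #cur = tt
  go #r = tt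
  go #q = tt
  go #mate = tt
  go #owner = tt
  go #queue = tt
  go #rank = tt

codeF : Field → ℕ
codeF end₁ = 0
codeF end₂ = 1
codeF col  = 2

codeF≤2 : ∀ F → codeF F ≤ 2
codeF≤2 end₁ = z≤n
codeF≤2 end₂ = s≤s z≤n
codeF≤2 col  = s≤s (s≤s z≤n)

infixr 4 _⨟_

data Cmd : Set where
  skip        : Cmd
  lit         : Var → ℕ → Cmd
  mov inc dec : Var → Var → Cmd
  plus minus  : Var → Var → Var → Cmd
  get         : Var → Arr → Var → Cmd
  put         : Arr → Var → Var → Cmd
  inp         : Var → Field → Var → Cmd
  _⨟_         : Cmd → Cmd → Cmd
  ifp         : Var → Cmd → Cmd → Cmd
  while       : Var → Cmd → Cmd

size : Cmd → ℕ
size skip          = 0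
size (lit x n)     = 1
size (mov x y)     = 2
size (inc x y)     = 2
size (dec x y)     = 2
size (plus x y z)  = 1
size (minus x y z) = 1
size (get x A y)   = 8
size (put A y x)   = 8
size (inp x F y)   = 5
size (c ⨟ d)       = size c + size d
size (ifp y a b)   = 3 + size b + size a
size (while y c)   = 3 + size c

cost : Cmd → ℕ
cost (c ⨟ d)     = cost c + cost d
-- Charging both branches rather than the larger one affects only constants and keeps costs free of
-- maxima.
cost (ifp y a b) = 3 + (cost a + cost b)
cost c           = size c

-- Registers 0 and 2 are scratch; register 1 holds the address at which the
-- input ends and the interleaved arrays begin.
ρ : Var → Reg
ρ x = 4 + codeV x

-- Four doublings multiply by 16, as the machine can only add. Since 16 exceeds every array code,
-- the arrays interleave without collisions.
compAddr : Arr → Var → List Instr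
compAddr A y =
  add 0 (ρ y) (ρ y) ∷ add 0 0 0 ∷ add 0 0 0 ∷ add 0 0 0 ∷
  add 0 0 1 ∷ const 2 (codeA A) ∷ add 0 0 2 ∷ []

comp : Cmd → Label → List Instr
comp skip          ℓ = []
comp (lit x n)     ℓ = const (ρ x) n ∷ []
comp (mov x y)     ℓ = const 0 0 ∷ sub (ρ x) (ρ y) 0 ∷ []
comp (inc x y)     ℓ = const 0 1 ∷ add (ρ x) (ρ y) 0 ∷ []
comp (dec x y)     ℓ = const 0 1 ∷ sub (ρ x) (ρ y) 0 ∷ []
comp (plus x y z)  ℓ = add (ρ x) (ρ y) (ρ z) ∷ []
comp (minus x y z) ℓ = sub (ρ x) (ρ y) (ρ z) ∷ []
comp (get x A y)   ℓ = compAddr A y ++ load (ρ x) 0 ∷ []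
comp (put A y x)   ℓ = compAddr A y ++ store 0 (ρ x) ∷ []
comp (inp x F y)   ℓ =
  add 0 (ρ y) (ρ y) ∷ add 0 0 (ρ y) ∷ const 2 (codeF F) ∷ add 0 0 2 ∷ load (ρ x) 0 ∷ []
comp (c ⨟ d)       ℓ = comp c ℓ ++ comp d (ℓ + size c)
comp (ifp y a b)   ℓ =
  jpos (ρ y) (3 + size b + ℓ) ∷ comp b (1 + ℓ) ++
  const 0 1 ∷ jpos 0 (size a + (3 + size b + ℓ)) ∷ comp a (3 + size b + ℓ)
-- The test stands behind the body and the loop is entered there, so each round costs a single jump.
-- The pair `const 0 1`, `jpos 0` is an unconditional jump.
comp (while y c)   ℓ =
  const 0 1 ∷ jpos 0 (size c + (2 + ℓ)) ∷ comp c (2 + ℓ) ++ jpos (ρ y) (2 + ℓ) ∷ []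

length-comp : ∀ c ℓ → List.length (comp c ℓ) ≡ size c
length-comp skip          ℓ = refl
length-comp (lit x n)     ℓ = refl
length-comp (mov x y)     ℓ = refl
length-comp (inc x y)     ℓ = refl
length-comp (dec x y)     ℓ = refl
length-comp (plus x y z)  ℓ = refl
length-comp (minus x y z) ℓ = refl
length-comp (get x A y)   ℓ = refl
length-comp (put A y x)   ℓ = refl
length-comp (inp x F y)   ℓ = refl
length-comp (c ⨟ d)       ℓ
  rewrite length-++ (comp c ℓ) {comp d (ℓ + size c)}
        | length-comp c ℓ | length-comp d (ℓ + size c) = refl
length-comp (ifp y a b)   ℓ
  rewrite length-++ (comp b (1 + ℓ)) {const 0 1 ∷ jpos 0 (size a + (3 + size b + ℓ)) ∷ comp a (3 + size b + ℓ)}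
        | length-comp b (1 + ℓ) | length-comp a (3 + size b + ℓ)
        | +-suc (size b) (suc (size a)) | +-suc (size b) (size a) = refl
length-comp (while y c)   ℓ
  rewrite length-++ (comp c (2 + ℓ)) {jpos (ρ y) (2 + ℓ) ∷ []}
        | length-comp c (2 + ℓ) | +-comm (size c) 1 = refl

At : Program → Label → List Instr → Set
At P ℓ []       = ⊤
At P ℓ (i ∷ is) = List.head (List.drop ℓ P) ≡ just i × At P (suc ℓ) is

At-++ : ∀ P ℓ xs {ys} → At P ℓ (xs ++ ys) → At P ℓ xs × At P (List.length xs + ℓ) ys
At-++ P ℓ []       at        = tt , at
At-++ P ℓ (x ∷ xs) {ys} (eq , at) =
  let at₁ , at₂ = At-++ P (suc ℓ) xs at
  in (eq , at₁) , subst (λ ℓ′ → At P ℓ′ ys) (+-suc (List.length xs) ℓ) at₂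

At-self : ∀ xs ys → At (xs ++ ys) (List.length xs) ys
At-self xs []       = tt
At-self xs (y ∷ ys) =
  head-drop xs ,
  subst₂ (λ P ℓ → At P ℓ ys) (++-assoc xs (y ∷ []) ys)
         (trans (length-++ xs) (+-comm (List.length xs) 1))
         (At-self (xs ++ y ∷ []) ys)
  where
  head-drop : ∀ xs → List.head (List.drop (List.length xs) (xs ++ y ∷ ys)) ≡ just y
  head-drop []       = refl
  head-drop (x ∷ xs) = head-drop xs

-- Stores and a timed program logic

record Store : Set where
  constructor mkStore
  field
    reg : Var → ℕ
    arr : Arr → ℕ → ℕ
open Store public

-- Names are compared through their codes, so that lookups at concrete names reduce by computation.
setv : Var → ℕ → Store → Store
setv x n s = mkStore (λ v → if codeV v ≡ᵇ codeV x then n else reg s v) (arr s)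

seta : Arr → ℕ → ℕ → Store → Store
seta A i n s =
  mkStore (reg s) (λ A′ → if codeA A′ ≡ᵇ codeA A then arr s A′ [ i ≔ n ] else arr s A′)

seta-same : ∀ i v s {A A′} → codeA A′ ≡ codeA A → arr (seta A i v s) A′ ≡ arr s A′ [ i ≔ v ]
seta-same i v s {A} eq rewrite eq | ≡ᵇ-refl (codeA A) = refl

seta-other : ∀ i v s {A A′} → codeA A′ ≢ codeA A → arr (seta A i v s) A′ ≡ arr s A′
seta-other i v s ≢ rewrite ≢⇒≡ᵇ ≢ = refl

-- w is the word length and H bounds all values and indices in use; fld reads the
-- input as a table with three fields per row, row 0 holding n, m and k.
module Semantics (w H m : ℕ) (fld : Field → ℕ → ℕ)
                 (fits : 16 * H + (20 + 3 * m) < 2 ^ w) where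

  base : ℕ
  base = 3 + 3 * m

  addr : Arr → ℕ → ℕ
  addr A i = 16 * i + base + codeA A

  record Rep (r μ : ℕ → ℕ) (s : Store) : Set where
    constructor mkRep
    field
      vars   : ∀ x → r (ρ x) ≡ reg s x
      base≡  : r 1 ≡ base
      arrays : ∀ A i → μ (addr A i) ≡ arr s A i
      input  : ∀ F i → i ≤ m → μ (3 * i + codeF F) ≡ fld F i
  open Rep

  -- Quantifying over the leftover fuel `t₀` lets executions compose by adding their lengths.
  record _↝[_,_]_ (σ : State) (P : Program) (t : ℕ) (σ′ : State) : Set where
    constructor runs
    field run≡ : ∀ t₀ → run P w (t + t₀) σ ≡ run P w t₀ σ′
  open _↝[_,_]_ public

  ↝-refl : ∀ {P σ} → σ ↝[ P , 0 ] σ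
  ↝-refl = runs λ t₀ → refl

  relabel : ∀ {P t σ ℓ ℓ′ r μ} → ℓ ≡ ℓ′ → σ ↝[ P , t ] ⟨ ℓ , r , μ ⟩ → σ ↝[ P , t ] ⟨ ℓ′ , r , μ ⟩
  relabel refl p = p

  infixr 5 _⨾_
  _⨾_ : ∀ {P t₁ t₂ σ₁ σ₂ σ₃} →
        σ₁ ↝[ P , t₁ ] σ₂ → σ₂ ↝[ P , t₂ ] σ₃ → σ₁ ↝[ P , t₁ + t₂ ] σ₃
  _⨾_ {P} {t₁} {t₂} {σ₁} (runs p) (runs q) = runs λ t₀ →
    trans (cong (λ t → run P w t σ₁) (+-assoc t₁ t₂ t₀)) (trans (p (t₂ + t₀)) (q t₀))

  mod-< : ∀ {x} → x < 2 ^ w → x mod2^ w ≡ x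
  mod-< x< = m<n⇒m%n≡m {{m^n≢0 2 w}} x<

  module _ {P : Program} {ℓ : Label} {r μ : ℕ → ℕ} where

    private
      σ : State
      σ = ⟨ ℓ , r , μ ⟩

    step : ∀ {i} → List.head (List.drop ℓ P) ≡ just i → ∀ t₀ → run P w (suc t₀) σ ≡ exec P w t₀ (just i) σ
    step eq t₀ = cong (λ i → exec P w t₀ i σ) eq

    step-const : ∀ {d x} → List.head (List.drop ℓ P) ≡ just (const d x) → x < 2 ^ w →
                 σ ↝[ P , 1 ] ⟨ suc ℓ , r [ d ≔ x ] , μ ⟩
    step-const {d} eq x< = runs λ t₀ →
      trans (step eq t₀) (cong (λ v → run P w t₀ ⟨ suc ℓ , r [ d ≔ v ] , μ ⟩) (mod-< x<))

    step-add : ∀ {d a b v} → List.head (List.drop ℓ P) ≡ just (add d a b) → r a + r b ≡ v → v < 2 ^ w →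
               σ ↝[ P , 1 ] ⟨ suc ℓ , r [ d ≔ v ] , μ ⟩
    step-add {d} eq refl v< = runs λ t₀ →
      trans (step eq t₀) (cong (λ v → run P w t₀ ⟨ suc ℓ , r [ d ≔ v ] , μ ⟩) (mod-< v<))

    step-sub : ∀ {d a b v} → List.head (List.drop ℓ P) ≡ just (sub d a b) → r a ∸ r b ≡ v →
               σ ↝[ P , 1 ] ⟨ suc ℓ , r [ d ≔ v ] , μ ⟩
    step-sub eq refl = runs λ t₀ → step eq t₀

    step-load : ∀ {d a v} → List.head (List.drop ℓ P) ≡ just (load d a) → μ (r a) ≡ v →
                σ ↝[ P , 1 ] ⟨ suc ℓ , r [ d ≔ v ] , μ ⟩
    step-load eq refl = runs λ t₀ → step eq t₀

    step-store : ∀ {a b i v} → List.head (List.drop ℓ P) ≡ just (store a b) → r a ≡ i → r b ≡ v →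
                 σ ↝[ P , 1 ] ⟨ suc ℓ , r , μ [ i ≔ v ] ⟩
    step-store eq refl refl = runs λ t₀ → step eq t₀

    step-jump : ∀ {a ℓ′ v} → List.head (List.drop ℓ P) ≡ just (jpos a ℓ′) → r a ≡ suc v →
                σ ↝[ P , 1 ] ⟨ ℓ′ , r , μ ⟩
    step-jump {ℓ′ = ℓ′} eq ra = runs λ t₀ →
      trans (step eq t₀)
        (cong (λ v → run P w t₀ ⟨ (if v ≡ᵇ 0 then suc ℓ else ℓ′) , r , μ ⟩) ra)

    step-stay : ∀ {a ℓ′} → List.head (List.drop ℓ P) ≡ just (jpos a ℓ′) → r a ≡ 0 →
                σ ↝[ P , 1 ] ⟨ suc ℓ , r , μ ⟩
    step-stay {ℓ′ = ℓ′} eq ra = runs λ t₀ →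
      trans (step eq t₀)
        (cong (λ v → run P w t₀ ⟨ (if v ≡ᵇ 0 then suc ℓ else ℓ′) , r , μ ⟩) ra)

  record Outcome (P : Program) (σ : State) (t : ℕ) (ℓ′ : Label) (Q : Store → Set) : Set where
    constructor outcome
    field
      {time}  : ℕ
      {r′ μ′} : ℕ → ℕ
      {s′}    : Store
      time≤   : time ≤ t
      steps   : σ ↝[ P , time ] ⟨ ℓ′ , r′ , μ′ ⟩
      rep     : Rep r′ μ′ s′
      post    : Q s′

  -- A Hoare triple for total correctness with a time bound; it quantifies over the label, so the
  -- code may be placed anywhere in a program.
  record Tri (c : Cmd) (t : ℕ) (Q : Store → Set) (s : Store) : Set where
    constructor tri
    field
      apply : ∀ {P ℓ r μ} → At P ℓ (comp c ℓ) → Rep r μ s →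
              Outcome P ⟨ ℓ , r , μ ⟩ t (size c + ℓ) Q
  open Tri public

  H<2^w : ∀ {v} → v ≤ H → v < 2 ^ w
  H<2^w v≤H = ≤-<-trans (≤-trans v≤H (≤-trans (m≤n*m H 16) (m≤m+n (16 * H) (20 + 3 * m)))) fits

  20<2^w : ∀ {v} → v ≤ 20 → v < 2 ^ w
  20<2^w v≤ = ≤-<-trans (≤-trans v≤ (≤-trans (m≤m+n 20 (3 * m)) (m≤n+m (20 + 3 * m) (16 * H)))) fits

  addr<2^w : ∀ A {i} → i ≤ H → addr A i < 2 ^ w
  addr<2^w A {i} i≤H = ≤-<-trans (begin
    16 * i + base + codeA A ≤⟨ +-mono-≤ (+-monoˡ-≤ base (*-monoʳ-≤ 16 i≤H)) (<⇒≤ (codeA<16 A)) ⟩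
    16 * H + base + 16      ≡⟨ +-assoc (16 * H) base 16 ⟩
    16 * H + (base + 16)    ≤⟨ +-monoʳ-≤ (16 * H) (begin
      base + 16      ≡⟨ +-comm base 16 ⟩
      19 + 3 * m     ≤⟨ n≤1+n _ ⟩
      20 + 3 * m     ∎) ⟩
    16 * H + (20 + 3 * m)   ∎) fits
    where open ≤-Reasoning

  -- Array codes are below 16, so after removing `base` the residue modulo 16 recovers the array,
  -- and the rest the index.
  addr-injective : ∀ {A A′ i i′} → addr A i ≡ addr A′ i′ → codeA A ≡ codeA A′ × i ≡ i′
  addr-injective {A} {A′} {i} {i′} eq = A≡ , *-cancelˡ-≡ i i′ 16 (+-cancelʳ-≡ (codeA A) _ _ (trans eq″ (cong (16 * i′ +_) (sym A≡))))
    where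
    swap : ∀ A i → addr A i ≡ 16 * i + codeA A + base
    swap A i = trans (+-assoc (16 * i) base _) (trans (cong (16 * i +_) (+-comm base _)) (sym (+-assoc (16 * i) _ base)))
    eq″ : 16 * i + codeA A ≡ 16 * i′ + codeA A′
    eq″ = +-cancelʳ-≡ base _ _ (trans (sym (swap A i)) (trans eq (swap A′ i′)))
    residue : ∀ A i → codeA A ≡ (16 * i + codeA A) % 16
    residue A i = sym (trans (cong (_% 16) (trans (+-comm (16 * i) _) (cong (codeA A +_) (*-comm 16 i))))
                        (trans ([m+kn]%n≡m%n (codeA A) i 16) (m<n⇒m%n≡m (codeA<16 A))))
    A≡ : codeA A ≡ codeA A′
    A≡ = trans (residue A i) (trans (cong (_% 16) eq″) (sym (residue A′ i′)))

  private
    dbl : ∀ k i → k * i + k * i ≡ (k + k) * i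
    dbl k i = sym (*-distribʳ-+ i k k)

  16*≤ : ∀ {i} k → k ≤ 16 → i ≤ H → k * i < 2 ^ w
  16*≤ {i} k k≤ i≤H = ≤-<-trans (≤-trans (*-mono-≤ k≤ i≤H) (m≤m+n (16 * H) (20 + 3 * m))) fits

  addr-steps : ∀ {P ℓ r μ s} A y → At P ℓ (compAddr A y) → Rep r μ s → reg s y ≤ H →
               ∃[ r′ ] (⟨ ℓ , r , μ ⟩ ↝[ P , 7 ] ⟨ 7 + ℓ , r′ , μ ⟩ ×
                        r′ 0 ≡ addr A (reg s y) × Rep r′ μ s)
  addr-steps {P} {ℓ} {r} {μ} {s} A y (a₁ , a₂ , a₃ , a₄ , a₅ , a₆ , a₇ , _) R i≤H =
    _ ,
    (step-add a₁ (trans (cong₂ _+_ (trans yv (sym (*-identityˡ i))) (trans yv (sym (*-identityˡ i)))) (dbl 1 i)) (16*≤ 2 (≤ᵇ⇒≤ 2 16 tt) i≤H) ⨾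
     step-add a₂ (dbl 2 i) (16*≤ 4 (≤ᵇ⇒≤ 4 16 tt) i≤H) ⨾
     step-add a₃ (dbl 4 i) (16*≤ 8 (≤ᵇ⇒≤ 8 16 tt) i≤H) ⨾
     step-add a₄ (dbl 8 i) (16*≤ 16 ≤-refl i≤H) ⨾
     step-add a₅ (cong (16 * i +_) (base≡ R)) (≤-<-trans (m≤m+n _ (codeA A)) (addr<2^w A i≤H)) ⨾
     step-const a₆ (20<2^w (≤-trans (<⇒≤ (codeA<16 A)) (≤ᵇ⇒≤ 16 20 tt))) ⨾
     step-add a₇ refl (addr<2^w A i≤H)) ,
    refl , mkRep (vars R) (base≡ R) (arrays R) (input R)
    where
    i : ℕ
    i = reg s y
    yv : r (ρ y) ≡ i
    yv = vars R y

  set-rep : ∀ {r μ s} x {v} → Rep r μ s → Rep (r [ ρ x ≔ v ]) μ (setv x v s)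
  set-rep x {v} R = mkRep
    (λ y → cong (λ t → if codeV y ≡ᵇ codeV x then v else t) (vars R y))
    (base≡ R) (arrays R) (input R)

  scratch-rep : ∀ {r μ s v} → Rep r μ s → Rep (r [ 0 ≔ v ]) μ s
  scratch-rep R = mkRep (vars R) (base≡ R) (arrays R) (input R)

  store-rep : ∀ {r μ s} A i {v} → Rep r μ s → Rep r (μ [ addr A i ≔ v ]) (seta A i v s)
  store-rep {r} {μ} {s} A i {v} R = mkRep (vars R) (base≡ R) arrays′ input′
    where
    arrays′ : ∀ A′ i′ → (μ [ addr A i ≔ v ]) (addr A′ i′) ≡ arr (seta A i v s) A′ i′
    arrays′ A′ i′ with codeA A′ ≟ codeA A | i′ ≟ i
    ... | yes A≡ | yes i≡ = trans ([≔]-same μ (addr A i) v (cong₂ (λ a j → 16 * j + base + a) A≡ i≡))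
            (sym (trans (cong-app (seta-same i v s A≡) i′) ([≔]-same (arr s A′) i v i≡)))
    ... | yes A≡ | no i≢  = trans ([≔]-other μ (addr A i) v (λ eq → i≢ (proj₂ (addr-injective {A′} {A} {i′} {i} eq))))
            (trans (arrays R A′ i′) (sym (trans (cong-app (seta-same i v s A≡) i′) ([≔]-other (arr s A′) i v i≢))))
    ... | no A≢  | _      = trans ([≔]-other μ (addr A i) v (λ eq → A≢ (proj₁ (addr-injective {A′} {A} {i′} {i} eq))))
            (trans (arrays R A′ i′) (sym (cong-app (seta-other i v s A≢) i′)))
    -- The rows up to m end below `base`, where the arrays begin, so no store overwrites the input.
    input′ : ∀ F j → j ≤ m → (μ [ addr A i ≔ v ]) (3 * j + codeF F) ≡ fld F j
    input′ F j j≤m = trans ([≔]-other μ (addr A i) v (<⇒≢ lt)) (input R F j j≤m)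
      where
      lt : 3 * j + codeF F < addr A i
      lt = ≤-trans (s≤s (≤-trans (+-mono-≤ (*-monoʳ-≤ 3 j≤m) (codeF≤2 F)) (≤-reflexive (+-comm (3 * m) 2))))
             (≤-trans (m≤n+m base (16 * i)) (m≤m+n _ (codeA A)))

  -- The value assigned by each command is named explicitly, since the terms for
  -- the stores would otherwise grow exponentially with the number of commands.
  wp : Cmd → (Store → Set) → Store → Set
  wp skip          Q s = Q s
  wp (lit x n)     Q s = n ≤ H × Q (setv x n s)
  wp (mov x y)     Q s = ∃[ v ] (reg s y ≡ v × Q (setv x v s))
  wp (inc x y)     Q s = ∃[ v ] (reg s y ≡ v × suc v ≤ H × Q (setv x (suc v) s))
  wp (dec x y)     Q s = ∃[ v ] (pred (reg s y) ≡ v × Q (setv x v s))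
  wp (plus x y z)  Q s = ∃[ v ] (reg s y + reg s z ≡ v × v ≤ H × Q (setv x v s))
  wp (minus x y z) Q s = ∃[ v ] (reg s y ∸ reg s z ≡ v × Q (setv x v s))
  wp (get x A y)   Q s = ∃[ i ] (reg s y ≡ i × i ≤ H × ∃[ v ] (arr s A i ≡ v × Q (setv x v s)))
  wp (put A y x)   Q s = ∃[ i ] (reg s y ≡ i × i ≤ H × ∃[ v ] (reg s x ≡ v × Q (seta A i v s)))
  wp (inp x F y)   Q s = ∃[ i ] (reg s y ≡ i × i ≤ m × Q (setv x (fld F i) s))
  wp (c ⨟ d)       Q s = wp c (wp d Q) s
  wp (ifp y a b)   Q s = (∀ {v} → reg s y ≡ suc v → wp a Q s) × (reg s y ≡ 0 → wp b Q s)
  -- Loops have no weakest precondition here; they are handled by `Tri-while` alone.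
  wp (while y c)   Q s = ⊥

  wp-mono : ∀ c {Q Q′ : Store → Set} → (∀ {s} → Q s → Q′ s) → ∀ {s} → wp c Q s → wp c Q′ s
  wp-mono skip          f q                     = f q
  wp-mono (lit x n)     f (h , q)               = h , f q
  wp-mono (mov x y)     f (v , eq , q)          = v , eq , f q
  wp-mono (inc x y)     f (v , eq , h , q)      = v , eq , h , f q
  wp-mono (dec x y)     f (v , eq , q)          = v , eq , f q
  wp-mono (plus x y z)  f (v , eq , h , q)      = v , eq , h , f q
  wp-mono (minus x y z) f (v , eq , q)          = v , eq , f q
  wp-mono (get x A y)   f (i , eq , h , v , eq′ , q) = i , eq , h , v , eq′ , f q
  wp-mono (put A y x)   f (i , eq , h , v , eq′ , q) = i , eq , h , v , eq′ , f q
  wp-mono (inp x F y)   f (i , eq , h , q)      = i , eq , h , f q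
  wp-mono (c ⨟ d)       f q                     = wp-mono c (wp-mono d f) q
  wp-mono (ifp y a b)   f (g , h) = (λ eq → wp-mono a f (g eq)) , (λ eq → wp-mono b f (h eq))

  Tri-post : ∀ {c t s} {Q Q′ : Store → Set} → (∀ {s} → Q s → Q′ s) → Tri c t Q s → Tri c t Q′ s
  Tri-post f h = tri λ at R → let open Outcome (apply h at R) in outcome time≤ steps rep (f post)

  Tri-seq : ∀ {c d t₁ t₂ s} {Q R : Store → Set} →
            Tri c t₁ R s → (∀ {s} → R s → Tri d t₂ Q s) → Tri (c ⨟ d) (t₁ + t₂) Q s
  Tri-seq {c} {d} {t₁} {t₂} {s} {Q} h k = tri run-both
    where
    run-both : ∀ {P ℓ r μ} → At P ℓ (comp (c ⨟ d) ℓ) → Rep r μ s →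
               Outcome P ⟨ ℓ , r , μ ⟩ (t₁ + t₂) (size c + size d + ℓ) Q
    run-both {P} {ℓ} at rep₀ = outcome
      (+-mono-≤ O₁.time≤ O₂.time≤)
      (relabel end (O₁.steps ⨾ O₂.steps)) O₂.rep O₂.post
      where
      ats = At-++ P ℓ (comp c ℓ) at
      module O₁ = Outcome (apply h (proj₁ ats) rep₀)
      at₂ : At P (size c + ℓ) (comp d (size c + ℓ))
      at₂ = subst₂ (λ a b → At P (a + ℓ) (comp d b)) (length-comp c ℓ) (+-comm ℓ (size c)) (proj₂ ats)
      module O₂ = Outcome (apply (k O₁.post) at₂ O₁.rep)
      end : size d + (size c + ℓ) ≡ size c + size d + ℓ
      end = trans (sym (+-assoc (size d) (size c) ℓ)) (cong (_+ ℓ) (+-comm (size d) (size c)))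

  Tri-if : ∀ {y a b t₁ t₂ s} {Q : Store → Set} →
           (∀ {v} → reg s y ≡ suc v → Tri a t₁ Q s) → (reg s y ≡ 0 → Tri b t₂ Q s) →
           Tri (ifp y a b) (3 + (t₁ + t₂)) Q s
  Tri-if {y} {a} {b} {t₁} {t₂} {s} {Q} ha hb = tri branch
    where
    branch : ∀ {P ℓ r μ} → At P ℓ (comp (ifp y a b) ℓ) → Rep r μ s →
             Outcome P ⟨ ℓ , r , μ ⟩ (3 + (t₁ + t₂)) (3 + size b + size a + ℓ) Q
    branch {P} {ℓ} {r} {μ} (jp , at) R = go (reg s y) refl
      where
      ats = At-++ P (suc ℓ) (comp b (suc ℓ)) at
      shift : List.length (comp b (suc ℓ)) + suc ℓ ≡ suc (size b + ℓ)
      shift = trans (cong (_+ suc ℓ) (length-comp b (suc ℓ))) (+-suc (size b) ℓ)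
      exit : List Instr
      exit = const 0 1 ∷ jpos 0 (size a + (3 + size b + ℓ)) ∷ comp a (3 + size b + ℓ)
      rest : At P (suc (size b + ℓ)) exit
      rest = subst (λ ℓ′ → At P ℓ′ exit) shift (proj₂ ats)
      end : size a + (3 + size b + ℓ) ≡ 3 + size b + size a + ℓ
      end = trans (sym (+-assoc (size a) (3 + size b) ℓ)) (cong (_+ ℓ) (+-comm (size a) (3 + size b)))
      go : ∀ v → reg s y ≡ v → Outcome P ⟨ ℓ , r , μ ⟩ (3 + (t₁ + t₂)) (3 + size b + size a + ℓ) Q
      go (suc v) eq = outcome
        (≤-trans (s≤s O.time≤) (≤-trans (s≤s (m≤m+n t₁ t₂)) (s≤s (m≤n+m (t₁ + t₂) 2))))
        (step-jump jp (trans (vars R y) eq) ⨾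
         relabel end O.steps)
        O.rep O.post
        where module O = Outcome (apply (ha eq) (proj₂ (proj₂ rest)) R)
      go zero eq = outcome
        (s≤s (≤-trans (+-monoˡ-≤ 2 O.time≤) (≤-trans (≤-reflexive (+-comm t₂ 2)) (s≤s (s≤s (m≤n+m t₂ t₁))))))
        (step-stay jp (trans (vars R y) eq) ⨾
         relabel (+-suc (size b) ℓ) O.steps ⨾
         step-const (proj₁ rest) (20<2^w (s≤s z≤n)) ⨾
         relabel end (step-jump (proj₁ (proj₂ rest)) refl))
        (scratch-rep O.rep) O.post
        where module O = Outcome (apply (hb eq) (proj₁ ats) R)

  Tri-wp : ∀ c {Q s} → wp c Q s → Tri c (cost c) Q s
  Tri-wp skip q = tri λ at R → outcome z≤n ↝-refl R q
  Tri-wp (lit x n) (n≤ , q) = tri λ (a , _) R → outcome ≤-refl (step-const a (H<2^w n≤)) (set-rep x R) q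
  Tri-wp (mov x y) (_ , refl , q) = tri λ (a , b , _) R → outcome ≤-refl
    (step-const a (20<2^w z≤n) ⨾ step-sub b (vars R y))
    (set-rep x (scratch-rep R)) q
  Tri-wp (inc x y) {s = s} (_ , refl , h , q) = tri λ (a , b , _) R → outcome ≤-refl
    (step-const a (20<2^w (s≤s z≤n)) ⨾ step-add b (trans (cong (_+ 1) (vars R y)) (+-comm (reg s y) 1)) (H<2^w h))
    (set-rep x (scratch-rep R)) q
  Tri-wp (dec x y) {s = s} (_ , refl , q) = tri λ (a , b , _) R → outcome ≤-refl
    (step-const a (20<2^w (s≤s z≤n)) ⨾ step-sub b (trans (cong (_∸ 1) (vars R y)) (∸1 (reg s y))))
    (set-rep x (scratch-rep R)) q
    where
    ∸1 : ∀ n → n ∸ 1 ≡ pred n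
    ∸1 zero    = refl
    ∸1 (suc n) = refl
  Tri-wp (plus x y z) (_ , refl , h , q) = tri λ (a , _) R → outcome ≤-refl
    (step-add a (cong₂ _+_ (vars R y) (vars R z)) (H<2^w h)) (set-rep x R) q
  Tri-wp (minus x y z) (_ , refl , q) = tri λ (a , _) R → outcome ≤-refl
    (step-sub a (cong₂ _∸_ (vars R y) (vars R z))) (set-rep x R) q
  Tri-wp (get x A y) {s = s} (_ , refl , h , _ , refl , q) = tri λ {P} {ℓ} {r} {μ} at R →
    let at₁ , (a , _) = At-++ P ℓ (compAddr A y) at
        r₁ , st , eq , R₁ = addr-steps A y at₁ R h
    in outcome ≤-refl (st ⨾ step-load a (trans (cong μ eq) (arrays R A (reg s y)))) (set-rep x R₁) q
  Tri-wp (put A y x) {s = s} (_ , refl , h , _ , refl , q) = tri λ {P} {ℓ} {r} {μ} at R →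
    let at₁ , (a , _) = At-++ P ℓ (compAddr A y) at
        r₁ , st , eq , R₁ = addr-steps A y at₁ R h
    in outcome ≤-refl (st ⨾ step-store a eq (vars R₁ x)) (store-rep A (reg s y) R₁) q
  Tri-wp (inp x F y) {s = s} (_ , refl , h , q) = tri λ (a₁ , a₂ , a₃ , a₄ , a₅ , _) R → let yv = vars R y in outcome ≤-refl
    (step-add a₁ (cong₂ _+_ yv yv) (below (≤-trans (+-monoʳ-≤ i (m≤m+n i _)) (m≤m+n _ 2))) ⨾
     step-add a₂ (trans (cong (i + i +_) yv) (trans (+-assoc i i i) (cong (λ j → i + (i + j)) (sym (+-identityʳ i))))) (below (m≤m+n (3 * i) 2)) ⨾
     step-const a₃ (20<2^w (≤-trans (codeF≤2 F) (s≤s (s≤s z≤n)))) ⨾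
     step-add a₄ refl (below (+-monoʳ-≤ (3 * i) (codeF≤2 F))) ⨾
     step-load a₅ (input R F i h))
    (set-rep x (mkRep (vars R) (base≡ R) (arrays R) (input R))) q
    where
    i : ℕ
    i = reg s y
    below : ∀ {v} → v ≤ 3 * i + 2 → v < 2 ^ w
    below v≤ = ≤-<-trans (≤-trans v≤ (≤-trans (+-monoˡ-≤ 2 (*-monoʳ-≤ 3 h))
      (≤-trans (≤-reflexive (+-comm (3 * m) 2)) (≤-trans (+-monoˡ-≤ (3 * m) (≤ᵇ⇒≤ 2 20 tt)) (m≤n+m (20 + 3 * m) (16 * H)))))) fits
  Tri-wp (c ⨟ d) q = Tri-seq {c} {d} (Tri-wp c q) (Tri-wp d)
  Tri-wp (ifp y a b) (g , h) = Tri-if {y} {a} {b} (λ eq → Tri-wp a (g eq)) (λ eq → Tri-wp b (h eq))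

  -- Each round lowers `μ`, so there are at most `n` of them, each costing `t` and a successful
  -- test. The 3 pays for the two instructions that enter the loop and for the last test.
  Tri-while : ∀ {y c} t (I : Store → Set) (μ : Store → ℕ) →
    (∀ {s v} → I s → reg s y ≡ suc v → Tri c t (λ s′ → I s′ × μ s′ < μ s) s) →
    ∀ {s n} → I s → μ s ≤ n → Tri (while y c) (3 + n * suc t) (λ s′ → I s′ × reg s′ y ≡ 0) s
  Tri-while {y} {c} t I μ body {n = n} inv₀ μ≤₀ = tri iterate
    where
    iterate : ∀ {P ℓ r m′} → At P ℓ (comp (while y c) ℓ) → Rep r m′ _ →
              Outcome P ⟨ ℓ , r , m′ ⟩ (3 + n * suc t) (3 + size c + ℓ) (λ s′ → I s′ × reg s′ y ≡ 0)
    iterate {P} {ℓ} (a₁ , a₂ , at) R₀ =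
      let open Outcome (loop n inv₀ μ≤₀ (scratch-rep R₀))
      in outcome (s≤s (s≤s time≤)) (step-const a₁ (20<2^w (s≤s z≤n)) ⨾ step-jump a₂ refl ⨾ steps) rep post
      where
      ats = At-++ P (2 + ℓ) (comp c (2 + ℓ)) at
      test : ℕ
      test = size c + (2 + ℓ)
      jp : List.head (List.drop test P) ≡ just (jpos (ρ y) (2 + ℓ))
      jp = subst (λ k → List.head (List.drop (k + (2 + ℓ)) P) ≡ just (jpos (ρ y) (2 + ℓ))) (length-comp c (2 + ℓ)) (proj₁ (proj₂ ats))
      end : suc test ≡ 3 + size c + ℓ
      end = cong suc (trans (+-suc (size c) (suc ℓ)) (cong suc (+-suc (size c) ℓ)))
      loop : ∀ n {s r m′} → I s → μ s ≤ n → Rep r m′ s →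
             Outcome P ⟨ test , r , m′ ⟩ (1 + n * suc t) (3 + size c + ℓ) (λ s′ → I s′ × reg s′ y ≡ 0)
      loop n {s} {r} {m′} inv μ≤ R = go (reg s y) refl n μ≤
        where
        go : ∀ v → reg s y ≡ v → ∀ n → μ s ≤ n →
             Outcome P ⟨ test , r , m′ ⟩ (1 + n * suc t) (3 + size c + ℓ) (λ s′ → I s′ × reg s′ y ≡ 0)
        go zero eq n _ = outcome (s≤s z≤n)
          (relabel end (step-stay jp (trans (vars R y) eq))) R (inv , eq)
        go (suc v) eq n μ≤ with apply (body inv eq) (proj₁ ats) R
        ... | outcome time≤ steps rep (inv′ , μ<) with n
        ...   | zero = ⊥-elim (n≮0 (≤-trans μ< μ≤))
        ...   | suc n =
          let O = loop n inv′ (s≤s⁻¹ (≤-trans μ< μ≤)) rep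
              module O = Outcome O
          in outcome (s≤s (≤-trans (+-mono-≤ time≤ O.time≤) (≤-reflexive (+-suc t (n * suc t)))))
               (step-jump jp (trans (vars R y) eq) ⨾ steps ⨾ O.steps) O.rep O.post

-- Matchings and duality

-- Indices run from 1 to n.
∑ : ℕ → (ℕ → ℕ) → ℕ
∑ zero    f = 0
∑ (suc n) f = f (suc n) + ∑ n f

∑-mono : ∀ n {f g} → (∀ i → 1 ≤ i → i ≤ n → f i ≤ g i) → ∑ n f ≤ ∑ n g
∑-mono zero    f≤g = z≤n
∑-mono (suc n) f≤g =
  +-mono-≤ (f≤g (suc n) (s≤s z≤n) ≤-refl) (∑-mono n λ i 1≤i i≤n → f≤g i 1≤i (m≤n⇒m≤1+n i≤n))

-- This keeps the gain at one index; it is how a single step of the algorithm shows in a sum over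
-- all edges.
∑-mono-at : ∀ n {f g} k {d} → 1 ≤ k → k ≤ n → (∀ i → 1 ≤ i → i ≤ n → f i ≤ g i) →
            f k + d ≤ g k → ∑ n f + d ≤ ∑ n g
∑-mono-at zero    k 1≤k k≤0 = ⊥-elim (<⇒≱ 1≤k k≤0)
∑-mono-at (suc n) {f} {g} k {d} 1≤k k≤ f≤g at with k ≟ suc n
... | yes refl = begin
      f k + ∑ n f + d   ≡⟨ +-assoc (f k) _ d ⟩
      f k + (∑ n f + d) ≡⟨ cong (f k +_) (+-comm _ d) ⟩
      f k + (d + ∑ n f) ≡⟨ sym (+-assoc (f k) d _) ⟩
      f k + d + ∑ n f   ≤⟨ +-mono-≤ at (∑-mono n λ i 1≤i i≤n → f≤g i 1≤i (m≤n⇒m≤1+n i≤n)) ⟩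
      g k + ∑ n g       ∎
  where open ≤-Reasoning
... | no k≢ = begin
      f (suc n) + ∑ n f + d   ≡⟨ +-assoc (f (suc n)) _ d ⟩
      f (suc n) + (∑ n f + d) ≤⟨ +-mono-≤ (f≤g (suc n) (s≤s z≤n) ≤-refl)
                                   (∑-mono-at n k 1≤k (s≤s⁻¹ (≤∧≢⇒< k≤ k≢))
                                     (λ i 1≤i i≤n → f≤g i 1≤i (m≤n⇒m≤1+n i≤n)) at) ⟩
      g (suc n) + ∑ n g       ∎
  where open ≤-Reasoning

∑-cong : ∀ n {f g} → (∀ i → 1 ≤ i → i ≤ n → f i ≡ g i) → ∑ n f ≡ ∑ n g
∑-cong zero    f≡g = refl
∑-cong (suc n) f≡g =
  cong₂ _+_ (f≡g (suc n) (s≤s z≤n) ≤-refl) (∑-cong n λ i 1≤i i≤n → f≡g i 1≤i (m≤n⇒m≤1+n i≤n))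

-- Adding the two differing terms crosswise avoids truncated subtraction.
∑-differ : ∀ n {f g} k → 1 ≤ k → k ≤ n → (∀ i → 1 ≤ i → i ≢ k → f i ≡ g i) → ∑ n f + g k ≡ ∑ n g + f k
∑-differ zero    k 1≤k k≤0 = ⊥-elim (<⇒≱ 1≤k k≤0)
∑-differ (suc n) {f} {g} k 1≤k k≤ same with k ≟ suc n
... | yes refl = begin
      f k + ∑ n f + g k   ≡⟨ cong (λ S → f k + S + g k) (∑-cong n λ i 1≤i i≤n → same i 1≤i (<⇒≢ (s≤s i≤n))) ⟩
      f k + ∑ n g + g k   ≡⟨ +-comm (f k + ∑ n g) (g k) ⟩
      g k + (f k + ∑ n g) ≡⟨ cong (g k +_) (+-comm (f k) _) ⟩
      g k + (∑ n g + f k) ≡⟨ sym (+-assoc (g k) _ _) ⟩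
      g k + ∑ n g + f k   ∎
  where open ≡-Reasoning
... | no k≢ = begin
      f (suc n) + ∑ n f + g k   ≡⟨ +-assoc (f (suc n)) _ _ ⟩
      f (suc n) + (∑ n f + g k) ≡⟨ cong₂ _+_ (same (suc n) (s≤s z≤n) (λ eq → k≢ (sym eq)))
                                     (∑-differ n k 1≤k (s≤s⁻¹ (≤∧≢⇒< k≤ k≢)) same) ⟩
      g (suc n) + (∑ n g + f k) ≡⟨ sym (+-assoc (g (suc n)) _ _) ⟩
      g (suc n) + ∑ n g + f k   ∎
  where open ≡-Reasoning

∑-distrib-+ : ∀ n f g → ∑ n (λ i → f i + g i) ≡ ∑ n f + ∑ n g
∑-distrib-+ zero    f g = refl
∑-distrib-+ (suc n) f g =
  trans (cong (f (suc n) + g (suc n) +_) (∑-distrib-+ n f g))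
        (interchange (f (suc n)) (g (suc n)) (∑ n f) (∑ n g))

∑-distrib-* : ∀ n c f → ∑ n (λ i → c * f i) ≡ c * ∑ n f
∑-distrib-* zero    c f = sym (*-zeroʳ c)
∑-distrib-* (suc n) c f =
  trans (cong (c * f (suc n) +_) (∑-distrib-* n c f)) (sym (*-distribˡ-+ c (f (suc n)) (∑ n f)))

∑-≤-* : ∀ n {f} d → (∀ i → 1 ≤ i → i ≤ n → f i ≤ d) → ∑ n f ≤ n * d
∑-≤-* zero    d f≤ = z≤n
∑-≤-* (suc n) d f≤ =
  +-mono-≤ (f≤ (suc n) (s≤s z≤n) ≤-refl) (∑-≤-* n d λ i 1≤i i≤n → f≤ i 1≤i (m≤n⇒m≤1+n i≤n))

positive : ℕ → ℕ
positive zero    = 0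
positive (suc _) = 1

positive-mono : ∀ {a b} → a ≤ b → positive a ≤ positive b
positive-mono z≤n     = z≤n
positive-mono (s≤s _) = ≤-refl

positive≤1 : ∀ a → positive a ≤ 1
positive≤1 zero    = z≤n
positive≤1 (suc a) = ≤-refl

positive-≢0 : ∀ {a} → a ≢ 0 → positive a ≡ 1
positive-≢0 {zero}  a≢0 = ⊥-elim (a≢0 refl)
positive-≢0 {suc a} a≢0 = refl

-- Index 0 stands for "unmatched".
record HalfMatching (_~_ : ℕ → ℕ → Set) (f g : ℕ → ℕ) : Set where
  field
    null     : f 0 ≡ 0
    inverse  : ∀ {u} → f u ≢ 0 → g (f u) ≡ u
    relates  : ∀ {u} → f u ≢ 0 → u ~ f u
open HalfMatching public

-- The old partners `g e` and `f u` are released before `u` and `e` are joined; when one of them is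
-- 0, its update just rewrites the null value at index 0. The hypotheses on `g` are those that let
-- the lemma be applied again with the two sides exchanged.
rematch-half : ∀ {_~_ f g u e} → HalfMatching _~_ f g → (∀ {e} → g e ≢ 0 → f (g e) ≡ e) → g 0 ≡ 0 →
               u ≢ 0 → e ≢ 0 → u ~ e →
               HalfMatching _~_ (f [ g e ≔ 0 ] [ u ≔ e ]) (g [ f u ≔ 0 ] [ e ≔ u ])
rematch-half {_~_} {f} {g} {u} {e} M back g0 u≢0 e≢0 u~e = record
  { null    = trans (at-other (λ eq → u≢0 (sym eq))) null′
  ; inverse = λ {v} → inverse′ v
  ; relates = λ {v} → relates′ v
  }
  where
  f₁ f′ g′ : ℕ → ℕ
  f₁ = f [ g e ≔ 0 ]
  f′ = f₁ [ u ≔ e ]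
  g′ = g [ f u ≔ 0 ] [ e ≔ u ]
  at-u : ∀ {v} → v ≡ u → f′ v ≡ e
  at-u = [≔]-same f₁ u e
  at-other : ∀ {v} → v ≢ u → f′ v ≡ f₁ v
  at-other = [≔]-other f₁ u e
  null′ : f₁ 0 ≡ 0
  null′ with 0 ≟ g e
  ... | yes eq = [≔]-same f (g e) 0 eq
  ... | no  ne = trans ([≔]-other f (g e) 0 ne) (null M)
  old : ∀ v → v ≢ u → f′ v ≢ 0 → v ≢ g e × f′ v ≡ f v × f v ≢ 0
  old v v≢u f′v≢0 = v≢ge , f′v≡ , λ eq → f′v≢0 (trans f′v≡ eq)
    where
    v≢ge : v ≢ g e
    v≢ge eq = f′v≢0 (trans (at-other v≢u) ([≔]-same f (g e) 0 eq))
    f′v≡ : f′ v ≡ f v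
    f′v≡ = trans (at-other v≢u) ([≔]-other f (g e) 0 v≢ge)
  inverse′ : ∀ v → f′ v ≢ 0 → g′ (f′ v) ≡ v
  inverse′ v f′v≢0 with v ≟ u
  ... | yes refl = trans (cong g′ (at-u {u} refl)) ([≔]-same (g [ f u ≔ 0 ]) e u {e} refl)
  ... | no v≢u =
    let v≢ge , f′v≡ , fv≢0 = old v v≢u f′v≢0
        gfv : g (f v) ≡ v
        gfv = inverse M fv≢0
    in trans (cong g′ f′v≡)
        (trans ([≔]-other (g [ f u ≔ 0 ]) e u (λ eq → v≢ge (trans (sym gfv) (cong g eq))))
        (trans ([≔]-other g (f u) 0 (λ eq →
                  v≢u (trans (sym gfv) (trans (cong g eq) (inverse M (λ fu≡0 → fv≢0 (trans eq fu≡0)))))))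
               gfv))
  relates′ : ∀ v → f′ v ≢ 0 → v ~ f′ v
  relates′ v f′v≢0 with v ≟ u
  ... | yes refl = subst (u ~_) (sym (at-u {u} refl)) u~e
  ... | no v≢u =
    let _ , f′v≡ , fv≢0 = old v v≢u f′v≢0 in subst (v ~_) (sym f′v≡) (relates M fv≢0)

-- The edges are numbered from 1 to m; a, b are their ends, c their colours.
module Graph (m : ℕ) (a b c : ℕ → ℕ) where

  Coloured : ℕ → ℕ → Set
  Coloured k e = 1 ≤ e × e ≤ m × c e ≡ k

  Left Right : ℕ → Set
  Left  = Coloured 1
  Right = Coloured 2

  End : ℕ → ℕ → Set
  End x e = a e ≡ x ⊎ b e ≡ x

  Conflict : ℕ → ℕ → Set
  Conflict u e = Left u × Right e × ∃[ x ] (End x u × End x e)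

  record Matching (mate owner : ℕ → ℕ) : Set where
    field
      left  : HalfMatching Conflict mate owner
      right : HalfMatching (λ e u → Conflict u e) owner mate
  open Matching public

  matched : (ℕ → ℕ) → ℕ
  matched mate = ∑ m (λ u → positive (mate u))

  coloured≢0 : ∀ {k e} → Coloured k e → e ≢ 0
  coloured≢0 (() , _) refl

  left-right : ∀ {i} → Left i → Right i → ⊥
  left-right (_ , _ , ci≡1) (_ , _ , ci≡2) with () ← trans (sym ci≡1) ci≡2

  rematch : ∀ {mate owner u e} → Matching mate owner → Conflict u e →
            Matching (mate [ owner e ≔ 0 ] [ u ≔ e ]) (owner [ mate u ≔ 0 ] [ e ≔ u ])
  rematch M k@(l , r , _) = record
    { left  = rematch-half (left M) (inverse (right M)) (null (right M)) (coloured≢0 l) (coloured≢0 r) k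
    ; right = rematch-half (right M) (inverse (left M)) (null (left M)) (coloured≢0 r) (coloured≢0 l) k
    }

  -- The indicator function of 1 ≤ i ≤ k.
  below : ℕ → ℕ → ℕ
  below k i = positive i * positive (suc k ∸ i)

  ∑-reindex : ∀ {_~_ f g} → HalfMatching _~_ f g → (∀ {u e} → u ~ e → 1 ≤ e × e ≤ m) → (h : ℕ → ℕ) →
              ∑ m (λ u → positive (f u) * h (f u)) ≤ ∑ m (λ e → positive (g e) * h e)
  ∑-reindex {_} {f} {g} M range h = ≤-trans (upto m) (∑-mono m λ e _ _ → *-monoˡ-≤ (h e) (below≤ (g e)))
    where
    below≤ : ∀ i → below m i ≤ positive i
    below≤ i = ≤-trans (*-monoʳ-≤ (positive i) (positive≤1 (suc m ∸ i))) (≤-reflexive (*-identityʳ _))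
    below-mono : ∀ k i → below k i ≤ below (suc k) i
    below-mono k i = *-monoʳ-≤ (positive i) (positive-mono (∸-monoˡ-≤ i (n≤1+n (suc k))))
    grow : ∀ k → below k (suc k) + 1 ≤ below (suc k) (suc k)
    grow k rewrite n∸n≡0 k | m+n∸n≡m 1 k = ≤-refl
    upto : ∀ k → ∑ k (λ u → positive (f u) * h (f u)) ≤ ∑ m (λ e → below k (g e) * h e)
    upto zero    = z≤n
    upto (suc k) = go (f (suc k)) refl
      where
      mono : ∀ i → 1 ≤ i → i ≤ m → below k (g i) * h i ≤ below (suc k) (g i) * h i
      mono i _ _ = *-monoˡ-≤ (h i) (below-mono k (g i))
      go : ∀ e → f (suc k) ≡ e → positive (f (suc k)) * h (f (suc k)) + ∑ k (λ u → positive (f u) * h (f u))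
           ≤ ∑ m (λ e → below (suc k) (g e) * h e)
      go zero    eq rewrite eq = ≤-trans (upto k) (∑-mono m mono)
      go e@(suc _) eq = begin
        positive (f (suc k)) * h (f (suc k)) + S ≡⟨ cong (λ v → positive v * h v + S) eq ⟩
        1 * h e + S                              ≡⟨ cong (_+ S) (*-identityˡ (h e)) ⟩
        h e + S                                  ≡⟨ +-comm (h e) S ⟩
        S + h e                                  ≤⟨ +-monoˡ-≤ (h e) (upto k) ⟩
        ∑ m (λ e → below k (g e) * h e) + h e    ≤⟨ ∑-mono-at m e (proj₁ rng) (proj₂ rng) mono at ⟩
        ∑ m (λ e → below (suc k) (g e) * h e)    ∎
        where
        open ≤-Reasoning
        S : ℕ
        S = ∑ k (λ u → positive (f u) * h (f u))
        f≢0 : f (suc k) ≢ 0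
        f≢0 eq′ with () ← trans (sym eq) eq′
        rng : 1 ≤ e × e ≤ m
        rng = subst (λ e → 1 ≤ e × e ≤ m) eq (range (relates M f≢0))
        ge : g e ≡ suc k
        ge = trans (cong g (sym eq)) (inverse M f≢0)
        at : below k (g e) * h e + h e ≤ below (suc k) (g e) * h e
        at = begin
          below k (g e) * h e + h e     ≡⟨ cong (below k (g e) * h e +_) (sym (*-identityˡ (h e))) ⟩
          below k (g e) * h e + 1 * h e ≡⟨ sym (*-distribʳ-+ (h e) (below k (g e)) 1) ⟩
          (below k (g e) + 1) * h e     ≡⟨ cong (λ v → (below k v + 1) * h e) ge ⟩
          (below k (suc k) + 1) * h e   ≤⟨ *-monoˡ-≤ (h e) (grow k) ⟩
          below (suc k) (suc k) * h e   ≡⟨ cong (λ v → below (suc k) v * h e) (sym ge) ⟩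
          below (suc k) (g e) * h e     ∎

  module _ {mate owner} (M : Matching mate owner) where

    private
      conflict-right : ∀ {u e} → Conflict u e → 1 ≤ e × e ≤ m
      conflict-right (_ , (1≤e , e≤m , _) , _) = 1≤e , e≤m
      conflict-left : ∀ {e u} → Conflict u e → 1 ≤ u × u ≤ m
      conflict-left ((1≤u , u≤m , _) , _) = 1≤u , u≤m

      suc≢0 : ∀ {i j n} → j ≡ suc n → i ≡ j → i ≢ 0
      suc≢0 refl refl ()

    -- `Z` is a vertex cover in units of 1/D, as far as the pairs of the matching see it. Each pair
    -- is charged to its two members; no index is both a left and a right member, so no `Z i` is
    -- charged twice.
    weak-duality : ∀ D Z → (∀ {u} → mate u ≢ 0 → D ≤ Z u + Z (mate u)) → D * matched mate ≤ ∑ m Z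
    weak-duality D Z ok = begin
      D * matched mate
        ≡⟨ sym (∑-distrib-* m D _) ⟩
      ∑ m (λ u → D * positive (mate u))
        ≤⟨ ∑-mono m (λ u _ _ → pointwise u (mate u) refl) ⟩
      ∑ m (λ u → positive (mate u) * Z u + positive (mate u) * Z (mate u))
        ≡⟨ ∑-distrib-+ m _ _ ⟩
      ∑ m (λ u → positive (mate u) * Z u) + ∑ m (λ u → positive (mate u) * Z (mate u))
        ≤⟨ +-monoʳ-≤ _ (∑-reindex (left M) conflict-right Z) ⟩
      ∑ m (λ u → positive (mate u) * Z u) + ∑ m (λ e → positive (owner e) * Z e)
        ≡⟨ sym (∑-distrib-+ m _ _) ⟩
      ∑ m (λ i → positive (mate i) * Z i + positive (owner i) * Z i)
        ≤⟨ ∑-mono m (λ i _ _ → exclusive i) ⟩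
      ∑ m Z ∎
      where
      open ≤-Reasoning
      pointwise : ∀ u e → mate u ≡ e → D * positive (mate u) ≤ positive (mate u) * Z u + positive (mate u) * Z (mate u)
      pointwise u zero    eq = subst (λ v → D * positive v ≤ positive v * Z u + positive v * Z v) (sym eq) (≤-reflexive (*-zeroʳ D))
      pointwise u (suc e) eq = begin
        D * positive (mate u)   ≡⟨ trans (cong (D *_) (positive-≢0 u≢0)) (*-identityʳ D) ⟩
        D                       ≤⟨ ok u≢0 ⟩
        Z u + Z (mate u)        ≡⟨ cong₂ _+_ (sym (trans (cong (_* Z u) (positive-≢0 u≢0)) (*-identityˡ _)))
                                             (sym (trans (cong (_* Z (mate u)) (positive-≢0 u≢0)) (*-identityˡ _))) ⟩
        positive (mate u) * Z u + positive (mate u) * Z (mate u) ∎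
        where
        u≢0 : mate u ≢ 0
        u≢0 eq′ with () ← trans (sym eq) eq′
      exclusive : ∀ i → positive (mate i) * Z i + positive (owner i) * Z i ≤ Z i
      exclusive i with mate i in eq₁ | owner i in eq₂
      ... | zero  | zero  = z≤n
      ... | zero  | suc _ = ≤-reflexive (*-identityˡ (Z i))
      ... | suc _ | zero  = ≤-reflexive (trans (+-identityʳ (1 * Z i)) (*-identityˡ (Z i)))
      ... | suc _ | suc _ = ⊥-elim (left-right (proj₁ (relates (left M) (suc≢0 refl eq₁)))
                                               (proj₁ (proj₂ (relates (right M) (suc≢0 refl eq₂)))))

    -- Complementary slackness: `Z` vanishes off the matching, so the pairs carry its whole sum. A
    -- cover with K = D would certify optimality; the auction reaches K = D + 1, a failed search K =
    -- D = 1.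
    strong-duality : ∀ K Z → (∀ {u} → mate u ≢ 0 → Z u + Z (mate u) ≤ K) →
                     (∀ {i} → 1 ≤ i → i ≤ m → mate i ≡ 0 → owner i ≡ 0 → Z i ≡ 0) →
                     ∑ m Z ≤ K * matched mate
    strong-duality K Z ok free = begin
      ∑ m Z
        ≤⟨ ∑-mono m covered ⟩
      ∑ m (λ i → positive (mate i) * Z i + positive (owner i) * Z i)
        ≡⟨ ∑-distrib-+ m _ _ ⟩
      ∑ m (λ u → positive (mate u) * Z u) + ∑ m (λ e → positive (owner e) * Z e)
        ≤⟨ +-monoʳ-≤ _ (∑-mono m λ e _ _ → back e (owner e) refl) ⟩
      ∑ m (λ u → positive (mate u) * Z u) + ∑ m (λ e → positive (owner e) * Z (mate (owner e)))
        ≤⟨ +-monoʳ-≤ _ (∑-reindex (right M) conflict-left (λ u → Z (mate u))) ⟩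
      ∑ m (λ u → positive (mate u) * Z u) + ∑ m (λ u → positive (mate u) * Z (mate u))
        ≡⟨ sym (∑-distrib-+ m _ _) ⟩
      ∑ m (λ u → positive (mate u) * Z u + positive (mate u) * Z (mate u))
        ≤⟨ ∑-mono m (λ u _ _ → pointwise u) ⟩
      ∑ m (λ u → K * positive (mate u))
        ≡⟨ ∑-distrib-* m K _ ⟩
      K * matched mate ∎
      where
      open ≤-Reasoning
      covered : ∀ i → 1 ≤ i → i ≤ m → Z i ≤ positive (mate i) * Z i + positive (owner i) * Z i
      covered i 1≤i i≤m with mate i in eq₁ | owner i in eq₂
      ... | zero  | zero  = ≤-reflexive (free 1≤i i≤m eq₁ eq₂)
      ... | zero  | suc _ = ≤-reflexive (sym (*-identityˡ (Z i)))
      ... | suc _ | o     = ≤-trans (≤-reflexive (sym (*-identityˡ (Z i)))) (m≤m+n (1 * Z i) (positive o * Z i))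
      back : ∀ e u → owner e ≡ u → positive (owner e) * Z e ≤ positive (owner e) * Z (mate (owner e))
      back e zero    eq rewrite eq = z≤n
      back e (suc u) eq = ≤-reflexive (cong (λ v → positive (owner e) * Z v) (sym (inverse (right M) (suc≢0 eq refl))))
      pointwise : ∀ u → positive (mate u) * Z u + positive (mate u) * Z (mate u) ≤ K * positive (mate u)
      pointwise u with mate u in eq
      ... | zero  = z≤n
      ... | suc e = ≤-trans (≤-reflexive (cong₂ _+_ (*-identityˡ (Z u)) (*-identityˡ (Z (suc e)))))
                      (≤-trans (subst (λ v → Z u + Z v ≤ K) eq (ok (suc≢0 eq refl))) (≤-reflexive (sym (*-identityʳ K))))

  -- The slots are the nodes of the linked lists of right edges, one per end.
  Slot : ℕ → ℕ → ℕ → Set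
  Slot x s e = Right e × (s ≡ e + e × a e ≡ x ⊎ s ≡ suc (e + e) × b e ≡ x)

  Touched : ℕ → Set
  Touched x = ∃[ e ] (1 ≤ e × e ≤ m × End x e)

  e+e-injective : ∀ e e′ → e + e ≡ e′ + e′ → e ≡ e′
  e+e-injective zero    zero     eq = refl
  e+e-injective (suc e) (suc e′) eq =
    cong suc (e+e-injective e e′ (suc-injective (trans (sym (+-suc e e)) (trans (suc-injective eq) (+-suc e′ e′)))))

  e+e≢1+e+e : ∀ e e′ → e + e ≢ suc (e′ + e′)
  e+e≢1+e+e e e′ eq =
    even≢odd e e′ (trans (cong (e +_) (+-identityʳ e)) (trans eq (cong (λ k → suc (e′ + k)) (sym (+-identityʳ e′)))))

  slot-unique : ∀ {x y s e e′} → Slot x s e → Slot y s e′ → x ≡ y × e ≡ e′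
  slot-unique {e = e} {e′} (_ , inj₁ (p , refl)) (_ , inj₁ (q , refl))
    with refl ← e+e-injective e e′ (trans (sym p) q) = refl , refl
  slot-unique {e = e} {e′} (_ , inj₁ (p , refl)) (_ , inj₂ (q , refl)) = ⊥-elim (e+e≢1+e+e e e′ (trans (sym p) q))
  slot-unique {e = e} {e′} (_ , inj₂ (p , refl)) (_ , inj₁ (q , refl)) = ⊥-elim (e+e≢1+e+e e′ e (trans (sym q) p))
  slot-unique {e = e} {e′} (_ , inj₂ (p , refl)) (_ , inj₂ (q , refl))
    with refl ← e+e-injective e e′ (suc-injective (trans (sym p) q)) = refl , refl

  slot-touched : ∀ {x s e} → Slot x s e → Touched x
  slot-touched {e = e} ((1≤e , e≤m , _) , inj₁ (_ , eq)) = e , 1≤e , e≤m , inj₁ eq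
  slot-touched {e = e} ((1≤e , e≤m , _) , inj₂ (_ , eq)) = e , 1≤e , e≤m , inj₂ eq

  slot-1≤ : ∀ {x s e} → Slot x s e → 1 ≤ s
  slot-1≤ {e = suc e} (_ , inj₁ (refl , _)) = s≤s z≤n
  slot-1≤ {e = e}     (_ , inj₂ (refl , _)) = s≤s z≤n
  slot-1≤ {e = zero}  ((() , _) , inj₁ _)

  slot-≤ : ∀ {x s e} → Slot x s e → s ≤ suc (m + m)
  slot-≤ ((_ , e≤m , _) , inj₁ (refl , _)) = m≤n⇒m≤1+n (+-mono-≤ e≤m e≤m)
  slot-≤ ((_ , e≤m , _) , inj₂ (refl , _)) = s≤s (+-mono-≤ e≤m e≤m)

  end-slot : ∀ {x e} → Right e → End x e → ∃[ s ] Slot x s e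
  end-slot r (inj₁ eq) = _ , r , inj₁ (refl , eq)
  end-slot r (inj₂ eq) = _ , r , inj₂ (refl , eq)

  -- One specification for list heads (p = 0) and for successors (p = s + 1). No slot has number 0,
  -- which can therefore mark the end of a list.
  Least : ℕ → ℕ → ℕ → Set
  Least x p l = (l ≡ 0 × (∀ {s e} → Slot x s e → s < p))
              ⊎ (∃[ e ] Slot x l e × p ≤ l × (∀ {s e} → Slot x s e → s < p ⊎ l ≤ s))

  record Lists (next edge head : ℕ → ℕ) : Set where
    field
      head-least : ∀ x → Least x 0 (head x)
      next-least : ∀ {x s e} → Slot x s e → Least x (suc s) (next s)
      edge-slot  : ∀ {x s e} → Slot x s e → edge s ≡ e
  open Lists

  -- The slots of x are scanned cyclically, in increasing order from cur x; a
  -- slot loses one level r whenever it is passed, so those already passed in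
  -- the current round are one level below the rest.
  record Scan (cur r q : ℕ → ℕ) : Set where
    field
      r-null : r 0 ≡ 0
      front  : ∀ {x} → Touched x → (cur x ≡ 0 × (∀ {s e} → ¬ Slot x s e)) ⊎ (∃[ e ] Slot x (cur x) e)
      levels : ∀ {x s e} → Slot x s e → (cur x ≤ s × r s ≡ r (cur x)) ⊎ (s < cur x × suc (r s) ≡ r (cur x))
      q≤r    : ∀ {x s e} → Slot x s e → q e ≤ r s
  open Scan public

  -- The dual variable of the left edge u: a bound on the best offer at its two ends, read off two
  -- pointers.
  level : (cur r : ℕ → ℕ) → ℕ → ℕ
  level cur r u = r (cur (a u)) ⊔ r (cur (b u))

  module _ {cur r q : ℕ → ℕ} (S : Scan cur r q) where

    slot≤front : ∀ {x s e} → Slot x s e → r s ≤ r (cur x)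
    slot≤front sl with levels S sl
    ... | inj₁ (_ , eq) = ≤-reflexive eq
    ... | inj₂ (_ , eq) = ≤-trans (n≤1+n _) (≤-reflexive eq)

    end≤level : ∀ {x u} → End x u → r (cur x) ≤ level cur r u
    end≤level (inj₁ refl) = m≤m⊔n _ _
    end≤level (inj₂ refl) = m≤n⊔m _ _

    -- The bound passes from the right edge to its slot, from the slot to the pointer of the shared
    -- vertex, and from there to the maximum over the ends of u.
    conflict≤level : ∀ {u e} → Conflict u e → q e ≤ level cur r u
    conflict≤level (_ , right-e , x , x∈u , x∈e) =
      let s , sl = end-slot right-e x∈e
      in ≤-trans (q≤r S sl) (≤-trans (slot≤front sl) (end≤level x∈u))

    lower-q : ∀ {e v} → v ≤ q e → Scan cur r (q [ e ≔ v ])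
    lower-q {e} {v} v≤ = record
      { r-null = r-null S ; front = front S ; levels = levels S
      ; q≤r = λ {x} {s} {e′} sl → ≤-trans ([≔]-≤ q e v≤ e′) (q≤r S sl) }

  -- Moving a scanning pointer to the next slot

  Successor : (next head : ℕ → ℕ) → ℕ → ℕ → ℕ → Set
  Successor next head x s s′ = (next s ≢ 0 × s′ ≡ next s) ⊎ (next s ≡ 0 × s′ ≡ head x)

  module _ {next edge head cur r q} (L : Lists next edge head) (S : Scan cur r q)
           {x s e p s′} (sl : Slot x s e) (cur≡ : cur x ≡ s) (rs : r s ≡ suc p) (q≤p : q e ≤ p)
           (succ : Successor next head x s s′) where

    private
      cur′ r′ : ℕ → ℕ
      cur′ = cur [ x ≔ s′ ]
      r′   = r [ s ≔ p ]

      r′-other : ∀ {t} → t ≢ s → r′ t ≡ r t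
      r′-other = [≔]-other r s p

      r′-s : ∀ {t} → t ≡ s → r′ t ≡ p
      r′-s = [≔]-same r s p

      level-x : ∀ {t e′} → Slot x t e′ → (s ≤ t × r t ≡ suc p) ⊎ (t < s × r t ≡ p)
      level-x sl′ with levels S sl′
      ... | inj₁ (le , eq) = inj₁ (subst (_≤ _) cur≡ le , trans eq (trans (cong r cur≡) rs))
      ... | inj₂ (lt , eq) = inj₂ (subst (_ <_) cur≡ lt , suc-injective (trans eq (trans (cong r cur≡) rs)))

      -- Either the pointer stays in the current round and jumps over no slot, or s was the last
      -- slot and the pointer returns to the first. In the latter case all slots of x have come down
      -- to p, and the next round starts from there.
      data Shape (s′ : ℕ) : Set where
        ahead : s < s′ → (∀ {t e′} → Slot x t e′ → t ≤ s ⊎ s′ ≤ t) → Shape s′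
        wrap  : (∀ {t e′} → Slot x t e′ → t ≤ s) → (∀ {t e′} → Slot x t e′ → s′ ≤ t) → Shape s′

      shape-of : ∀ {s′} → Successor next head x s s′ → ∃[ e′ ] Slot x s′ e′ × Shape s′
      shape-of (inj₁ (n≢0 , refl)) with next-least L sl
      ... | inj₁ (n≡0 , _) = ⊥-elim (n≢0 n≡0)
      ... | inj₂ (e′ , sl′ , lt , least) = e′ , sl′ , ahead lt (λ sl″ → case (least sl″))
        where
        case : ∀ {t} → t < suc s ⊎ next s ≤ t → t ≤ s ⊎ next s ≤ t
        case (inj₁ lt) = inj₁ (s≤s⁻¹ lt)
        case (inj₂ le) = inj₂ le
      shape-of (inj₂ (n≡0 , refl)) with next-least L sl | head-least L x
      ... | inj₂ (_ , _ , lt , _) | _ = ⊥-elim (n≮0 (subst (_ <_) n≡0 lt))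
      ... | inj₁ _ | inj₁ (_ , none) = ⊥-elim (n≮0 (none sl))
      ... | inj₁ (_ , last) | inj₂ (e′ , sl′ , _ , least) =
        e′ , sl′ , wrap (λ sl″ → s≤s⁻¹ (last sl″)) (λ sl″ → case (least sl″))
        where
        case : ∀ {t} → t < 0 ⊎ head x ≤ t → head x ≤ t
        case (inj₂ le) = le

      shape : ∃[ e′ ] Slot x s′ e′ × Shape s′
      shape = shape-of succ

      cur′-x : ∀ {y} → y ≡ x → cur′ y ≡ s′
      cur′-x = [≔]-same cur x s′

      cur′-other : ∀ {y} → y ≢ x → cur′ y ≡ cur y
      cur′-other = [≔]-other cur x s′

      foreign : ∀ {y t e′} → y ≢ x → Slot y t e′ → r′ t ≡ r t
      foreign y≢x sl′ = r′-other λ { refl → y≢x (proj₁ (slot-unique sl′ sl)) }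

      passed : ∀ {t e′} → Slot x t e′ → t ≤ s → r′ t ≡ p
      passed {t} sl′ t≤s with t ≟ s
      ... | yes eq = r′-s eq
      ... | no ne with level-x sl′
      ...   | inj₁ (s≤t , _) = ⊥-elim (ne (≤-antisym t≤s s≤t))
      ...   | inj₂ (_ , eq)  = trans (r′-other ne) eq

      unpassed : ∀ {t e′} → Slot x t e′ → s < t → r′ t ≡ suc p
      unpassed {t} sl′ s<t with level-x sl′
      ... | inj₁ (_ , eq)  = trans (r′-other (λ { refl → <-irrefl refl s<t })) eq
      ... | inj₂ (t<s , _) = ⊥-elim (<-asym s<t t<s)

      levels-x : ∀ {t e′} → Slot x t e′ → (s′ ≤ t × r′ t ≡ r′ s′) ⊎ (t < s′ × suc (r′ t) ≡ r′ s′)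
      levels-x sl′ with shape
      ... | _ , sl″ , wrap last first =
        inj₁ (first sl′ , trans (passed sl′ (last sl′)) (sym (passed sl″ (last sl″))))
      ... | _ , sl″ , ahead s<s′ gap with gap sl′
      ...   | inj₁ t≤s = inj₂ (≤-<-trans t≤s s<s′ , trans (cong suc (passed sl′ t≤s)) (sym (unpassed sl″ s<s′)))
      ...   | inj₂ s′≤t = inj₁ (s′≤t , trans (unpassed sl′ (<-≤-trans s<s′ s′≤t)) (sym (unpassed sl″ s<s′)))

      front-x : r′ s′ ≤ suc p
      front-x with shape
      ... | _ , sl″ , wrap last _    = ≤-trans (≤-reflexive (passed sl″ (last sl″))) (n≤1+n p)
      ... | _ , sl″ , ahead s<s′ _ = ≤-reflexive (unpassed sl″ s<s′)

      front-other : ∀ {y} → Touched y → y ≢ x → r′ (cur′ y) ≡ r (cur y)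
      front-other {y} ty y≢x = trans (cong r′ (cur′-other y≢x)) (case (front S ty))
        where
        case : (cur y ≡ 0 × (∀ {s e} → ¬ Slot y s e)) ⊎ (∃[ e ] Slot y (cur y) e) → r′ (cur y) ≡ r (cur y)
        case (inj₁ (eq , _))   = r′-other λ eq′ → <⇒≢ (slot-1≤ sl) (trans (sym eq) eq′)
        case (inj₂ (_ , sl′)) = foreign y≢x sl′

    advance-front : ∀ {y} → Touched y → r′ (cur′ y) ≤ r (cur y)
    advance-front {y} ty with y ≟ x
    ... | yes refl = ≤-trans (≤-reflexive (cong r′ (cur′-x {y} refl)))
                       (≤-trans front-x (≤-reflexive (sym (trans (cong r cur≡) rs))))
    ... | no y≢x = ≤-reflexive (front-other ty y≢x)

    advance : Scan cur′ r′ q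
    advance = record
      { r-null = trans (r′-other (λ eq → <⇒≢ (slot-1≤ sl) eq)) (r-null S)
      ; front  = front′
      ; levels = levels′
      ; q≤r    = q≤r′
      }
      where
      front′ : ∀ {y} → Touched y → (cur′ y ≡ 0 × (∀ {s e} → ¬ Slot y s e)) ⊎ (∃[ e ] Slot y (cur′ y) e)
      front′ {y} ty with y ≟ x
      ... | yes refl = inj₂ (proj₁ shape , subst (λ t → Slot y t (proj₁ shape)) (sym (cur′-x {y} refl)) (proj₁ (proj₂ shape)))
      ... | no y≢x with front S ty
      ...   | inj₁ (eq , none) = inj₁ (trans (cur′-other y≢x) eq , none)
      ...   | inj₂ (e′ , sl′)  = inj₂ (e′ , subst (λ t → Slot y t e′) (sym (cur′-other y≢x)) sl′)
      levels′ : ∀ {y t e′} → Slot y t e′ →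
                (cur′ y ≤ t × r′ t ≡ r′ (cur′ y)) ⊎ (t < cur′ y × suc (r′ t) ≡ r′ (cur′ y))
      levels′ {y} {t} sl′ with y ≟ x
      ... | yes refl = subst (λ k → (k ≤ t × r′ t ≡ r′ k) ⊎ (t < k × suc (r′ t) ≡ r′ k))
                         (sym (cur′-x {y} refl)) (levels-x sl′)
      ... | no y≢x with levels S sl′ | front-other (slot-touched sl′) y≢x
      ...   | inj₁ (le , eq) | eq′ =
              inj₁ (subst (_≤ t) (sym (cur′-other y≢x)) le , trans (foreign y≢x sl′) (trans eq (sym eq′)))
      ...   | inj₂ (lt , eq) | eq′ =
              inj₂ (subst (t <_) (sym (cur′-other y≢x)) lt , trans (cong suc (foreign y≢x sl′)) (trans eq (sym eq′)))
      q≤r′ : ∀ {y t e′} → Slot y t e′ → q e′ ≤ r′ t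
      q≤r′ {y} {t} sl′ with t ≟ s
      -- Only slot s changes its bound; by `q≤p` the lowered one is still valid.
      ... | yes refl = subst (λ k → q k ≤ r′ s) (sym (proj₂ (slot-unique sl′ sl)))
                         (≤-trans q≤p (≤-reflexive (sym (r′-s {s} refl))))
      ... | no ne = ≤-trans (q≤r S sl′) (≤-reflexive (sym (r′-other ne)))

    advance-level : ∀ {u} → 1 ≤ u → u ≤ m → level cur′ r′ u ≤ level cur r u
    advance-level {u} 1≤u u≤m = ⊔-mono-≤ (advance-front (u , 1≤u , u≤m , inj₁ refl))
                                         (advance-front (u , 1≤u , u≤m , inj₂ refl))

-- The algorithm

insertSlot : Field → Cmd
insertSlot F =
  inp %x F %e ⨟ get %h #head %x ⨟ put #next %s %h ⨟ put #edge %s %e ⨟ put #head %x %s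

buildStep build : Cmd
buildStep =
  inp %c col %e ⨟ dec %c %c ⨟
  -- Edges come in descending order, and slot 2e + 1 is inserted before 2e. Insertion at the head
  -- thus leaves the lists increasing.
  ifp %c (plus %s %e %e ⨟ inc %s %s ⨟ insertSlot end₂ ⨟ dec %s %s ⨟ insertSlot end₁) skip ⨟
  dec %e %e
build = lit %z 0 ⨟ inp %m end₂ %z ⨟ mov %e %m ⨟ while %e buildStep

-- `%P` holds D²; adding D once before and once after the increment yields (D + 1)² without
-- multiplication.
sqrtStep squareRoot : Cmd
sqrtStep = plus %P %P %D ⨟ inc %D %D ⨟ plus %P %P %D ⨟ minus %g %m %P
squareRoot = (lit %D 1 ⨟ lit %P 1 ⨟ minus %g %m %P) ⨟ while %g sqrtStep

resetStep reset : Cmd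
resetStep =
  inp %x end₁ %e ⨟ get %h #head %x ⨟ put #cur %x %h ⨟
  inp %x end₂ %e ⨟ get %h #head %x ⨟ put #cur %x %h ⨟
  put #q %e %D ⨟ plus %s %e %e ⨟ put #r %s %D ⨟ inc %s %s ⨟ put #r %s %D ⨟
  -- Colour minus 1 plus mate is 0 exactly for the free left edges, with which the queue starts.
  inp %t col %e ⨟ dec %t %t ⨟ get %h #mate %e ⨟ plus %t %t %h ⨟
  ifp %t skip (put #queue %qt %e ⨟ inc %qt %qt) ⨟
  dec %e %e
reset = (lit %qh 0 ⨟ lit %qt 0 ⨟ mov %e %m) ⨟ while %e resetStep

choose pass scanStep scan : Cmd → Cmd
choose k =
  get %u #queue %qh ⨟
  inp %x end₁ %u ⨟ get %s #cur %x ⨟ get %p #r %s ⨟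
  inp %y end₂ %u ⨟ get %s′ #cur %y ⨟ get %p′ #r %s′ ⨟
  -- The end whose pointer shows the larger bound is scanned, so that `%p` is the level of u.
  minus %d %p′ %p ⨟ ifp %d (mov %x %y ⨟ mov %s %s′ ⨟ mov %p %p′) skip ⨟ k
pass bid =
  get %e #edge %s ⨟ get %t #q %e ⨟ minus %d %p %t ⨟
  -- If the bound exceeds the levels left to e, it is out of date: it is lowered by one and the
  -- pointer moves on, wrapping at the end of the list. Otherwise it is attained, and e is a best
  -- offer for u.
  ifp %d
    (dec %p %p ⨟ put #r %s %p ⨟ get %s #next %s ⨟ ifp %s skip (get %s #head %x) ⨟ put #cur %x %s)
    bid
-- At level 0 no offers are left, and u leaves the queue for good unless it is pushed again.
scanStep bid = choose (ifp %p (pass bid) (inc %qh %qh)) ⨟ minus %g %qt %qh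
scan bid = minus %g %qt %qh ⨟ while %g (scanStep bid)

rematchCmd push auction search : Cmd
-- An absent partner has number 0, and clearing index 0 does no harm; hence there is no case
-- distinction.
rematchCmd = lit %z 0 ⨟ put #mate %o %z ⨟ put #owner %f %z ⨟ put #mate %u %e ⨟ put #owner %e %u
push = put #queue %qt %o ⨟ inc %qt %qt
auction =
  get %f #mate %u ⨟
  -- The invariant does not claim that queued left edges are free; a matched one is skipped.
  ifp %f (inc %qh %qh)
    (dec %t %t ⨟ put #q %e %t ⨟ get %o #owner %e ⨟ rematchCmd ⨟ inc %qh %qh ⨟ ifp %o push skip)
search =
  dec %t %t ⨟ put #q %e %t ⨟ put #rank %e %qh ⨟ get %o #owner %e ⨟
  -- A free right edge is kept in `%f`, and emptying the queue ends the scan.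
  ifp %o push (mov %f %e ⨟ mov %qh %qt)

augmentStep augment : Cmd
augmentStep =
  get %i #rank %e ⨟ get %u #queue %i ⨟ get %f #mate %u ⨟ get %o #owner %e ⨟ rematchCmd ⨟ mov %e %f
augment = mov %e %f ⨟ while %e augmentStep

improve countStep count main : Cmd
-- `augment` overwrites `%f`, so the outcome is saved in `%c`, where 0 means that the search failed
-- and the rounds end.
improve = lit %D 1 ⨟ reset ⨟ lit %f 0 ⨟ scan search ⨟ mov %c %f ⨟ augment
countStep = get %o #mate %e ⨟ ifp %o (inc %n %n) skip ⨟ dec %e %e
count = (lit %n 0 ⨟ mov %e %m) ⨟ while %e countStep
main =
  build ⨟ squareRoot ⨟ reset ⨟ scan auction ⨟ lit %c 1 ⨟ while %c improve ⨟
  -- Field `col` of row 0 is k, so `%n` becomes the truncated difference of matching size and k: 0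
  -- means yes.
  count ⨟ lit %z 0 ⨟ inp %o col %z ⨟ minus %n %n %o

-- The factor of each loop body bounds an initial measure: m for passes over the edges and for the
-- root, the potential 4mD + m for a scan (D = 1 in a search), the queue capacity 2m for an
-- augmentation, and D + 1 for the rounds of improvement.
resetTime searchTime augmentTime improveTime : ℕ → ℕ
resetTime m   = 4 + (3 + m * suc (cost resetStep))
searchTime m  = 1 + (3 + (m * 4 + m) * suc (cost (scanStep search)))
augmentTime m = 2 + (3 + (m + m * 1) * suc (cost augmentStep))
improveTime m = 1 + (resetTime m + (1 + (searchTime m + (2 + augmentTime m))))

auctionTime mainTime : ℕ → ℕ → ℕ
auctionTime m D = 1 + (3 + (m * (4 * D) + m) * suc (cost (scanStep auction)))
mainTime m D =
  (1 + (5 + (2 + (3 + m * suc (cost buildStep))))) +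
  ((3 + (3 + m * suc (cost sqrtStep))) +
  (resetTime m + (auctionTime m D + (1 + ((3 + suc D * suc (improveTime m)) +
  ((3 + (3 + m * suc (cost countStep))) + (1 + (5 + 1))))))))

-- D is the least positive integer with m ≤ D², the last condition being kept apart.
record Root (m D : ℕ) : Set where
  field
    1≤D   : 1 ≤ D
    tight : D ≡ 1 ⊎ pred D * pred D < m

root-≤ : ∀ {m D} → Root m D → D ≤ suc m
root-≤ R with Root.tight R
root-≤ R | inj₁ refl = s≤s z≤n
root-≤ {D = zero}        R | inj₂ _ = z≤n
root-≤ {D = suc zero}    R | inj₂ _ = s≤s z≤n
root-≤ {D = suc (suc D)} R | inj₂ lt = s≤s (≤-trans (m≤m*n (suc D) (suc D)) (<⇒≤ lt))

root-unique : ∀ {m D D′} → Root m D → m ≤ D * D → Root m D′ → m ≤ D′ * D′ → D ≡ D′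
root-unique R m≤ R′ m≤′ = ≤-antisym (half R R′ m≤′) (half R′ R m≤)
  where
  half : ∀ {m D D′} → Root m D → Root m D′ → m ≤ D′ * D′ → D ≤ D′
  half {m} {D} {D′} R R′ m≤ with Root.tight R
  ... | inj₁ refl = Root.1≤D R′
  ... | inj₂ lt = ≮⇒≥ λ D′<D →
    let le : D′ ≤ pred D
        le = suc[m]≤n⇒m≤pred[n] D′<D
    in <⇒≱ lt (≤-trans m≤ (*-mono-≤ le le))

ceilingRoot : ∀ m → ∃[ D ] (Root m D × m ≤ D * D)
ceilingRoot zero = 1 , record { 1≤D = ≤-refl ; tight = inj₁ refl } , z≤n
ceilingRoot (suc m) with ceilingRoot m
... | D , R , m≤ with suc m ≤? D * D
...   | yes le = D , record { 1≤D = Root.1≤D R ; tight = up (Root.tight R) } , le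
  where
  up : D ≡ 1 ⊎ pred D * pred D < m → D ≡ 1 ⊎ pred D * pred D < suc m
  up (inj₁ eq) = inj₁ eq
  up (inj₂ lt) = inj₂ (m≤n⇒m≤1+n lt)
...   | no ¬le = suc D , record { 1≤D = s≤s z≤n ; tight = inj₂ (≰⇒> ¬le) } ,
                 s≤s (≤-trans m≤ (≤-trans (*-monoʳ-≤ D (n≤1+n D)) (m≤n+m (D * suc D) D)))

-- Correctness and running time of the commands

module Correctness
  (w H m : ℕ) (fld : Field → ℕ → ℕ) (fits : 16 * H + (20 + 3 * m) < 2 ^ w)
  (square≤H : (2 + m) * (2 + m) ≤ H)
  (fld-m : fld end₂ 0 ≡ m)
  (end₁≤H : ∀ {e} → 1 ≤ e → e ≤ m → fld end₁ e ≤ H)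
  (end₂≤H : ∀ {e} → 1 ≤ e → e ≤ m → fld end₂ e ≤ H)
  (colours : ∀ {e} → 1 ≤ e → e ≤ m → fld col e ≡ 1 ⊎ fld col e ≡ 2)
  where

  open Semantics w H m fld fits
  open Graph m (fld end₁) (fld end₂) (fld col)

  m+m<H : suc (m + m) ≤ H
  m+m<H = ≤-trans (+-mono-≤ {suc m} {2 + m} (n≤1+n _) (≤-trans (m≤n+m m 2) (m≤m+n _ _))) square≤H

  1≤H : 1 ≤ H
  1≤H = ≤-trans (s≤s z≤n) m+m<H

  m≤H : m ≤ H
  m≤H = ≤-trans (m≤m+n m m) (≤-trans (n≤1+n _) m+m<H)

  ≤m⇒≤H : ∀ {e} → e ≤ m → e ≤ H
  ≤m⇒≤H e≤m = ≤-trans e≤m m≤H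

  slots≤H : ∀ {e} → e ≤ m → suc (e + e) ≤ H
  slots≤H e≤m = ≤-trans (s≤s (+-mono-≤ e≤m e≤m)) m+m<H

  -- Queue cells are never reused: there are at most m entries at first, and then one per level lost
  -- by a right edge. These indices and the squares formed in the root loop are what `square≤H` has
  -- to accommodate.
  entries<H : ∀ {D} → D ≤ suc m → suc (m + m * D) ≤ H
  entries<H {D} D≤ = ≤-trans
    (+-mono-≤ {suc m} {2 + m} (n≤1+n _)
      (≤-trans (*-monoʳ-≤ m (≤-trans D≤ (n≤1+n _))) (m≤n+m (m * (2 + m)) (2 + m)))) square≤H

  -- Building the lists of right edges

  record PreLists (p : ℕ) (next edge head : ℕ → ℕ) : Set where
    field
      head-least : ∀ x → Least x p (head x)
      next-least : ∀ {x s e} → Slot x s e → p ≤ s → Least x (suc s) (next s)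
      edge-slot  : ∀ {x s e} → Slot x s e → p ≤ s → edge s ≡ e

  least-lower : ∀ {x s l} → (∀ {e} → ¬ Slot x s e) → Least x (suc s) l → Least x s l
  least-lower no-slot (inj₁ (eq , none)) =
    inj₁ (eq , λ sl → ≤∧≢⇒< (s≤s⁻¹ (none sl)) λ { refl → no-slot sl })
  least-lower {x} {s} {l} no-slot (inj₂ (e , sl , lt , least)) = inj₂ (e , sl , <⇒≤ lt , λ sl′ → case sl′ (least sl′))
    where
    case : ∀ {t e′} → Slot x t e′ → t < suc s ⊎ l ≤ t → t < s ⊎ l ≤ t
    case sl′ (inj₁ t<) = inj₁ (≤∧≢⇒< (s≤s⁻¹ t<) λ { refl → no-slot sl′ })
    case sl′ (inj₂ le) = inj₂ le

  preLists-lower : ∀ {s next edge head} → (∀ {x e} → ¬ Slot x s e) →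
                   PreLists (suc s) next edge head → PreLists s next edge head
  preLists-lower {s} no-slot L = record
    { head-least = λ x → least-lower no-slot (head-least x)
    ; next-least = λ sl s≤ → next-least sl (above sl s≤)
    ; edge-slot  = λ sl s≤ → edge-slot sl (above sl s≤)
    }
    where
    open PreLists L
    above : ∀ {x t e} → Slot x t e → s ≤ t → suc s ≤ t
    above sl s≤t = ≤∧≢⇒< s≤t λ { refl → no-slot sl }

  -- The slots already listed are larger than s, so s becomes the least slot of x and the old head
  -- its successor.
  preLists-insert : ∀ {x s e next edge head} → Slot x s e → PreLists (suc s) next edge head →
                    PreLists s (next [ s ≔ head x ]) (edge [ s ≔ e ]) (head [ x ≔ s ])
  preLists-insert {x} {s} {e} {next} {edge} {head} sl L = record
    { head-least = head-least′ ; next-least = next-least′ ; edge-slot = edge-slot′ }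
    where
    open PreLists L
    head-least′ : ∀ y → Least y s ((head [ x ≔ s ]) y)
    head-least′ y with y ≟ x
    ... | yes refl = subst (Least y s) (sym ([≔]-same head x s {x} refl))
                       (inj₂ (e , sl , ≤-refl , λ {t} _ → <-≤-connex t s))
    ... | no ne = subst (Least y s) (sym ([≔]-other head x s ne))
                    (least-lower (λ sl′ → ne (proj₁ (slot-unique sl′ sl))) (head-least y))
    next-least′ : ∀ {y t e′} → Slot y t e′ → s ≤ t → Least y (suc t) ((next [ s ≔ head x ]) t)
    next-least′ {y} {t} sl′ s≤t with t ≟ s
    ... | yes refl = subst (Least y (suc s)) (sym ([≔]-same next s (head x) {s} refl))
                       (subst (λ z → Least y (suc s) (head z)) (proj₁ (slot-unique sl′ sl)) (head-least y))
    ... | no ne = subst (Least y (suc t)) (sym ([≔]-other next s (head x) ne))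
                    (next-least sl′ (≤∧≢⇒< s≤t (λ eq → ne (sym eq))))
    edge-slot′ : ∀ {y t e′} → Slot y t e′ → s ≤ t → (edge [ s ≔ e ]) t ≡ e′
    edge-slot′ {y} {t} sl′ s≤t with t ≟ s
    ... | yes refl = trans ([≔]-same edge s e {s} refl) (proj₂ (slot-unique sl sl′))
    ... | no ne = trans ([≔]-other edge s e ne) (edge-slot sl′ (≤∧≢⇒< s≤t (λ eq → ne (sym eq))))

  preLists-complete : ∀ {next edge head} → PreLists 2 next edge head → Lists next edge head
  preLists-complete L = record
    { head-least = λ x → lower (head-least x)
    ; next-least = λ sl → next-least sl (2≤ sl)
    ; edge-slot  = λ sl → edge-slot sl (2≤ sl)
    }
    where
    open PreLists L
    2≤ : ∀ {x s e} → Slot x s e → 2 ≤ s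
    2≤ {e = suc e} (_ , inj₁ (refl , _)) = s≤s (≤-trans (s≤s z≤n) (m≤n+m (suc e) e))
    2≤ {e = suc e} (_ , inj₂ (refl , _)) = s≤s (s≤s z≤n)
    2≤ {e = zero}  ((() , _) , _)
    lower : ∀ {x l} → Least x 2 l → Least x 0 l
    lower (inj₁ (eq , none)) = inj₁ (eq , λ sl → ⊥-elim (<⇒≱ (none sl) (2≤ sl)))
    lower {x} {l} (inj₂ (e , sl , _ , least)) = inj₂ (e , sl , z≤n , λ sl′ → inj₂ (case sl′ (least sl′)))
      where
      case : ∀ {t e′} → Slot x t e′ → t < 2 ⊎ l ≤ t → l ≤ t
      case sl′ (inj₁ lt) = ⊥-elim (<⇒≱ lt (2≤ sl′))
      case sl′ (inj₂ le) = le

  preLists-at : ∀ {p p′ next edge head} → p ≡ p′ → PreLists p next edge head → PreLists p′ next edge head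
  preLists-at refl L = L

  record Blank (r mate owner : ℕ → ℕ) : Set where
    field
      r-blank     : r 0 ≡ 0
      mate-blank  : ∀ i → mate i ≡ 0
      owner-blank : ∀ i → owner i ≡ 0

  blank-matching : ∀ {r mate owner} → Blank r mate owner → Matching mate owner
  blank-matching B = record
    { left  = record { null = mate-blank 0 ; inverse = λ {u} ne → ⊥-elim (ne (mate-blank u)) ; relates = λ {u} ne → ⊥-elim (ne (mate-blank u)) }
    ; right = record { null = owner-blank 0 ; inverse = λ {u} ne → ⊥-elim (ne (owner-blank u)) ; relates = λ {u} ne → ⊥-elim (ne (owner-blank u)) }
    }
    where open Blank B

  record Building (e m′ : ℕ) (next edge head r mate owner : ℕ → ℕ) : Set where
    field
      e≤m      : e ≤ m
      m-reg    : m′ ≡ m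
      preLists : PreLists (2 + (e + e)) next edge head
      blank    : Blank r mate owner

  BuildingAt : Store → Set
  BuildingAt s = Building (reg s %e) (reg s %m) (arr s #next) (arr s #edge) (arr s #head) (arr s #r) (arr s #mate) (arr s #owner)

  pred-+ : ∀ e → 2 + (e + e) ≡ suc e + suc e
  pred-+ e = cong suc (sym (+-suc e e))

  not-right : ∀ {e x} → ¬ Right e → (∀ {e′} → ¬ Slot x (e + e) e′) × (∀ {e′} → ¬ Slot x (suc (e + e)) e′)
  not-right {e} ¬r =
    (λ { {e′} (r , inj₁ (eq , _)) → ¬r (subst Right (sym (e+e-injective e e′ eq)) r)
       ; {e′} (r , inj₂ (eq , _)) → e+e≢1+e+e e e′ eq }) ,
    (λ { {e′} (r , inj₁ (eq , _)) → e+e≢1+e+e e′ e (sym eq)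
       ; {e′} (r , inj₂ (eq , _)) → ¬r (subst Right (sym (e+e-injective e e′ (suc-injective eq))) r) })

  buildStep-wp : ∀ {s v} → BuildingAt s → reg s %e ≡ suc v →
                 wp buildStep (λ s′ → BuildingAt s′ × reg s′ %e < reg s %e) s
  buildStep-wp {s} {v} I e≡ = e , refl , e≤m , pred (fld col e) , refl , insert-case , skip-case
    where
    open Building I
    e : ℕ
    e = reg s %e
    1≤e : 1 ≤ e
    1≤e = subst (1 ≤_) (sym e≡) (s≤s z≤n)
    lt : pred e < e
    lt = subst (λ e → pred e < e) (sym e≡) ≤-refl
    threshold : 2 + (pred e + pred e) ≡ e + e
    threshold = trans (pred-+ (pred e)) (cong (λ k → k + k) (trans (cong suc (cong pred e≡)) (sym e≡)))
    finish : ∀ {next edge head} → PreLists (e + e) next edge head →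
             Building (pred e) (reg s %m) next edge head (arr s #r) (arr s #mate) (arr s #owner)
    finish L = record { e≤m = ≤-trans (<⇒≤ lt) e≤m ; m-reg = m-reg ; blank = blank
                      ; preLists = preLists-at (sym threshold) L }
    x₁ x₂ h₁ h₂ : ℕ
    x₁ = fld end₁ e
    x₂ = fld end₂ e
    h₁ = (arr s #head [ x₂ ≔ suc (e + e) ]) x₁
    h₂ = arr s #head x₂
    insert-case : ∀ {w} → pred (fld col e) ≡ suc w → _
    insert-case {w} c≡ =
      e + e , refl , slots≤m , e + e , refl , slots≤H e≤m ,
      e , refl , e≤m , x₂ , refl , end₂≤H 1≤e e≤m , h₂ , refl ,
      suc (e + e) , refl , slots≤H e≤m , h₂ , refl ,
      suc (e + e) , refl , slots≤H e≤m , e , refl ,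
      x₂ , refl , end₂≤H 1≤e e≤m , suc (e + e) , refl ,
      e + e , refl ,
      e , refl , e≤m , x₁ , refl , end₁≤H 1≤e e≤m , h₁ , refl ,
      e + e , refl , slots≤m , h₁ , refl ,
      e + e , refl , slots≤m , e , refl ,
      x₁ , refl , end₁≤H 1≤e e≤m , e + e , refl ,
      pred e , refl ,
      finish (preLists-insert (r-e , inj₁ (refl , refl)) (preLists-insert (r-e , inj₂ (refl , refl)) preLists)) ,
      lt
      where
      slots≤m : e + e ≤ H
      slots≤m = ≤-trans (n≤1+n _) (slots≤H e≤m)
      r-e : Right e
      r-e with colours 1≤e e≤m
      ... | inj₁ eq with () ← trans (sym c≡) (cong pred eq)
      ... | inj₂ eq = 1≤e , e≤m , eq
    skip-case : pred (fld col e) ≡ 0 → _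
    skip-case c≡ = pred e , refl , finish (preLists-lower (λ {x} → proj₁ (not-right {e} {x} ¬r)) (preLists-lower (λ {x} → proj₂ (not-right {e} {x} ¬r)) preLists)) , lt
      where
      ¬r : ¬ Right e
      ¬r (_ , _ , eq) with () ← trans (sym c≡) (cong pred eq)

  record Ready (m′ : ℕ) (next edge head r mate owner : ℕ → ℕ) : Set where
    field
      m-reg    : m′ ≡ m
      lists    : Lists next edge head
      r-zero   : r 0 ≡ 0
      matching : Matching mate owner

  ReadyAt : Store → Set
  ReadyAt s = Ready (reg s %m) (arr s #next) (arr s #edge) (arr s #head) (arr s #r) (arr s #mate) (arr s #owner)

  Initial : Store → Set
  Initial s = ∀ A i → arr s A i ≡ 0

  build-tri : ∀ {s} → Initial s → Tri build (1 + (5 + (2 + (3 + m * suc (cost buildStep))))) ReadyAt s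
  build-tri {s} zeros =
    Tri-seq (Tri-wp (lit %z 0) {λ s → Initial s × reg s %z ≡ 0} (z≤n , zeros , refl)) λ {s₁} (zeros , z≡0) →
    Tri-seq (Tri-wp (inp %m end₂ %z) {λ s → Initial s × reg s %m ≡ m} (0 , z≡0 , z≤n , zeros , fld-m)) λ {s₂} (zeros , m≡) →
    Tri-seq (Tri-wp (mov %e %m) {λ s → BuildingAt s × reg s %e ≤ m} (m , m≡ , start {s₂} zeros m≡ , ≤-refl)) λ {s₃} (I , e≤m) →
    Tri-post (λ {s} → finish {s}) (Tri-while (cost buildStep) BuildingAt (λ s → reg s %e)
      (λ {s} I e≡ → Tri-wp buildStep (buildStep-wp {s} I e≡)) I e≤m)
    where
    start : ∀ {s} → Initial s → reg s %m ≡ m →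
            Building m (reg s %m) (arr s #next) (arr s #edge) (arr s #head) (arr s #r) (arr s #mate) (arr s #owner)
    start {s} zeros m≡ = record
      { e≤m = ≤-refl ; m-reg = m≡
      ; preLists = record
          { head-least = λ x → inj₁ (zeros #head x , λ sl → s≤s (slot-≤ sl))
          ; next-least = λ sl le → ⊥-elim (<⇒≱ le (slot-≤ sl))
          ; edge-slot  = λ sl le → ⊥-elim (<⇒≱ le (slot-≤ sl)) }
      ; blank = record { r-blank = zeros #r 0 ; mate-blank = zeros #mate ; owner-blank = zeros #owner } }
    finish : ∀ {s} → BuildingAt s × reg s %e ≡ 0 → ReadyAt s
    finish {s} (I , e≡0) = record
      { m-reg = m-reg
      ; lists = preLists-complete (preLists-at (cong (λ e → 2 + (e + e)) e≡0) preLists)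
      ; r-zero = Blank.r-blank blank
      ; matching = blank-matching blank }
      where open Building I

  -- The rounded-up square root of m

  record Rooting (D P g : ℕ) : Set where
    field
      root     : Root m D
      P-square : P ≡ D * D
      g-rest   : g ≡ m ∸ P

  RootingAt : Store → Set
  RootingAt s = ReadyAt s × Rooting (reg s %D) (reg s %P) (reg s %g)

  sqrtStep-wp : ∀ {s v} → RootingAt s → reg s %g ≡ suc v →
                wp sqrtStep (λ s′ → RootingAt s′ × reg s′ %g < reg s %g) s
  sqrtStep-wp {s} {v} (I , J) g≡ =
    D * D + D , cong (_+ D) P-square , ≤-trans (m≤m+n _ (suc D)) P′≤H ,
    D , refl , ≤-trans (m≤n+m (suc D) (D * D + D)) P′≤H ,
    P′ , refl , P′≤H ,
    m ∸ P′ , cong (_∸ P′) (Ready.m-reg I) ,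
    (I , record { root = record { 1≤D = s≤s z≤n ; tight = inj₂ D²<m } ; P-square = square ; g-rest = refl }) ,
    decrease
    where
    open Rooting J
    D P′ : ℕ
    D = reg s %D
    P′ = D * D + D + suc D
    square : P′ ≡ suc D * suc D
    square = trans (+-comm (D * D + D) (suc D)) (cong (suc D +_) (trans (+-comm (D * D) D) (sym (*-suc D D))))
    D²<m : D * D < m
    D²<m = m∸n≢0⇒n<m λ eq → 1+n≢0 (trans (sym g≡) (trans g-rest (trans (cong (m ∸_) P-square) eq)))
    D≤m : D ≤ m
    D≤m = ≤-trans (m≤m*n D D {{>-nonZero (Root.1≤D root)}}) (<⇒≤ D²<m)
    P′≤H : P′ ≤ H
    P′≤H = ≤-trans (≤-reflexive square) (≤-trans (*-mono-≤ (s≤s (m≤n⇒m≤1+n D≤m)) (s≤s (m≤n⇒m≤1+n D≤m))) square≤H)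
    decrease : m ∸ P′ < reg s %g
    decrease = subst (m ∸ P′ <_) (sym (trans g-rest (cong (m ∸_) P-square)))
                 (≤-<-trans (∸-monoʳ-≤ m (≤-trans (m≤m+n (suc (D * D)) (D + D)) (≤-reflexive shuffle)))
                            (∸-monoʳ-< {m} {suc (D * D)} ≤-refl D²<m))
      where
      shuffle : suc (D * D) + (D + D) ≡ P′
      shuffle = trans (sym (+-assoc (suc (D * D)) D D)) (sym (+-suc (D * D + D) D))

  squareRoot-tri : ∀ {D s} → Root m D → m ≤ D * D → ReadyAt s →
                   Tri squareRoot (3 + (3 + m * suc (cost sqrtStep))) (λ s → ReadyAt s × reg s %D ≡ D) s
  squareRoot-tri {D} {s} R m≤ I =
    Tri-seq (Tri-wp (lit %D 1 ⨟ lit %P 1 ⨟ minus %g %m %P) {λ s → RootingAt s × reg s %g ≤ m}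
      (1≤H , 1≤H , m ∸ 1 , cong (_∸ 1) (Ready.m-reg I) ,
       (I , record { root = record { 1≤D = s≤s z≤n ; tight = inj₁ refl } ; P-square = refl ; g-rest = refl }) ,
       m∸n≤m m 1)) λ (J , g≤m) →
    Tri-post (λ {s} → finish {s}) (Tri-while (cost sqrtStep) RootingAt (λ s → reg s %g)
      (λ {s} J g≡ → Tri-wp sqrtStep (sqrtStep-wp {s} J g≡)) J g≤m)
    where
    finish : ∀ {s} → RootingAt s × reg s %g ≡ 0 → ReadyAt s × reg s %D ≡ D
    finish {s} ((I , J) , g≡0) = I ,
      root-unique (Rooting.root J) (subst (m ≤_) P-square (m∸n≡0⇒m≤n (trans (sym g-rest) g≡0))) R m≤
      where open Rooting J

  -- Resetting prices, pointers and the queue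

  mate≤m : ∀ {mate owner} → Matching mate owner → ∀ u → mate u ≤ m
  mate≤m {mate} M u with mate u ≟ 0
  ... | yes eq = ≤-trans (≤-reflexive eq) z≤n
  ... | no ne  = proj₁ (proj₂ (proj₁ (proj₂ (relates (left M) ne))))

  owner≤m : ∀ {mate owner} → Matching mate owner → ∀ e → owner e ≤ m
  owner≤m {owner = owner} M e with owner e ≟ 0
  ... | yes eq = ≤-trans (≤-reflexive eq) z≤n
  ... | no ne  = proj₁ (proj₂ (proj₁ (relates (right M) ne)))

  ready-r : ∀ {m′ next edge head r r′ mate owner} → r′ 0 ≡ 0 → Ready m′ next edge head r mate owner →
            Ready m′ next edge head r′ mate owner
  ready-r eq R = record { m-reg = m-reg ; lists = lists ; r-zero = eq ; matching = matching }
    where open Ready R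

  -- The edges above `e` have been treated. `cur-set` includes the ends of left edges, whose
  -- pointers are read even where no right edge lies.
  record Reset (N D e : ℕ) (mate head cur r q queue : ℕ → ℕ) (D′ qh qt : ℕ) : Set where
    field
      D-reg   : D′ ≡ D
      size≡   : matched mate ≡ N
      q-set   : ∀ {i} → e < i → i ≤ m → q i ≡ D
      r-set   : ∀ {i} → e < i → i ≤ m → r (i + i) ≡ D × r (suc (i + i)) ≡ D
      cur-set : ∀ {i x} → e < i → i ≤ m → End x i → cur x ≡ head x
      qh≡0    : qh ≡ 0
      qt-room : qt + e ≤ m
      queued  : ∀ {i} → i < qt → Left (queue i) × mate (queue i) ≡ 0
      sources : ∀ {u} → e < u → Left u → mate u ≡ 0 → ∃[ i ] (i < qt × queue i ≡ u)

  ResetAt : (N D : ℕ) → Store → Set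
  ResetAt N D s = ReadyAt s × Reset N D (reg s %e) (arr s #mate) (arr s #head) (arr s #cur) (arr s #r) (arr s #q)
                                    (arr s #queue) (reg s %D) (reg s %qh) (reg s %qt)

  resetStep-wp : ∀ {N D s v} → D ≤ H → ResetAt N D s → reg s %e ≡ suc v →
                 wp resetStep (λ s′ → ResetAt N D s′ × reg s′ %e < reg s %e) s
  resetStep-wp {N} {D} {s} D≤H (I , J) e≡ =
    e , refl , e≤m , x₁ , refl , end₁≤H 1≤e e≤m , head x₁ , refl ,
    x₁ , refl , end₁≤H 1≤e e≤m , head x₁ , refl ,
    e , refl , e≤m , x₂ , refl , end₂≤H 1≤e e≤m , head x₂ , refl ,
    x₂ , refl , end₂≤H 1≤e e≤m , head x₂ , refl ,
    e , refl , ≤m⇒≤H e≤m , D , D-reg ,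
    e + e , refl , <⇒≤ (slots≤H e≤m) ,
    e + e , refl , <⇒≤ (slots≤H e≤m) , D , D-reg ,
    e + e , refl , slots≤H e≤m ,
    suc (e + e) , refl , slots≤H e≤m , D , D-reg ,
    e , refl , e≤m , pred (fld col e) , refl ,
    e , refl , ≤m⇒≤H e≤m , mate e , refl ,
    t , refl , t≤H ,
    (λ t≡ → pred e , refl , finish qt-room′ queued (covered t≡)) ,
    (λ t≡ → qt , refl , qt≤H , e , refl ,
            qt , refl , qt<H ,
            pred e , refl , finish push-room (push-queued t≡) push-sources)
    where
    open Ready I
    open Reset J
    e x₁ x₂ t qt : ℕ
    e = reg s %e
    x₁ = fld end₁ e
    x₂ = fld end₂ e
    mate head queue r′ cur′ q′ : ℕ → ℕ
    mate = arr s #mate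
    head = arr s #head
    queue = arr s #queue
    qt = reg s %qt
    t = pred (fld col e) + mate e
    r′ = arr s #r [ e + e ≔ D ] [ suc (e + e) ≔ D ]
    cur′ = arr s #cur [ x₁ ≔ head x₁ ] [ x₂ ≔ head x₂ ]
    q′ = arr s #q [ e ≔ D ]
    e≤m : e ≤ m
    e≤m = ≤-trans (m≤n+m e qt) qt-room
    1≤e : 1 ≤ e
    1≤e = subst (1 ≤_) (sym e≡) (s≤s z≤n)
    suc-pred-e : suc (pred e) ≡ e
    suc-pred-e = trans (cong (λ k → suc (pred k)) e≡) (sym e≡)
    lt : pred e < e
    lt = ≤-reflexive suc-pred-e
    t≤H : t ≤ H
    t≤H = ≤-trans (+-mono-≤ col≤1 (mate≤m matching e)) (≤-trans (s≤s (m≤m+n m m)) m+m<H)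
      where
      col≤1 : pred (fld col e) ≤ 1
      col≤1 with colours 1≤e e≤m
      ... | inj₁ eq = ≤-trans (≤-reflexive (cong pred eq)) z≤n
      ... | inj₂ eq = ≤-reflexive (cong pred eq)
    qt<m : suc qt ≤ m
    qt<m = ≤-trans (≤-reflexive (+-comm 1 qt)) (≤-trans (+-monoʳ-≤ qt 1≤e) qt-room)
    qt<H : suc qt ≤ H
    qt<H = ≤m⇒≤H qt<m
    qt≤H : qt ≤ H
    qt≤H = <⇒≤ qt<H
    from : ∀ {i} → pred e < i → i ≢ e → e < i
    from lt′ ne = ≤∧≢⇒< (≤-trans (≤-reflexive (sym suc-pred-e)) lt′) λ eq → ne (sym eq)
    cur-copied : ∀ {x} → (x ≡ x₁ ⊎ x ≡ x₂ ⊎ arr s #cur x ≡ head x) → cur′ x ≡ head x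
    cur-copied {x} h with x ≟ x₂ | x ≟ x₁
    ... | yes refl | _ = [≔]-same (arr s #cur [ x₁ ≔ head x₁ ]) x₂ (head x₂) {x₂} refl
    ... | no ne | yes refl = trans ([≔]-other (arr s #cur [ x₁ ≔ head x₁ ]) x₂ (head x₂) ne)
                               ([≔]-same (arr s #cur) x₁ (head x₁) {x₁} refl)
    ... | no ne | no ne′ with h
    ...   | inj₁ eq        = ⊥-elim (ne′ eq)
    ...   | inj₂ (inj₁ eq) = ⊥-elim (ne eq)
    ...   | inj₂ (inj₂ eq) = trans ([≔]-other (arr s #cur [ x₁ ≔ head x₁ ]) x₂ (head x₂) ne)
                               (trans ([≔]-other (arr s #cur) x₁ (head x₁) ne′) eq)
    cur-set′ : ∀ {i x} → pred e < i → i ≤ m → End x i → cur′ x ≡ head x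
    cur-set′ {i} lt′ i≤m end with i ≟ e
    cur-set′ lt′ i≤m (inj₁ eq) | yes refl = cur-copied (inj₁ (sym eq))
    cur-set′ lt′ i≤m (inj₂ eq) | yes refl = cur-copied (inj₂ (inj₁ (sym eq)))
    ... | no ne = cur-copied (inj₂ (inj₂ (cur-set (from lt′ ne) i≤m end)))
    q-set′ : ∀ {i} → pred e < i → i ≤ m → q′ i ≡ D
    q-set′ {i} lt′ i≤m with i ≟ e
    ... | yes refl = [≔]-same (arr s #q) e D {e} refl
    ... | no ne = trans ([≔]-other (arr s #q) e D ne) (q-set (from lt′ ne) i≤m)
    r-set′ : ∀ {i} → pred e < i → i ≤ m → r′ (i + i) ≡ D × r′ (suc (i + i)) ≡ D
    r-set′ {i} lt′ i≤m with i ≟ e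
    ... | yes refl = trans ([≔]-other (arr s #r [ e + e ≔ D ]) (suc (e + e)) D (e+e≢1+e+e e e))
                       ([≔]-same (arr s #r) (e + e) D {e + e} refl) ,
                     [≔]-same (arr s #r [ e + e ≔ D ]) (suc (e + e)) D {suc (e + e)} refl
    ... | no ne = trans ([≔]-other (arr s #r [ e + e ≔ D ]) (suc (e + e)) D (e+e≢1+e+e i e))
                    (trans ([≔]-other (arr s #r) (e + e) D (λ eq → ne (e+e-injective i e eq))) (proj₁ old)) ,
                  trans ([≔]-other (arr s #r [ e + e ≔ D ]) (suc (e + e)) D (λ eq → ne (e+e-injective i e (suc-injective eq))))
                    (trans ([≔]-other (arr s #r) (e + e) D (λ eq → e+e≢1+e+e e i (sym eq))) (proj₂ old))
      where
      old = r-set (from lt′ ne) i≤m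
    r-zero′ : r′ 0 ≡ 0
    r-zero′ = trans ([≔]-other (arr s #r [ e + e ≔ D ]) (suc (e + e)) D (λ ()))
                (trans ([≔]-other (arr s #r) (e + e) D (<⇒≢ (≤-trans 1≤e (m≤m+n e e)))) r-zero)
    finish : ∀ {queue′ qt′} → qt′ + pred e ≤ m →
             (∀ {i} → i < qt′ → Left (queue′ i) × mate (queue′ i) ≡ 0) →
             (∀ {u} → pred e < u → Left u → mate u ≡ 0 → ∃[ i ] (i < qt′ × queue′ i ≡ u)) →
             (Ready (reg s %m) (arr s #next) (arr s #edge) head r′ mate (arr s #owner) ×
              Reset N D (pred e) mate head cur′ r′ q′ queue′ (reg s %D) (reg s %qh) qt′) × pred e < e
    finish room queued′ sources′ = (ready-r r-zero′ I , record
      { D-reg = D-reg ; size≡ = size≡ ; q-set = q-set′ ; r-set = r-set′ ; cur-set = cur-set′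
      ; qh≡0 = qh≡0 ; qt-room = room ; queued = queued′ ; sources = sources′ }) , lt
    qt-room′ : qt + pred e ≤ m
    qt-room′ = ≤-trans (+-monoʳ-≤ qt (<⇒≤ lt)) qt-room
    covered : ∀ {w} → t ≡ suc w → ∀ {u} → pred e < u → Left u → mate u ≡ 0 → ∃[ i ] (i < qt × queue i ≡ u)
    covered t≡ {u} lt′ l free with u ≟ e
    ... | yes refl with () ← trans (sym t≡) (cong₂ _+_ (cong pred (proj₂ (proj₂ l))) free)
    ... | no ne = sources (from lt′ ne) l free
    queue′ : ℕ → ℕ
    queue′ = queue [ qt ≔ e ]
    push-room : suc qt + pred e ≤ m
    push-room = ≤-trans (≤-reflexive (trans (sym (+-suc qt (pred e))) (cong (qt +_) suc-pred-e))) qt-room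
    push-queued : t ≡ 0 → ∀ {i} → i < suc qt → Left (queue′ i) × mate (queue′ i) ≡ 0
    push-queued t≡ {i} i< with i ≟ qt
    ... | yes refl = subst (λ u → Left u × mate u ≡ 0) (sym ([≔]-same queue qt e {qt} refl))
                       ((1≤e , e≤m , col≡1) , m+n≡0⇒n≡0 (pred (fld col e)) t≡)
      where
      col≡1 : fld col e ≡ 1
      col≡1 with colours 1≤e e≤m
      ... | inj₁ eq = eq
      ... | inj₂ eq with () ← trans (sym (cong pred eq)) (m+n≡0⇒m≡0 (pred (fld col e)) t≡)
    ... | no ne = subst (λ u → Left u × mate u ≡ 0) (sym ([≔]-other queue qt e ne)) (queued (≤∧≢⇒< (s≤s⁻¹ i<) ne))
    push-sources : ∀ {u} → pred e < u → Left u → mate u ≡ 0 → ∃[ i ] (i < suc qt × queue′ i ≡ u)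
    push-sources {u} lt′ l free with u ≟ e
    ... | yes refl = qt , ≤-refl , [≔]-same queue qt e {qt} refl
    ... | no ne =
      let i , i<qt , eq = sources (from lt′ ne) l free
      in i , m≤n⇒m≤1+n i<qt , trans ([≔]-other queue qt e (<⇒≢ i<qt)) eq

  reset-tri : ∀ {N D s} → D ≤ H → ReadyAt s → reg s %D ≡ D → matched (arr s #mate) ≡ N →
              Tri reset (4 + (3 + m * suc (cost resetStep))) (λ s → ResetAt N D s × reg s %e ≡ 0) s
  reset-tri {N} {D} {s} D≤H I D≡ N≡ =
    Tri-seq (Tri-wp (lit %qh 0 ⨟ lit %qt 0 ⨟ mov %e %m) {λ s → ResetAt N D s × reg s %e ≤ m}
      (z≤n , z≤n , m , Ready.m-reg I , (I , record
        { D-reg = D≡ ; size≡ = N≡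
        ; q-set = λ lt le → ⊥-elim (<⇒≱ lt le)
        ; r-set = λ lt le → ⊥-elim (<⇒≱ lt le)
        ; cur-set = λ lt le → ⊥-elim (<⇒≱ lt le)
        ; qh≡0 = refl ; qt-room = ≤-refl ; queued = λ ()
        ; sources = λ lt l → ⊥-elim (<⇒≱ lt (proj₁ (proj₂ l))) }) , ≤-refl)) λ (J , e≤m) →
    Tri-while (cost resetStep) (ResetAt N D) (λ s → reg s %e)
      (λ {s} J e≡ → Tri-wp resetStep (resetStep-wp {s = s} D≤H J e≡)) J e≤m

  -- The factor 2 pays for the queue entry that lowering q may create.
  weight : (r q : ℕ → ℕ) → ℕ → ℕ
  weight r q e = r (e + e) + r (suc (e + e)) + 2 * q e

  potential : (r q : ℕ → ℕ) → ℕ → ℕ → ℕ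
  potential r q qh qt = ∑ m (weight r q) + (qt ∸ qh)

  weight-r : ∀ {x s e v} r q → Slot x s e → r s ≡ suc v →
             ∑ m (weight (r [ s ≔ v ]) q) + 1 ≤ ∑ m (weight r q)
  weight-r {x} {s} {e} {v} r q sl rs =
    ∑-mono-at m e (proj₁ (proj₁ sl)) (proj₁ (proj₂ (proj₁ sl)))
      (λ i _ _ → +-monoˡ-≤ (2 * q i) (+-mono-≤ (drop (i + i)) (drop (suc (i + i)))))
      (≤-trans (≤-reflexive (trans (+-assoc (r′ (e + e) + r′ (suc (e + e))) (2 * q e) 1) (trans (cong (r′ (e + e) + r′ (suc (e + e)) +_) (+-comm (2 * q e) 1)) (sym (+-assoc (r′ (e + e) + r′ (suc (e + e))) 1 (2 * q e))))))
        (+-monoˡ-≤ (2 * q e) (strict (proj₂ sl))))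
    where
    r′ : ℕ → ℕ
    r′ = r [ s ≔ v ]
    drop : ∀ i → r′ i ≤ r i
    drop = [≔]-≤ r s (subst (v ≤_) (sym rs) (n≤1+n v))
    drop-s : ∀ {i} → s ≡ i → r′ i + 1 ≤ r i
    drop-s refl = ≤-reflexive (trans (cong (_+ 1) ([≔]-same r s v {s} refl)) (trans (+-comm v 1) (sym rs)))
    strict : (s ≡ e + e × fld end₁ e ≡ x ⊎ s ≡ suc (e + e) × fld end₂ e ≡ x) →
             r′ (e + e) + r′ (suc (e + e)) + 1 ≤ r (e + e) + r (suc (e + e))
    strict (inj₁ (eq , _)) = ≤-trans (≤-reflexive (trans (+-assoc (r′ (e + e)) _ 1) (trans (cong (r′ (e + e) +_) (+-comm _ 1)) (sym (+-assoc (r′ (e + e)) 1 _)))))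
                               (+-mono-≤ (drop-s eq) (drop (suc (e + e))))
    strict (inj₂ (eq , _)) = ≤-trans (≤-reflexive (+-assoc (r′ (e + e)) _ 1)) (+-mono-≤ (drop (e + e)) (drop-s eq))

  weight-q : ∀ {e t} r q → 1 ≤ e → e ≤ m → q e ≡ suc t →
             ∑ m (weight r (q [ e ≔ t ])) + 2 ≤ ∑ m (weight r q)
  weight-q {e} {t} r q 1≤e e≤m qe =
    ∑-mono-at m e 1≤e e≤m
      (λ i _ _ → +-monoʳ-≤ (r (i + i) + r (suc (i + i))) (*-monoʳ-≤ 2 ([≔]-≤ q e t≤ i)))
      (≤-trans (≤-reflexive (+-assoc (r (e + e) + r (suc (e + e))) _ 2))
        (+-monoʳ-≤ (r (e + e) + r (suc (e + e)))
          (≤-reflexive (trans (cong (λ v → 2 * v + 2) ([≔]-same q e t {e} refl))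
            (trans (+-comm (2 * t) 2) (trans (sym (*-suc 2 t)) (cong (2 *_) (sym qe))))))))
    where
    t≤ : t ≤ q e
    t≤ = subst (t ≤_) (sym qe) (n≤1+n t)

  ∑-lower : ∀ {e t} q → 1 ≤ e → e ≤ m → q e ≡ suc t → ∑ m (q [ e ≔ t ]) + 1 ≤ ∑ m q
  ∑-lower {e} {t} q 1≤e e≤m qe =
    ∑-mono-at m e 1≤e e≤m (λ i _ _ → [≔]-≤ q e (subst (t ≤_) (sym qe) (n≤1+n t)) i)
      (≤-reflexive (trans (cong (_+ 1) ([≔]-same q e t {e} refl)) (trans (+-comm t 1) (sym qe))))

  front≤H : ∀ {cur r q x} → Scan cur r q → Touched x → cur x ≤ H
  front≤H S tx with Scan.front S tx
  ... | inj₁ (eq , _) = ≤-trans (≤-reflexive eq) z≤n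
  ... | inj₂ (_ , sl) = ≤-trans (slot-≤ sl) m+m<H

  slot-end : ∀ {x s e} → Slot x s e → End x e
  slot-end (_ , inj₁ (_ , eq)) = inj₁ eq
  slot-end (_ , inj₂ (_ , eq)) = inj₂ eq

  -- Active u says that the left edge u must be scanned until its level is 0, and
  -- Extra collects what the respective bid maintains besides.
  module Scanning
    (K D : ℕ) (K<H : K < H)
    (Active : (mate q : ℕ → ℕ) (f : ℕ) → ℕ → Set)
    (Extra : (lev mate owner q rank queue : ℕ → ℕ) (qt f : ℕ) → Set)
    where

    -- `room` trades future queue entries against the levels of right edges. `pending` gives
    -- completeness: once the queue is empty, every active left edge has level 0.
    record Inv (cur r q queue mate owner rank : ℕ → ℕ) (qh qt f : ℕ) : Set where
      field
        scanned : Scan cur r q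
        q≤D     : ∀ e → 1 ≤ e → e ≤ m → q e ≤ D
        qh≤qt   : qh ≤ qt
        room    : qt + ∑ m q ≤ K
        queued  : ∀ {i} → i < qt → Left (queue i)
        pending : ∀ {u} → Left u → Active mate q f u →
                  level cur r u ≡ 0 ⊎ ∃[ i ] (qh ≤ i × i < qt × queue i ≡ u)
        extra   : Extra (level cur r) mate owner q rank queue qt f

    InvAt : Store → Set
    InvAt s = ReadyAt s × Inv (arr s #cur) (arr s #r) (arr s #q) (arr s #queue) (arr s #mate) (arr s #owner)
                              (arr s #rank) (reg s %qh) (reg s %qt) (reg s %f)

    Φ : Store → ℕ
    Φ s = potential (arr s #r) (arr s #q) (reg s %qh) (reg s %qt)

    record Picked (queue cur r q : ℕ → ℕ) (qh qt u x s p : ℕ) : Set where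
      field
        qh<qt : qh < qt
        u≡    : queue qh ≡ u
        x∈u   : End x u
        s≡    : cur x ≡ s
        p≡    : r s ≡ p
        top   : level cur r u ≡ p

    PickedAt : Store → Set
    PickedAt s = InvAt s × Picked (arr s #queue) (arr s #cur) (arr s #r) (arr s #q) (reg s %qh) (reg s %qt)
                                  (reg s %u) (reg s %x) (reg s %s) (reg s %p)

    -- By `tight`, e attains the level of u, so no right edge in conflict with u has more levels
    -- left.
    record Offer (queue cur r q : ℕ → ℕ) (qh qt u e t : ℕ) : Set where
      field
        qh<qt    : qh < qt
        u≡       : queue qh ≡ u
        conflict : Conflict u e
        t≡       : q e ≡ t
        t≢0      : t ≢ 0
        tight    : level cur r u ≡ t

    OfferAt : Store → Set
    OfferAt s = InvAt s × Offer (arr s #queue) (arr s #cur) (arr s #r) (arr s #q) (reg s %qh) (reg s %qt)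
                                (reg s %u) (reg s %e) (reg s %t)

    qt≤K : ∀ {cur r q queue mate owner rank qh qt f} → Inv cur r q queue mate owner rank qh qt f → qt ≤ K
    qt≤K I = ≤-trans (m≤m+n _ _) (Inv.room I)

    -- An entry may be dropped for two reasons: its left edge has level 0, or it is no longer
    -- active. The implication `done` covers both.
    skip-wp : ∀ {s} → InvAt s → reg s %qh < reg s %qt →
              (Active (arr s #mate) (arr s #q) (reg s %f) (arr s #queue (reg s %qh)) →
               level (arr s #cur) (arr s #r) (arr s #queue (reg s %qh)) ≡ 0) →
              wp (inc %qh %qh) (λ s′ → InvAt s′ × Φ s′ < Φ s) s
    skip-wp {s} (R , I) lt done =
      qh , refl , ≤-trans lt (≤-trans (qt≤K I) (<⇒≤ K<H)) ,
      (R , record { scanned = scanned ; q≤D = q≤D ; qh≤qt = lt ; room = room ; queued = queued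
                  ; pending = pending′ ; extra = extra }) ,
      +-monoʳ-< (∑ m (weight (arr s #r) (arr s #q))) (∸-monoʳ-< {reg s %qt} ≤-refl lt)
      where
      open Inv I
      qh : ℕ
      qh = reg s %qh
      pending′ : ∀ {u} → Left u → Active (arr s #mate) (arr s #q) (reg s %f) u →
                 level (arr s #cur) (arr s #r) u ≡ 0 ⊎ ∃[ i ] (suc qh ≤ i × i < reg s %qt × arr s #queue i ≡ u)
      pending′ {u} l act with pending l act
      ... | inj₁ eq = inj₁ eq
      ... | inj₂ (i , le , lt′ , eq) with i ≟ qh
      ...   | yes refl = inj₁ (subst (λ u → level (arr s #cur) (arr s #r) u ≡ 0) eq (done (subst (Active (arr s #mate) (arr s #q) (reg s %f)) (sym eq) act)))
      ...   | no ne = inj₂ (i , ≤∧≢⇒< le (λ eq′ → ne (sym eq′)) , lt′ , eq)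

    module _
      (extra-mono : ∀ {lev lev′ mate owner q rank queue qt f} → (∀ {u} → 1 ≤ u → u ≤ m → lev′ u ≤ lev u) →
                    Extra lev mate owner q rank queue qt f → Extra lev′ mate owner q rank queue qt f)
      (bid : Cmd) (bid-wp : ∀ {s} → OfferAt s → wp bid (λ s′ → InvAt s′ × Φ s′ < Φ s) s)
      where

      pass-wp : ∀ {s v} → PickedAt s → reg s %p ≡ suc v →
                wp (pass bid) (λ s′ → InvAt s′ × Φ s′ < Φ s) s
      pass-wp {s} {v} ((R , I) , P) p-suc with Scan.front (Inv.scanned I) (picked-touched I P)
        where
        picked-touched : ∀ {cur r q queue mate owner rank qh qt f u x s p} →
                         Inv cur r q queue mate owner rank qh qt f → Picked queue cur r q qh qt u x s p → Touched x
        picked-touched {u = u} I P =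
          let 1≤u , u≤m , _ = subst Left (Picked.u≡ P) (Inv.queued I (Picked.qh<qt P))
          in u , 1≤u , u≤m , Picked.x∈u P
      -- The pointer of an empty list is 0, where `r` is 0, against the positive `%p`.
      ... | inj₁ (cur≡0 , _) with () ← trans (sym p-suc) (trans (sym (Picked.p≡ P))
                (trans (cong (arr s #r) (trans (sym (Picked.s≡ P)) cur≡0)) (Ready.r-zero R)))
      ... | inj₂ (e , sl₀) =
        σ , refl , σ≤H , e , Lists.edge-slot lists sl ,
        e , refl , ≤m⇒≤H (proj₁ (proj₂ (proj₁ sl))) , q e , refl ,
        p ∸ q e , refl ,
        (λ d≡ →
          v , cong pred p-suc ,
          σ , refl , σ≤H , v , refl ,
          σ , refl , σ≤H , next σ , refl ,
          (λ n≡ → x , refl , x≤H , next σ , refl ,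
                  moved d≡ (inj₁ ((λ eq → 1+n≢0 (trans (sym n≡) eq)) , refl))) ,
          (λ n≡ → x , refl , x≤H , head x , refl ,
                  x , refl , x≤H , head x , refl ,
                  moved d≡ (inj₂ (n≡ , refl)))) ,
        (λ d≡ → bid-wp ((R , I) , record
          { qh<qt = qh<qt ; u≡ = u≡ ; conflict = conflict ; t≡ = refl
          ; t≢0 = λ eq → 1+n≢0 (trans (sym p-suc) (n≤0⇒n≡0 (subst (p ≤_) eq (m∸n≡0⇒m≤n d≡))))
          -- The failed test gives `p ≤ q e`, and `q e` is in turn at most the level of u, which is
          -- p.
          ; tight = ≤-antisym (≤-trans (≤-reflexive top) (m∸n≡0⇒m≤n d≡)) (conflict≤level scanned conflict) }))
        where
        open Ready R
        open Inv I
        open Picked P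
        σ p x u : ℕ
        σ = reg s %s
        p = reg s %p
        x = reg s %x
        u = reg s %u
        q next head : ℕ → ℕ
        q = arr s #q
        next = arr s #next
        head = arr s #head
        sl : Slot x σ e
        sl = subst (λ t → Slot x t e) s≡ sl₀
        left-u : Left u
        left-u = subst Left u≡ (queued qh<qt)
        conflict : Conflict u e
        conflict = left-u , proj₁ sl , x , x∈u , slot-end sl
        σ≤H : σ ≤ H
        σ≤H = ≤-trans (slot-≤ sl) m+m<H
        x≤H : x ≤ H
        x≤H with x∈u
        ... | inj₁ eq = subst (_≤ H) eq (end₁≤H (proj₁ left-u) (proj₁ (proj₂ left-u)))
        ... | inj₂ eq = subst (_≤ H) eq (end₂≤H (proj₁ left-u) (proj₁ (proj₂ left-u)))
        module _ {s′ w} (d≡ : p ∸ q e ≡ suc w) (succ : Successor next head x σ s′) where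
          private
            cur′ r′ : ℕ → ℕ
            cur′ = arr s #cur [ x ≔ s′ ]
            r′ = arr s #r [ σ ≔ v ]
            q≤v : q e ≤ v
            q≤v = s≤s⁻¹ (subst (q e <_) p-suc (m∸n≢0⇒n<m (λ eq → 1+n≢0 (trans (sym d≡) eq))))
            rs : arr s #r σ ≡ suc v
            rs = trans p≡ p-suc
            lower : ∀ {u} → 1 ≤ u → u ≤ m → level cur′ r′ u ≤ level (arr s #cur) (arr s #r) u
            lower = advance-level lists scanned sl s≡ rs q≤v succ
            scanned′ : Scan cur′ r′ q
            scanned′ = advance lists scanned sl s≡ rs q≤v succ
            pending′ : ∀ {u} → Left u → Active (arr s #mate) q (reg s %f) u →
                       level cur′ r′ u ≡ 0 ⊎ ∃[ i ] (reg s %qh ≤ i × i < reg s %qt × arr s #queue i ≡ u)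
            pending′ l act with pending l act
            ... | inj₁ eq = inj₁ (n≤0⇒n≡0 (≤-trans (lower (proj₁ l) (proj₁ (proj₂ l))) (≤-reflexive eq)))
            ... | inj₂ h  = inj₂ h
          moved : (Ready (reg s %m) next (arr s #edge) head r′ (arr s #mate) (arr s #owner) ×
                   Inv cur′ r′ q (arr s #queue) (arr s #mate) (arr s #owner) (arr s #rank)
                       (reg s %qh) (reg s %qt) (reg s %f)) ×
                  potential r′ q (reg s %qh) (reg s %qt) < Φ s
          moved = (ready-r (Scan.r-null scanned′) R , record
            { scanned = scanned′ ; q≤D = q≤D ; qh≤qt = qh≤qt ; room = room ; queued = queued
            ; pending = pending′ ; extra = extra-mono lower extra }) ,
            +-monoˡ-< (reg s %qt ∸ reg s %qh) (≤-trans (≤-reflexive (+-comm 1 (∑ m (weight r′ q)))) (weight-r (arr s #r) q sl rs))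

      scanStep-wp : ∀ {s v} → InvAt s × reg s %g ≡ reg s %qt ∸ reg s %qh → reg s %g ≡ suc v →
                    wp (scanStep bid) (λ s′ → (InvAt s′ × reg s′ %g ≡ reg s′ %qt ∸ reg s′ %qh) × Φ s′ < Φ s) s
      scanStep-wp {s} {v} ((R , I) , g≡) g-suc =
        qh , refl , qh≤H , u , refl ,
        u , refl , u≤m , x , refl , x≤H , cur x , refl ,
        cur x , refl , front≤H scanned x-touched , p , refl ,
        u , refl , u≤m , y , refl , y≤H , cur y , refl ,
        cur y , refl , front≤H scanned y-touched , p′ , refl ,
        p′ ∸ p , refl ,
        (λ d≡ → y , refl , cur y , refl , p′ , refl ,
                after ((R , I) , record { qh<qt = qh<qt ; u≡ = refl ; x∈u = inj₂ refl ; s≡ = refl ; p≡ = refl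
                                        ; top = m≤n⇒m⊔n≡n (<⇒≤ (m∸n≢0⇒n<m (λ eq → 1+n≢0 (trans (sym d≡) eq)))) }) refl) ,
        (λ d≡ → after ((R , I) , record { qh<qt = qh<qt ; u≡ = refl ; x∈u = inj₁ refl ; s≡ = refl ; p≡ = refl
                                        ; top = m≥n⇒m⊔n≡m (m∸n≡0⇒m≤n d≡) }) refl)
        where
        open Inv I
        cur r : ℕ → ℕ
        cur = arr s #cur
        r = arr s #r
        qh u x y p p′ : ℕ
        qh = reg s %qh
        u = arr s #queue qh
        x = fld end₁ u
        y = fld end₂ u
        p = r (cur x)
        p′ = r (cur y)
        qh<qt : qh < reg s %qt
        qh<qt = m∸n≢0⇒n<m (λ eq → 1+n≢0 (trans (sym g-suc) (trans g≡ eq)))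
        qh≤H : qh ≤ H
        qh≤H = ≤-trans (<⇒≤ qh<qt) (≤-trans (qt≤K I) (<⇒≤ K<H))
        1≤u : 1 ≤ u
        1≤u = proj₁ (queued qh<qt)
        u≤m : u ≤ m
        u≤m = proj₁ (proj₂ (queued qh<qt))
        x≤H : x ≤ H
        x≤H = end₁≤H 1≤u u≤m
        y≤H : y ≤ H
        y≤H = end₂≤H 1≤u u≤m
        x-touched : Touched x
        x-touched = u , 1≤u , u≤m , inj₁ refl
        y-touched : Touched y
        y-touched = u , 1≤u , u≤m , inj₂ refl
        after : ∀ {s₁} → PickedAt s₁ → Φ s₁ ≡ Φ s →
                wp (ifp %p (pass bid) (inc %qh %qh))
                  (wp (minus %g %qt %qh) (λ s′ → (InvAt s′ × reg s′ %g ≡ reg s′ %qt ∸ reg s′ %qh) × Φ s′ < Φ s)) s₁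
        after {s₁} (J , P) same =
          (λ p≡ → wp-mono (pass bid) (λ {s′} → finish {s′}) {s₁} (pass-wp {s₁} (J , P) p≡)) ,
          (λ p≡ → wp-mono (inc %qh %qh) (λ {s′} → finish {s′}) {s₁} (skip-wp {s₁} J (Picked.qh<qt P)
                    (λ _ → trans (cong (level (arr s₁ #cur) (arr s₁ #r)) (Picked.u≡ P)) (trans (Picked.top P) p≡))))
          where
          finish : ∀ {s′} → InvAt s′ × Φ s′ < Φ s₁ →
                   wp (minus %g %qt %qh) (λ s′ → (InvAt s′ × reg s′ %g ≡ reg s′ %qt ∸ reg s′ %qh) × Φ s′ < Φ s) s′
          finish {s′} (I , lt) = reg s′ %qt ∸ reg s′ %qh , refl , (I , refl) , subst (Φ s′ <_) same lt

      scan-tri : ∀ {s n} → InvAt s → Φ s ≤ n →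
                 Tri (scan bid) (1 + (3 + n * suc (cost (scanStep bid))))
                   (λ s → InvAt s × reg s %qh ≡ reg s %qt) s
      scan-tri {s} {n} I Φ≤ =
        Tri-seq (Tri-wp (minus %g %qt %qh)
          {λ s → (InvAt s × reg s %g ≡ reg s %qt ∸ reg s %qh) × Φ s ≤ n}
          (reg s %qt ∸ reg s %qh , refl , (I , refl) , Φ≤)) λ (J , Φ≤) →
        Tri-post (λ {s} → finish {s})
          (Tri-while (cost (scanStep bid)) (λ s → InvAt s × reg s %g ≡ reg s %qt ∸ reg s %qh) Φ
            (λ {s} J g≡ → Tri-wp (scanStep bid) (scanStep-wp {s} J g≡)) J Φ≤)
        where
        finish : ∀ {s} → (InvAt s × reg s %g ≡ reg s %qt ∸ reg s %qh) × reg s %g ≡ 0 →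
                 InvAt s × reg s %qh ≡ reg s %qt
        finish {s} ((J , g≡) , g≡0) =
          J , ≤-antisym (Inv.qh≤qt (proj₂ J)) (m∸n≡0⇒m≤n (trans (sym g≡) g≡0))

  rematch-other : ∀ (f : ℕ → ℕ) {o u e v} → v ≢ u → v ≢ o → (f [ o ≔ 0 ] [ u ≔ e ]) v ≡ f v
  rematch-other f {o} {u} {e} v≢u v≢o = trans ([≔]-other (f [ o ≔ 0 ]) u e v≢u) ([≔]-other f o 0 v≢o)

  -- The auction

  module Auction (D : ℕ) (D≤ : D ≤ suc m) where

    K : ℕ
    K = m + m * D

    Waiting : (mate q : ℕ → ℕ) (f : ℕ) → ℕ → Set
    Waiting mate q f u = mate u ≡ 0

    -- Complementary slackness with an error of one level on sold right edges; unsold ones keep all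
    -- D levels, that is, price 0.
    record Prices (lev mate owner q rank queue : ℕ → ℕ) (qt f : ℕ) : Set where
      field
        near : ∀ {u} → mate u ≢ 0 → 1 ≤ u → u ≤ m → lev u ≤ suc (q (mate u))
        free : ∀ {e} → 1 ≤ e → e ≤ m → owner e ≡ 0 → q e ≡ D

    prices-mono : ∀ {lev lev′ mate owner q rank queue qt f} → (∀ {u} → 1 ≤ u → u ≤ m → lev′ u ≤ lev u) →
                  Prices lev mate owner q rank queue qt f → Prices lev′ mate owner q rank queue qt f
    prices-mono lower E = record
      { near = λ ne 1≤u u≤m → ≤-trans (lower 1≤u u≤m) (near ne 1≤u u≤m) ; free = free }
      where open Prices E

    open Scanning K D (entries<H D≤) Waiting Prices public

    auction-wp : ∀ {s} → OfferAt s → wp auction (λ s′ → InvAt s′ × Φ s′ < Φ s) s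
    auction-wp {s} ((R , I) , P) =
      u , refl , ≤m⇒≤H u≤m , mate u , refl ,
      (λ {w} f≡ → skip-wp {setv %f (mate u) s} (R , flag) qh<qt
         (λ act → ⊥-elim (1+n≢0 (trans (sym f≡) (trans (cong mate (sym u≡)) act))))) ,
      (λ f≡ →
        t′ , refl , e , refl , ≤m⇒≤H e≤m , t′ , refl ,
        e , refl , ≤m⇒≤H e≤m , o , refl ,
        z≤n ,
        o , refl , ≤m⇒≤H (owner≤m matching e) , 0 , refl ,
        mate u , refl , ≤m⇒≤H (mate≤m matching u) , 0 , refl ,
        u , refl , ≤m⇒≤H u≤m , e , refl ,
        e , refl , ≤m⇒≤H e≤m , u , refl ,
        qh , refl , <⇒≤ (≤-<-trans qh<qt qt<H) ,
        (λ {o′} o≡ → qt , refl , <⇒≤ qt<H , o , refl , qt , refl , qt<H , pushed f≡ o≡) ,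
        (λ o≡ → dropped f≡ o≡))
      where
      open Ready R
      open Inv I
      open Offer P
      open Prices extra
      u e t′ o qh qt : ℕ
      u = reg s %u
      e = reg s %e
      t′ = pred (reg s %t)
      qh = reg s %qh
      qt = reg s %qt
      mate owner q queue : ℕ → ℕ
      mate = arr s #mate
      owner = arr s #owner
      q = arr s #q
      queue = arr s #queue
      o = owner e
      mate′ owner′ q′ : ℕ → ℕ
      mate′ = mate [ o ≔ 0 ] [ u ≔ e ]
      owner′ = owner [ mate u ≔ 0 ] [ e ≔ u ]
      q′ = q [ e ≔ t′ ]
      lev : ℕ → ℕ
      lev = level (arr s #cur) (arr s #r)
      left-u : Left u
      left-u = proj₁ conflict
      right-e : Right e
      right-e = proj₁ (proj₂ conflict)
      u≤m : u ≤ m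
      u≤m = proj₁ (proj₂ left-u)
      e≤m : e ≤ m
      e≤m = proj₁ (proj₂ right-e)
      1≤e : 1 ≤ e
      1≤e = proj₁ right-e
      qt<H : suc qt ≤ H
      qt<H = ≤-trans (s≤s (qt≤K I)) (entries<H D≤)
      t-suc : q e ≡ suc t′
      t-suc = trans t≡ (sym (suc-pred (reg s %t) {{≢-nonZero t≢0}}))
      t′≤q : t′ ≤ q e
      t′≤q = ≤-trans (n≤1+n t′) (≤-reflexive (sym t-suc))
      q′-e : ∀ {i} → i ≡ e → q′ i ≡ t′
      q′-e = [≔]-same q e t′
      q′-other : ∀ {i} → i ≢ e → q′ i ≡ q i
      q′-other = [≔]-other q e t′
      flag : Inv (arr s #cur) (arr s #r) q queue mate owner (arr s #rank) qh qt (mate u)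
      flag = record { scanned = scanned ; q≤D = q≤D ; qh≤qt = qh≤qt ; room = room ; queued = queued
                    ; pending = pending ; extra = record { near = near ; free = free } }
      matching′ : Matching mate′ owner′
      matching′ = rematch matching conflict
      ready′ : Ready (reg s %m) (arr s #next) (arr s #edge) (arr s #head) (arr s #r) mate′ owner′
      ready′ = record { m-reg = m-reg ; lists = lists ; r-zero = r-zero ; matching = matching′ }
      near′ : ∀ {v} → mate′ v ≢ 0 → 1 ≤ v → v ≤ m → lev v ≤ suc (q′ (mate′ v))
      near′ {v} ne 1≤v v≤m with v ≟ u | v ≟ o
      -- The buyer bids at its exact level and the sale takes one level from e: this is where the
      -- error of one arises.
      ... | yes refl | _ = ≤-reflexive (trans tight (trans (sym t≡) (trans t-suc
                             (cong suc (sym (q′-e ([≔]-same (mate [ o ≔ 0 ]) u e {u} refl)))))))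
      ... | no v≢u | yes refl = ⊥-elim (ne (trans ([≔]-other (mate [ o ≔ 0 ]) u e v≢u) ([≔]-same mate o 0 {o} refl)))
      ... | no v≢u | no v≢o =
        subst (λ k → lev v ≤ suc k) (sym (trans (cong q′ same) (q′-other (λ eq → v≢o (trans (sym (inverse (left matching) ne′)) (cong owner eq))))))
              (near ne′ 1≤v v≤m)
        where
        same : mate′ v ≡ mate v
        same = rematch-other mate v≢u v≢o
        ne′ : mate v ≢ 0
        ne′ eq = ne (trans same eq)
      free′ : mate u ≡ 0 → ∀ {i} → 1 ≤ i → i ≤ m → owner′ i ≡ 0 → q′ i ≡ D
      free′ f≡ {i} 1≤i i≤m oi≡0 with i ≟ e
      ... | yes refl = ⊥-elim (coloured≢0 left-u (trans (sym ([≔]-same (owner [ mate u ≔ 0 ]) e u {e} refl)) oi≡0))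
      -- The bidder was free, so clearing its former mate touches index 0 only: a right edge once
      -- sold stays sold.
      ... | no ne = trans (q′-other ne) (free 1≤i i≤m (trans (sym (rematch-other owner ne
                      (λ eq → <⇒≢ 1≤i (sym (trans eq f≡))))) oi≡0))
      q≤D′ : ∀ i → 1 ≤ i → i ≤ m → q′ i ≤ D
      q≤D′ i 1≤i i≤m = ≤-trans ([≔]-≤ q e t′≤q i) (q≤D i 1≤i i≤m)
      room′ : suc qt + ∑ m q′ ≤ K
      room′ = ≤-trans (≤-reflexive (trans (sym (+-suc qt _)) (cong (qt +_) (+-comm 1 (∑ m q′)))))
                (≤-trans (+-monoʳ-≤ qt (∑-lower q 1≤e e≤m t-suc)) room)
      still : ∀ {v} → v ≢ o → mate′ v ≡ 0 → mate v ≡ 0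
      still {v} v≢o free-v with v ≟ u
      ... | yes refl = ⊥-elim (coloured≢0 right-e (trans (sym ([≔]-same (mate [ o ≔ 0 ]) u e {u} refl)) free-v))
      ... | no v≢u = trans (sym (rematch-other mate v≢u v≢o)) free-v
      waiting : ∀ {v} → Left v → v ≢ o → mate′ v ≡ 0 →
                lev v ≡ 0 ⊎ ∃[ i ] (suc qh ≤ i × i < qt × queue i ≡ v)
      waiting {v} l v≢o free-v with pending l (still v≢o free-v)
      ... | inj₁ eq = inj₁ eq
      ... | inj₂ (i , le , lt , eq) with i ≟ qh
      ...   | yes refl = ⊥-elim (coloured≢0 right-e (trans (sym ([≔]-same (mate [ o ≔ 0 ]) u e {u} refl))
                           (trans (cong mate′ (trans (sym u≡) eq)) free-v)))
      ...   | no ne = inj₂ (i , ≤∧≢⇒< le (λ eq′ → ne (sym eq′)) , lt , eq)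
      prices′ : mate u ≡ 0 → ∀ {queue qt f} → Prices lev mate′ owner′ q′ (arr s #rank) queue qt f
      prices′ f≡ = record { near = near′ ; free = free′ f≡ }
      -- The head of the queue is consumed, so even with a push the queue does not grow, and the
      -- drop of `q` is clear gain.
      smaller : ∀ {qt′} → qt′ ≤ suc qt → potential (arr s #r) q′ (suc qh) qt′ < Φ s
      smaller {qt′} qt′≤ = begin-strict
        W′ + (qt′ ∸ suc qh)      ≤⟨ +-monoʳ-≤ W′ (∸-monoˡ-≤ (suc qh) qt′≤) ⟩
        W′ + (qt ∸ qh)           <⟨ +-monoˡ-< (qt ∸ qh) (m<m+n W′ {2} (s≤s z≤n)) ⟩
        W′ + 2 + (qt ∸ qh)       ≤⟨ +-monoˡ-≤ (qt ∸ qh) (weight-q (arr s #r) q 1≤e e≤m t-suc) ⟩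
        Φ s                      ∎
        where
        open ≤-Reasoning
        W′ : ℕ
        W′ = ∑ m (weight (arr s #r) q′)
      module _ (f≡ : mate u ≡ 0) where
        dropped : o ≡ 0 →
          (Ready (reg s %m) (arr s #next) (arr s #edge) (arr s #head) (arr s #r) mate′ owner′ ×
           Inv (arr s #cur) (arr s #r) q′ queue mate′ owner′ (arr s #rank) (suc qh) qt (mate u)) ×
          potential (arr s #r) q′ (suc qh) qt < Φ s
        dropped o≡ = (ready′ , record
          { scanned = lower-q scanned t′≤q ; q≤D = q≤D′ ; qh≤qt = qh<qt
          ; room = ≤-trans (n≤1+n _) room′ ; queued = queued
          ; pending = λ l → waiting l (λ eq → coloured≢0 l (trans eq o≡))
          ; extra = prices′ f≡ }) , smaller (n≤1+n qt)
        pushed : ∀ {o′} → o ≡ suc o′ →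
          (Ready (reg s %m) (arr s #next) (arr s #edge) (arr s #head) (arr s #r) mate′ owner′ ×
           Inv (arr s #cur) (arr s #r) q′ (queue [ qt ≔ o ]) mate′ owner′ (arr s #rank) (suc qh) (suc qt) (mate u)) ×
          potential (arr s #r) q′ (suc qh) (suc qt) < Φ s
        pushed {o′} o≡ = (ready′ , record
          { scanned = lower-q scanned t′≤q ; q≤D = q≤D′ ; qh≤qt = m≤n⇒m≤1+n qh<qt
          ; room = room′ ; queued = queued′ ; pending = pending′
          ; extra = prices′ f≡ }) , smaller ≤-refl
          where
          left-o : Left o
          left-o = proj₁ (relates (right matching) (λ eq → 1+n≢0 (trans (sym o≡) eq)))
          queued′ : ∀ {i} → i < suc qt → Left ((queue [ qt ≔ o ]) i)
          queued′ {i} i< with i ≟ qt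
          ... | yes refl = subst Left (sym ([≔]-same queue qt o {qt} refl)) left-o
          ... | no ne = subst Left (sym ([≔]-other queue qt o ne)) (queued (≤∧≢⇒< (s≤s⁻¹ i<) ne))
          pending′ : ∀ {v} → Left v → mate′ v ≡ 0 →
                     lev v ≡ 0 ⊎ ∃[ i ] (suc qh ≤ i × i < suc qt × (queue [ qt ≔ o ]) i ≡ v)
          pending′ {v} l free-v with v ≟ o
          ... | yes refl = inj₂ (qt , qh<qt , ≤-refl , [≔]-same queue qt o {qt} refl)
          ... | no v≢o with waiting l v≢o free-v
          ...   | inj₁ eq = inj₁ eq
          ...   | inj₂ (i , le , lt , eq) =
                  inj₂ (i , le , m≤n⇒m≤1+n lt , trans ([≔]-other queue qt o (<⇒≢ lt)) eq)

  reset-front : ∀ {N D s x} → ResetAt N D s → reg s %e ≡ 0 → Touched x →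
                (arr s #cur x ≡ 0 × (∀ {t e} → ¬ Slot x t e)) ⊎
                (∃[ e ] Slot x (arr s #cur x) e × (∀ {t e′} → Slot x t e′ → arr s #cur x ≤ t))
  reset-front {s = s} {x} (R , J) e≡0 (e , 1≤e , e≤m , end) with Lists.head-least (Ready.lists R) x
  ... | inj₁ (eq , none) = inj₁ (trans copied eq , λ sl → n≮0 (none sl))
    where copied = Reset.cur-set J (subst (_< e) (sym e≡0) 1≤e) e≤m end
  ... | inj₂ (e′ , sl , _ , least) =
    inj₂ (e′ , subst (λ t → Slot x t e′) (sym copied) sl , λ sl′ → subst (_≤ _) (sym copied) (case (least sl′)))
    where
    copied : arr s #cur x ≡ arr s #head x
    copied = Reset.cur-set J (subst (_< e) (sym e≡0) 1≤e) e≤m end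
    case : ∀ {t} → t < 0 ⊎ arr s #head x ≤ t → arr s #head x ≤ t
    case (inj₂ le) = le

  reset-slot : ∀ {N D s x t e} → ResetAt N D s → reg s %e ≡ 0 → Slot x t e → arr s #r t ≡ D
  reset-slot {s = s} (R , J) e≡0 ((1≤e , e≤m , _) , inj₁ (refl , _)) =
    proj₁ (Reset.r-set J (subst (_< _) (sym e≡0) 1≤e) e≤m)
  reset-slot {s = s} (R , J) e≡0 ((1≤e , e≤m , _) , inj₂ (refl , _)) =
    proj₂ (Reset.r-set J (subst (_< _) (sym e≡0) 1≤e) e≤m)

  reset-q : ∀ {N D s e} → ResetAt N D s → reg s %e ≡ 0 → 1 ≤ e → e ≤ m → arr s #q e ≡ D
  reset-q (R , J) e≡0 1≤e = Reset.q-set J (subst (_< _) (sym e≡0) 1≤e)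

  reset-scan : ∀ {N D s} → ResetAt N D s → reg s %e ≡ 0 → Scan (arr s #cur) (arr s #r) (arr s #q)
  reset-scan {N} {D} {s} J e≡0 = record
    { r-null = Ready.r-zero (proj₁ J)
    ; front  = front′
    ; levels = levels′
    ; q≤r    = λ sl → ≤-reflexive (trans (reset-q {s = s} J e≡0 (proj₁ (proj₁ sl)) (proj₁ (proj₂ (proj₁ sl))))
                                         (sym (reset-slot {s = s} J e≡0 sl)))
    }
    where
    front′ : ∀ {x} → Touched x → (arr s #cur x ≡ 0 × (∀ {t e} → ¬ Slot x t e)) ⊎ (∃[ e ] Slot x (arr s #cur x) e)
    front′ tx with reset-front {s = s} J e≡0 tx
    ... | inj₁ h            = inj₁ h
    ... | inj₂ (e , sl , _) = inj₂ (e , sl)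
    levels′ : ∀ {x t e} → Slot x t e →
              (arr s #cur x ≤ t × arr s #r t ≡ arr s #r (arr s #cur x)) ⊎
              (t < arr s #cur x × suc (arr s #r t) ≡ arr s #r (arr s #cur x))
    levels′ sl with reset-front {s = s} J e≡0 (slot-touched sl)
    ... | inj₁ (_ , none) = ⊥-elim (none sl)
    ... | inj₂ (_ , sl′ , first) =
      inj₁ (first sl , trans (reset-slot {s = s} J e≡0 sl) (sym (reset-slot {s = s} J e≡0 sl′)))

  reset-level : ∀ {N D s u} → ResetAt N D s → reg s %e ≡ 0 → 1 ≤ u → u ≤ m → level (arr s #cur) (arr s #r) u ≤ D
  reset-level {N} {D} {s} {u} J e≡0 1≤u u≤m = ⊔-lub (bound (u , 1≤u , u≤m , inj₁ refl)) (bound (u , 1≤u , u≤m , inj₂ refl))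
    where
    bound : ∀ {x} → Touched x → arr s #r (arr s #cur x) ≤ D
    bound tx with reset-front {s = s} J e≡0 tx
    ... | inj₁ (eq , _)     = ≤-trans (≤-reflexive (trans (cong (arr s #r) eq) (Ready.r-zero (proj₁ J)))) z≤n
    ... | inj₂ (_ , sl , _) = ≤-reflexive (reset-slot {s = s} J e≡0 sl)

  reset-room : ∀ {N D s} → ResetAt N D s → reg s %e ≡ 0 → reg s %qt + ∑ m (arr s #q) ≤ m + m * D
  reset-room {s = s} J e≡0 = +-mono-≤ (≤-trans (m≤m+n _ _) (Reset.qt-room (proj₂ J)))
    (∑-≤-* m _ λ e 1≤e e≤m → ≤-reflexive (reset-q {s = s} J e≡0 1≤e e≤m))

  -- Per edge, two slots at D and twice `q` at D make 4D; the queue adds at most m.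
  reset-potential : ∀ {N D s} → ResetAt N D s → reg s %e ≡ 0 →
                    potential (arr s #r) (arr s #q) (reg s %qh) (reg s %qt) ≤ m * (4 * D) + m
  reset-potential {N} {D} {s} J e≡0 =
    +-mono-≤ (∑-≤-* m (4 * D) λ e 1≤e e≤m →
                let r₁ , r₂ = Reset.r-set (proj₂ J) (subst (_< e) (sym e≡0) 1≤e) e≤m
                in ≤-reflexive (trans (cong₂ _+_ (cong₂ _+_ r₁ r₂) (cong (2 *_) (reset-q {s = s} J e≡0 1≤e e≤m))) (+-assoc D D (2 * D))))
             (≤-trans (m∸n≤m _ (reg s %qh)) (≤-trans (m≤m+n _ _) (Reset.qt-room (proj₂ J))))

  module AuctionResult (D : ℕ) (root : Root m D) (m≤D² : m ≤ D * D) where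

    open Auction D (root-≤ root)

    auction-start : ∀ {N s} → ResetAt N D s → reg s %e ≡ 0 → InvAt s
    auction-start {N} {s} J e≡0 = proj₁ J , record
      { scanned = reset-scan {s = s} J e≡0
      ; q≤D = λ e 1≤e e≤m → ≤-reflexive (reset-q {s = s} J e≡0 1≤e e≤m)
      ; qh≤qt = ≤-trans (≤-reflexive qh≡0) z≤n
      ; room = reset-room {s = s} J e≡0
      ; queued = λ lt → proj₁ (queued lt)
      ; pending = pending′
      ; extra = record
          { near = near′
          ; free = λ 1≤e e≤m _ → reset-q {s = s} J e≡0 1≤e e≤m }
      }
      where
      open Reset (proj₂ J)
      pending′ : ∀ {u} → Left u → arr s #mate u ≡ 0 →
                 level (arr s #cur) (arr s #r) u ≡ 0 ⊎ ∃[ i ] (reg s %qh ≤ i × i < reg s %qt × arr s #queue i ≡ u)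
      pending′ l free-u =
        let i , lt , eq = sources (subst (_< _) (sym e≡0) (proj₁ l)) l free-u
        in inj₂ (i , ≤-trans (≤-reflexive qh≡0) z≤n , lt , eq)
      near′ : ∀ {u} → arr s #mate u ≢ 0 → 1 ≤ u → u ≤ m →
              level (arr s #cur) (arr s #r) u ≤ suc (arr s #q (arr s #mate u))
      near′ ne 1≤u u≤m =
        let 1≤e , e≤m , _ = proj₁ (proj₂ (relates (left (Ready.matching (proj₁ J))) ne))
        in ≤-trans (reset-level {s = s} J e≡0 1≤u u≤m)
             (≤-trans (≤-reflexive (sym (reset-q {s = s} J e≡0 1≤e e≤m))) (n≤1+n _))

    -- `Z` is the level on left edges and the price `D ∸ q` on right edges. It gives every conflict
    -- at least D and every own pair at most D + 1, and free edges weigh 0. The excess over D times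
    -- |M| is thus |M|, which is at most m ≤ D².
    auction-bound : ∀ {s} → InvAt s → reg s %qh ≡ reg s %qt →
                    ∀ {mate owner} → Matching mate owner → matched mate ≤ matched (arr s #mate) + D
    auction-bound {s} (R , I) done {mate} {owner} M =
      *-cancelˡ-≤ D {{>-nonZero (Root.1≤D root)}} (begin
        D * matched mate                 ≤⟨ weak-duality M D Z feasible ⟩
        ∑ m Z                            ≤⟨ strong-duality matching (suc D) Z nearly-tight unmatched ⟩
        suc D * matched (arr s #mate)    ≤⟨ +-monoˡ-≤ _ small ⟩
        D * D + D * matched (arr s #mate) ≡⟨ +-comm (D * D) _ ⟩
        D * matched (arr s #mate) + D * D ≡⟨ sym (*-distribˡ-+ D _ D) ⟩
        D * (matched (arr s #mate) + D)   ∎)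
      where
      open ≤-Reasoning
      open Ready R
      open Inv I
      open Prices extra
      lev q : ℕ → ℕ
      lev = level (arr s #cur) (arr s #r)
      q = arr s #q
      small : matched (arr s #mate) ≤ D * D
      small = ≤-trans (∑-≤-* m 1 λ i _ _ → positive≤1 _) (≤-trans (≤-reflexive (*-identityʳ m)) m≤D²)
      colourZ : ℕ → ℕ → ℕ
      colourZ 1 i = lev i
      colourZ _ i = D ∸ q i
      Z : ℕ → ℕ
      Z i = colourZ (fld col i) i
      Z-left : ∀ {i} → Left i → Z i ≡ lev i
      Z-left {i} (_ , _ , eq) = cong (λ k → colourZ k i) eq
      Z-right : ∀ {i} → Right i → Z i ≡ D ∸ q i
      Z-right {i} (_ , _ , eq) = cong (λ k → colourZ k i) eq
      feasible : ∀ {u} → mate u ≢ 0 → D ≤ Z u + Z (mate u)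
      feasible {u} ne =
        let k = relates (left M) ne in
        ≤-trans (m≤n+m∸n D (q (mate u)))
          (≤-trans (+-monoˡ-≤ (D ∸ q (mate u)) (conflict≤level scanned k))
            (≤-reflexive (sym (cong₂ _+_ (Z-left (proj₁ k)) (Z-right (proj₁ (proj₂ k)))))))
      nearly-tight : ∀ {u} → arr s #mate u ≢ 0 → Z u + Z (arr s #mate u) ≤ suc D
      nearly-tight {u} ne =
        let k = relates (left matching) ne
            1≤u , u≤m , _ = proj₁ k
            1≤e , e≤m , _ = proj₁ (proj₂ k)
        in ≤-trans (≤-reflexive (cong₂ _+_ (Z-left (proj₁ k)) (Z-right (proj₁ (proj₂ k)))))
             (≤-trans (+-monoˡ-≤ (D ∸ q (arr s #mate u)) (near ne 1≤u u≤m))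
               (≤-reflexive (cong suc (m+[n∸m]≡n (q≤D _ 1≤e e≤m)))))
      unmatched : ∀ {i} → 1 ≤ i → i ≤ m → arr s #mate i ≡ 0 → arr s #owner i ≡ 0 → Z i ≡ 0
      unmatched {i} 1≤i i≤m free-u free-e with colours 1≤i i≤m
      ... | inj₂ eq = trans (Z-right (1≤i , i≤m , eq)) (trans (cong (D ∸_) (free 1≤i i≤m free-e)) (n∸n≡0 D))
      ... | inj₁ eq with pending (1≤i , i≤m , eq) free-u
      ...   | inj₁ lev≡0 = trans (Z-left (1≤i , i≤m , eq)) lev≡0
      ...   | inj₂ (j , le , lt , _) = ⊥-elim (<⇒≱ lt (subst (_≤ j) done le))

  -- The search for an augmenting path

  Cover : ℕ → Set
  Cover k = ∃[ cov ] (∑ m cov ≤ k × (∀ {u e} → Conflict u e → cov u ≢ 0 ⊎ cov e ≢ 0))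

  -- A parent pointer is the queue index of the left edge that discovered a right edge.
  Rooted : (mate q rank queue : ℕ → ℕ) → ℕ → Set
  Rooted mate q rank queue i =
    mate (queue i) ≡ 0 ⊎ (q (mate (queue i)) ≡ 0 × rank (mate (queue i)) < i)

  Discovered : (q rank queue : ℕ → ℕ) → ℕ → Set
  Discovered q rank queue qt = ∀ {e} → Right e → q e ≡ 0 → rank e < qt × Conflict (queue (rank e)) e

  Fresh : (owner q : ℕ → ℕ) → ℕ → Set
  Fresh owner q f = Right f × q f ≡ 0 × owner f ≡ 0

  module Search (N : ℕ) where

    -- Requiring `f ≡ 0` makes the obligation to scan lapse as soon as a free right edge is found,
    -- so the queue may be abandoned.
    Reached : (mate q : ℕ → ℕ) (f : ℕ) → ℕ → Set
    Reached mate q f u = f ≡ 0 × (mate u ≡ 0 ⊎ q (mate u) ≡ 0)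

    -- `rooted` and `seen` let a path be traced back: a queue entry that is not free has a marked
    -- mate whose parent stands earlier in the queue, so the path ends at a free left edge.
    record Forest (lev mate owner q rank queue : ℕ → ℕ) (qt f : ℕ) : Set where
      field
        size≡   : matched mate ≡ N
        rooted  : ∀ {i} → i < qt → Rooted mate q rank queue i
        seen    : Discovered q rank queue qt
        unfound : f ≡ 0 → ∀ {e} → Right e → q e ≡ 0 → owner e ≢ 0
        found   : f ≢ 0 → Fresh owner q f

    forest-mono : ∀ {lev lev′ mate owner q rank queue qt f} → (∀ {u} → 1 ≤ u → u ≤ m → lev′ u ≤ lev u) →
                  Forest lev mate owner q rank queue qt f → Forest lev′ mate owner q rank queue qt f
    forest-mono _ E = record { size≡ = size≡ ; rooted = rooted ; seen = seen ; unfound = unfound ; found = found }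
      where open Forest E

    open Scanning (m + m * 1) 1 (entries<H (s≤s z≤n)) Reached Forest public

    search-wp : ∀ {s} → OfferAt s → wp search (λ s′ → InvAt s′ × Φ s′ < Φ s) s
    search-wp {s} ((R , I) , P) =
      0 , t′≡0 , e , refl , ≤m⇒≤H e≤m , 0 , refl ,
      e , refl , ≤m⇒≤H e≤m , qh , refl ,
      e , refl , ≤m⇒≤H e≤m , o , refl ,
      (λ {o′} o≡ → qt , refl , <⇒≤ qt<H , o , refl , qt , refl , qt<H , pushed o≡) ,
      (λ o≡ → e , refl , qt , refl , discovered o≡)
      where
      open Ready R
      open Inv I
      open Offer P
      open Forest extra
      u e o qh qt f : ℕ
      u = reg s %u
      e = reg s %e
      qh = reg s %qh
      qt = reg s %qt
      f = reg s %f
      mate owner q queue rank : ℕ → ℕ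
      mate = arr s #mate
      owner = arr s #owner
      q = arr s #q
      queue = arr s #queue
      rank = arr s #rank
      o = owner e
      q′ rank′ queue′ lev : ℕ → ℕ
      q′ = q [ e ≔ 0 ]
      rank′ = rank [ e ≔ qh ]
      queue′ = queue [ qt ≔ o ]
      lev = level (arr s #cur) (arr s #r)
      right-e : Right e
      right-e = proj₁ (proj₂ conflict)
      1≤e : 1 ≤ e
      1≤e = proj₁ right-e
      e≤m : e ≤ m
      e≤m = proj₁ (proj₂ right-e)
      qt<H : suc qt ≤ H
      qt<H = ≤-trans (s≤s (qt≤K I)) (entries<H (s≤s z≤n))
      -- With one level, `q` is a mark: 1 for unseen and 0 for seen.
      qe≡1 : q e ≡ 1
      qe≡1 = ≤-antisym (q≤D e 1≤e e≤m) (n≢0⇒n>0 (λ eq → t≢0 (trans (sym t≡) eq)))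
      t′≡0 : pred (reg s %t) ≡ 0
      t′≡0 = cong pred (trans (sym t≡) qe≡1)
      q′-e : ∀ {i} → i ≡ e → q′ i ≡ 0
      q′-e = [≔]-same q e 0
      q′-zero : ∀ {i} → q i ≡ 0 → q′ i ≡ 0
      q′-zero {i} eq = n≤0⇒n≡0 (≤-trans ([≔]-≤ q e z≤n i) (≤-reflexive eq))
      unseen : ∀ {i} → q i ≡ 0 → i ≢ e
      unseen eq refl = 1+n≢0 (trans (sym qe≡1) eq)
      seen-before : ∀ {i} → i ≢ e → q′ i ≡ 0 → q i ≡ 0
      seen-before ne eq = trans (sym ([≔]-other q e 0 ne)) eq
      q≤1 : ∀ i → 1 ≤ i → i ≤ m → q′ i ≤ 1
      q≤1 i 1≤i i≤m = ≤-trans ([≔]-≤ q e z≤n i) (q≤D i 1≤i i≤m)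
      room′ : suc qt + ∑ m q′ ≤ m + m * 1
      room′ = ≤-trans (≤-reflexive (trans (sym (+-suc qt _)) (cong (qt +_) (+-comm 1 (∑ m q′)))))
                (≤-trans (+-monoʳ-≤ qt (∑-lower q 1≤e e≤m qe≡1)) room)
      rooted′ : ∀ {i} → Rooted mate q rank queue i → Rooted mate q′ rank′ queue i
      rooted′ (inj₁ eq)        = inj₁ eq
      rooted′ (inj₂ (eq , lt)) = inj₂ (q′-zero eq , subst (_< _) (sym ([≔]-other rank e qh (unseen eq))) lt)
      seen′ : Discovered q′ rank′ queue qt
      seen′ {i} r eq with i ≟ e
      ... | yes refl = subst (λ k → k < qt × Conflict (queue k) e) (sym ([≔]-same rank e qh {e} refl))
                         (qh<qt , subst (λ u → Conflict u e) (sym u≡) conflict)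
      ... | no ne = subst (λ k → k < qt × Conflict (queue k) i) (sym ([≔]-other rank e qh ne))
                      (seen r (seen-before ne eq))
      found′ : f ≢ 0 → Fresh owner q′ f
      found′ ne = let r , z , o = found ne in r , q′-zero z , o
      queue′-old : ∀ {i} → i < qt → queue′ i ≡ queue i
      queue′-old lt = [≔]-other queue qt o (<⇒≢ lt)
      -- Here the head stays in the queue, as u may discover more edges. Of the two units gained
      -- from `q`, one pays for the new entry.
      smaller : ∀ {k} → k ≤ suc (qt ∸ qh) → ∑ m (weight (arr s #r) q′) + k < Φ s
      smaller {k} k≤ = begin-strict
        W′ + k                   <⟨ +-monoʳ-< W′ (≤-<-trans k≤ ≤-refl) ⟩
        W′ + (2 + (qt ∸ qh))     ≡⟨ sym (+-assoc W′ 2 _) ⟩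
        W′ + 2 + (qt ∸ qh)       ≤⟨ +-monoˡ-≤ (qt ∸ qh) (weight-q (arr s #r) q 1≤e e≤m qe≡1) ⟩
        Φ s                      ∎
        where
        open ≤-Reasoning
        W′ : ℕ
        W′ = ∑ m (weight (arr s #r) q′)
      discovered : o ≡ 0 →
        (Ready (reg s %m) (arr s #next) (arr s #edge) (arr s #head) (arr s #r) mate owner ×
         Inv (arr s #cur) (arr s #r) q′ queue mate owner rank′ qt qt e) ×
        potential (arr s #r) q′ qt qt < Φ s
      discovered o≡ = (R , record
        { scanned = lower-q scanned z≤n ; q≤D = q≤1 ; qh≤qt = ≤-refl ; room = ≤-trans (n≤1+n _) room′
        ; queued = queued
        ; pending = λ _ (e≡0 , _) → ⊥-elim (<⇒≢ 1≤e (sym e≡0))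
        ; extra = record
            { size≡ = size≡
            ; rooted = λ lt → rooted′ (rooted lt)
            ; seen = seen′
            ; unfound = λ e≡0 → ⊥-elim (<⇒≢ 1≤e (sym e≡0))
            ; found = λ _ → right-e , q′-e {e} refl , o≡ } }) ,
        smaller (≤-trans (≤-reflexive (n∸n≡0 qt)) z≤n)
      pushed : ∀ {o′} → o ≡ suc o′ →
        (Ready (reg s %m) (arr s #next) (arr s #edge) (arr s #head) (arr s #r) mate owner ×
         Inv (arr s #cur) (arr s #r) q′ queue′ mate owner rank′ qh (suc qt) f) ×
        potential (arr s #r) q′ qh (suc qt) < Φ s
      pushed {o′} o≡ = (R , record
        { scanned = lower-q scanned z≤n ; q≤D = q≤1 ; qh≤qt = m≤n⇒m≤1+n qh≤qt ; room = room′
        ; queued = queued″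
        ; pending = pending″
        ; extra = record
            { size≡ = size≡
            ; rooted = rooted″
            ; seen = λ r eq → let lt , k = seen′ r eq in
                m≤n⇒m≤1+n lt , subst (λ u → Conflict u _) (sym (queue′-old lt)) k
            ; unfound = unfound″
            ; found = found′ } }) ,
        smaller (≤-reflexive (+-∸-assoc 1 qh≤qt))
        where
        o≢0 : o ≢ 0
        o≢0 eq = 1+n≢0 (trans (sym o≡) eq)
        left-o : Left o
        left-o = proj₁ (relates (right matching) o≢0)
        mate-o : mate o ≡ e
        mate-o = inverse (right matching) o≢0
        queue′-qt : queue′ qt ≡ o
        queue′-qt = [≔]-same queue qt o {qt} refl
        queued″ : ∀ {i} → i < suc qt → Left (queue′ i)
        queued″ {i} i< with i ≟ qt
        ... | yes refl = subst Left (sym queue′-qt) left-o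
        ... | no ne = subst Left (sym ([≔]-other queue qt o ne)) (queued (≤∧≢⇒< (s≤s⁻¹ i<) ne))
        rooted″ : ∀ {i} → i < suc qt → Rooted mate q′ rank′ queue′ i
        rooted″ {i} i< with i ≟ qt
        ... | yes refl = inj₂ (subst (λ e′ → q′ e′ ≡ 0 × rank′ e′ < qt) (sym (trans (cong mate queue′-qt) mate-o))
                                (q′-e {e} refl , subst (_< qt) (sym ([≔]-same rank e qh {e} refl)) qh<qt))
        ... | no ne = subst (λ u → mate u ≡ 0 ⊎ (q′ (mate u) ≡ 0 × rank′ (mate u) < i)) (sym ([≔]-other queue qt o ne))
                        (rooted′ (rooted (≤∧≢⇒< (s≤s⁻¹ i<) ne)))
        unfound″ : f ≡ 0 → ∀ {i} → Right i → q′ i ≡ 0 → owner i ≢ 0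
        unfound″ f≡0 {i} r eq with i ≟ e
        ... | yes refl = o≢0
        ... | no ne = unfound f≡0 r (seen-before ne eq)
        -- Marking e makes only its owner o newly reached.
        reached-before : ∀ {v} → v ≢ o → Reached mate q′ f v → Reached mate q f v
        reached-before v≢o (f≡0 , inj₁ eq) = f≡0 , inj₁ eq
        reached-before {v} v≢o (f≡0 , inj₂ eq) with mate v ≟ e
        ... | yes mv≡e = ⊥-elim (v≢o (trans (sym (inverse (left matching) mv≢0)) (cong owner mv≡e)))
          where
          mv≢0 : mate v ≢ 0
          mv≢0 mv≡0 = <⇒≢ 1≤e (trans (sym mv≡0) mv≡e)
        ... | no ne = f≡0 , inj₂ (seen-before ne eq)
        pending″ : ∀ {v} → Left v → Reached mate q′ f v →
                   lev v ≡ 0 ⊎ ∃[ i ] (qh ≤ i × i < suc qt × queue′ i ≡ v)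
        pending″ {v} l act with v ≟ o
        ... | yes refl = inj₂ (qt , qh≤qt , ≤-refl , queue′-qt)
        ... | no v≢o with pending l (reached-before v≢o act)
        ...   | inj₁ eq = inj₁ eq
        ...   | inj₂ (i , le , lt , eq) = inj₂ (i , le , m≤n⇒m≤1+n lt , trans (queue′-old lt) eq)

    search-start : ∀ {s} → ResetAt N 1 s → reg s %e ≡ 0 → reg s %f ≡ 0 → InvAt s
    search-start {s} J e≡0 f≡0 = proj₁ J , record
      { scanned = reset-scan {s = s} J e≡0
      ; q≤D = λ e 1≤e e≤m → ≤-reflexive (reset-q {s = s} J e≡0 1≤e e≤m)
      ; qh≤qt = ≤-trans (≤-reflexive qh≡0) z≤n
      ; room = reset-room {s = s} J e≡0
      ; queued = λ lt → proj₁ (queued lt)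
      ; pending = pending′
      ; extra = record
          { size≡ = size≡
          ; rooted = λ lt → inj₁ (proj₂ (queued lt))
          ; seen = λ r eq → ⊥-elim (q≢0 r eq)
          ; unfound = λ _ r eq → ⊥-elim (q≢0 r eq)
          ; found = λ ne → ⊥-elim (ne f≡0) }
      }
      where
      open Reset (proj₂ J)
      q≢0 : ∀ {e} → Right e → arr s #q e ≢ 0
      q≢0 (1≤e , e≤m , _) eq with () ← trans (sym (reset-q {s = s} J e≡0 1≤e e≤m)) eq
      pending′ : ∀ {u} → Left u → Reached (arr s #mate) (arr s #q) (reg s %f) u →
                 level (arr s #cur) (arr s #r) u ≡ 0 ⊎ ∃[ i ] (reg s %qh ≤ i × i < reg s %qt × arr s #queue i ≡ u)
      pending′ {u} l (_ , act) with arr s #mate u ≟ 0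
      ... | yes free-u =
        let i , lt , eq = sources (subst (_< _) (sym e≡0) (proj₁ l)) l free-u
        in inj₂ (i , ≤-trans (≤-reflexive qh≡0) z≤n , lt , eq)
      ... | no ne with act
      ...   | inj₁ eq = ⊥-elim (ne eq)
      ...   | inj₂ eq = ⊥-elim (q≢0 (proj₁ (proj₂ (relates (left (Ready.matching (proj₁ J))) ne))) eq)

    -- König's cover: the matched left edges that were not reached and the marked right edges. A
    -- reached left edge ends with level 0, so all right edges in conflict with it are marked.
    -- Marked right edges are matched, since no free one was found, and each pair contributes
    -- exactly one.
    search-cover : ∀ {s} → InvAt s → reg s %qh ≡ reg s %qt → reg s %f ≡ 0 → Cover N
    search-cover {s} (R , I) done f≡0 = cov ,
      ≤-trans (strong-duality matching 1 cov tight-pair unmatched) (≤-reflexive (trans (*-identityˡ _) size≡)) ,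
      covers
      where
      open Ready R
      open Inv I
      open Forest extra
      mate q : ℕ → ℕ
      mate = arr s #mate
      q = arr s #q
      colour-cov : ℕ → ℕ → ℕ
      colour-cov 1 i = positive (mate i) * q (mate i)
      colour-cov _ i = 1 ∸ q i
      cov : ℕ → ℕ
      cov i = colour-cov (fld col i) i
      cov-left : ∀ {i} → Left i → cov i ≡ positive (mate i) * q (mate i)
      cov-left {i} (_ , _ , eq) = cong (λ k → colour-cov k i) eq
      cov-right : ∀ {i} → Right i → cov i ≡ 1 ∸ q i
      cov-right {i} (_ , _ , eq) = cong (λ k → colour-cov k i) eq
      tight-pair : ∀ {u} → mate u ≢ 0 → cov u + cov (mate u) ≤ 1
      tight-pair {u} ne =
        let k = relates (left matching) ne
            1≤e , e≤m , _ = proj₁ (proj₂ k)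
        in ≤-reflexive (trans (cong₂ _+_ (trans (cov-left (proj₁ k)) (trans (cong (_* q (mate u)) (positive-≢0 ne)) (*-identityˡ _)))
                                         (cov-right (proj₁ (proj₂ k))))
             (m+[n∸m]≡n (q≤D _ 1≤e e≤m)))
      unmatched : ∀ {i} → 1 ≤ i → i ≤ m → mate i ≡ 0 → arr s #owner i ≡ 0 → cov i ≡ 0
      unmatched {i} 1≤i i≤m free-u free-e with colours 1≤i i≤m
      ... | inj₁ eq = trans (cov-left (1≤i , i≤m , eq)) (cong (λ k → positive k * q (mate i)) free-u)
      ... | inj₂ eq = trans (cov-right (1≤i , i≤m , eq))
              (m≤n⇒m∸n≡0 (n≢0⇒n>0 (λ qi≡0 → unfound f≡0 (1≤i , i≤m , eq) qi≡0 free-e)))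
      covers : ∀ {u e} → Conflict u e → cov u ≢ 0 ⊎ cov e ≢ 0
      covers {u} {e} k with cov u ≟ 0
      ... | no ne = inj₁ ne
      ... | yes cov≡0 = inj₂ λ eq → 0≢1+n (trans (sym eq) (trans (cov-right (proj₁ (proj₂ k))) (cong (1 ∸_) qe≡0)))
        where
        reached : mate u ≡ 0 ⊎ q (mate u) ≡ 0
        reached with mate u ≟ 0
        ... | yes eq = inj₁ eq
        ... | no ne = inj₂ (trans (sym (trans (cov-left (proj₁ k)) (trans (cong (_* q (mate u)) (positive-≢0 ne)) (*-identityˡ _)))) cov≡0)
        lev≡0 : level (arr s #cur) (arr s #r) u ≡ 0
        lev≡0 with pending (proj₁ k) (f≡0 , reached)
        ... | inj₁ eq = eq
        ... | inj₂ (i , le , lt , _) = ⊥-elim (<⇒≱ lt (subst (_≤ i) done le))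
        qe≡0 : q e ≡ 0
        qe≡0 = n≤0⇒n≡0 (≤-trans (conflict≤level scanned k) (≤-reflexive lev≡0))

  -- Each step moves the free right edge one level up the search forest.
  record Augmenting (T c₀ : ℕ) (mate owner q rank queue : ℕ → ℕ) (e qt c : ℕ) : Set where
    field
      -- The free right edge e stands for the pair still to be gained.
      total : matched mate + positive e ≡ T
      c≡    : c ≡ c₀
      qt<H  : qt < H
      seen  : Discovered q rank queue qt
      fresh : e ≢ 0 → Fresh owner q e
      -- Only entries up to `rank e` are covered, since the mates of later ones may already have
      -- been exchanged.
      path  : e ≢ 0 → ∀ {i} → i ≤ rank e → Rooted mate q rank queue i

  AugmentingAt : (T c₀ : ℕ) → Store → Set
  AugmentingAt T c₀ s = ReadyAt s × Augmenting T c₀ (arr s #mate) (arr s #owner) (arr s #q) (arr s #rank)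
                                               (arr s #queue) (reg s %e) (reg s %qt) (reg s %c)

  -- The queue index of the parent falls strictly along the path; the successor separates parent
  -- index 0 from the end.
  remaining : Store → ℕ
  remaining s = positive (reg s %e) * suc (arr s #rank (reg s %e))

  augmentStep-wp : ∀ {T c₀ s v} → AugmentingAt T c₀ s → reg s %e ≡ suc v →
                   wp augmentStep (λ s′ → AugmentingAt T c₀ s′ × remaining s′ < remaining s) s
  augmentStep-wp {T} {c₀} {s} {v} (R , A) e≡ =
    e , refl , ≤m⇒≤H e≤m , rank e , refl ,
    rank e , refl , ≤-trans (<⇒≤ rank<qt) (<⇒≤ qt<H) , u , refl ,
    u , refl , ≤m⇒≤H u≤m , f , refl ,
    e , refl , ≤m⇒≤H e≤m , owner e , refl ,
    z≤n ,
    owner e , refl , ≤m⇒≤H (owner≤m matching e) , 0 , refl ,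
    f , refl , ≤m⇒≤H (mate≤m matching u) , 0 , refl ,
    u , refl , ≤m⇒≤H u≤m , e , refl ,
    e , refl , ≤m⇒≤H e≤m , u , refl ,
    f , refl ,
    (record { m-reg = m-reg ; lists = lists ; r-zero = r-zero ; matching = rematch matching conflict } , record
      { total = total′ ; c≡ = c≡ ; qt<H = qt<H ; seen = seen ; fresh = fresh′ ; path = path′ }) ,
    shorter
    where
    open Ready R
    open Augmenting A
    e u f : ℕ
    e = reg s %e
    mate owner q rank queue mate′ owner′ : ℕ → ℕ
    mate = arr s #mate
    owner = arr s #owner
    q = arr s #q
    rank = arr s #rank
    queue = arr s #queue
    u = queue (rank e)
    f = mate u
    mate′ = mate [ owner e ≔ 0 ] [ u ≔ e ]
    owner′ = owner [ f ≔ 0 ] [ e ≔ u ]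
    e≢0 : e ≢ 0
    e≢0 eq with () ← trans (sym e≡) eq
    right-e : Right e
    right-e = proj₁ (fresh e≢0)
    owner-e : owner e ≡ 0
    owner-e = proj₂ (proj₂ (fresh e≢0))
    rank<qt : rank e < reg s %qt
    rank<qt = proj₁ (seen right-e (proj₁ (proj₂ (fresh e≢0))))
    conflict : Conflict u e
    conflict = proj₂ (seen right-e (proj₁ (proj₂ (fresh e≢0))))
    e≤m : e ≤ m
    e≤m = proj₁ (proj₂ right-e)
    u≤m : u ≤ m
    u≤m = proj₁ (proj₂ (proj₁ conflict))
    mate′-u : mate′ u ≡ e
    mate′-u = [≔]-same (mate [ owner e ≔ 0 ]) u e {u} refl
    total′ : matched mate′ + positive f ≡ T
    total′ = trans (∑-differ m {λ v → positive (mate′ v)} {λ v → positive (mate v)} u (proj₁ (proj₁ conflict)) u≤m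
               (λ i 1≤i i≢u → cong positive (rematch-other mate i≢u (λ eq → <⇒≢ 1≤i (sym (trans eq owner-e))))))
               (trans (cong (λ k → matched mate + positive k) mate′-u) total)
    parent : f ≢ 0 → q f ≡ 0 × rank f < rank e
    parent ne with path e≢0 {rank e} ≤-refl
    ... | inj₁ eq = ⊥-elim (ne eq)
    ... | inj₂ h  = h
    fresh′ : f ≢ 0 → Fresh owner′ q f
    fresh′ ne = proj₁ (proj₂ (relates (left matching) ne)) , proj₁ (parent ne) ,
      trans ([≔]-other (owner [ f ≔ 0 ]) e u f≢e) ([≔]-same owner f 0 {f} refl)
      where
      f≢e : f ≢ e
      f≢e eq = coloured≢0 (proj₁ conflict) (trans (sym (inverse (left matching) ne)) (trans (cong owner eq) owner-e))
    path′ : f ≢ 0 → ∀ {i} → i ≤ rank f → Rooted mate′ q rank queue i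
    path′ ne {i} i≤ with queue i ≟ u | queue i ≟ owner e | path e≢0 {i} (≤-trans i≤ (<⇒≤ (proj₂ (parent ne))))
    ... | yes eq | _ | inj₁ eq′ = ⊥-elim (ne (trans (cong mate (sym eq)) eq′))
    -- The edge u cannot stand at a position i up to `rank f`: its mate f would have rank below i.
    ... | yes eq | _ | inj₂ (_ , lt) = ⊥-elim (<⇒≱ (subst (λ v → rank (mate v) < i) eq lt) i≤)
    ... | no i≢u | yes i≡o | _ = inj₁ (trans ([≔]-other (mate [ owner e ≔ 0 ]) u e i≢u) ([≔]-same mate (owner e) 0 i≡o))
    ... | no i≢u | no i≢o | old =
      subst (λ k → k ≡ 0 ⊎ (q k ≡ 0 × rank k < i)) (sym (rematch-other mate i≢u i≢o)) old
    shorter : positive f * suc (rank f) < positive e * suc (rank e)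
    shorter = subst (positive f * suc (rank f) <_) (sym (trans (cong (_* suc (rank e)) (positive-≢0 e≢0)) (*-identityˡ _))) bound
      where
      bound : positive f * suc (rank f) < suc (rank e)
      bound with f ≟ 0
      ... | yes eq = subst (λ k → positive k * suc (rank f) < suc (rank e)) (sym eq) (s≤s z≤n)
      ... | no ne  = ≤-trans (s≤s (≤-reflexive (trans (cong (_* suc (rank f)) (positive-≢0 ne)) (*-identityˡ _))))
                             (s≤s (proj₂ (parent ne)))

  -- Rounds of improvement and the final count

  MatchedAt : ℕ → Store → Set
  MatchedAt N s = ReadyAt s × matched (arr s #mate) ≡ N

  module _ (N : ℕ) where

    open Search N

    Augmented : ℕ → Store → Set
    Augmented f₀ s = MatchedAt (N + positive f₀) s × reg s %c ≡ f₀

    augment-tri : ∀ {s} → InvAt s → reg s %c ≡ reg s %f → Tri augment (augmentTime m) (Augmented (reg s %f)) s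
    augment-tri {s} (R , I) c≡f =
      Tri-seq (Tri-wp (mov %e %f) {λ s′ → AugmentingAt (N + positive f) f s′ × remaining s′ ≤ m + m * 1}
        (f , refl , (R , record
          { total = cong (_+ positive f) size≡ ; c≡ = c≡f ; qt<H = ≤-<-trans (qt≤K I) (entries<H (s≤s z≤n))
          ; seen = seen ; fresh = found
          ; path = λ ne i≤ → rooted (≤-<-trans i≤ (rank<qt ne)) }) , short)) λ (A , bound) →
      Tri-post (λ {s′} → finish {s′})
        (Tri-while (cost augmentStep) (AugmentingAt (N + positive f) f) remaining
          (λ {s′} A e≡ → Tri-wp augmentStep (augmentStep-wp {s = s′} A e≡)) A bound)
      where
      open Inv I
      open Forest extra
      f : ℕ
      f = reg s %f
      rank<qt : f ≢ 0 → arr s #rank f < reg s %qt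
      rank<qt ne = let r , z , _ = found ne in proj₁ (seen r z)
      short : positive f * suc (arr s #rank f) ≤ m + m * 1
      short with f ≟ 0
      ... | yes eq = subst (λ k → positive k * suc (arr s #rank f) ≤ m + m * 1) (sym eq) z≤n
      ... | no ne  = ≤-trans (≤-reflexive (trans (cong (_* suc (arr s #rank f)) (positive-≢0 ne)) (*-identityˡ _)))
                             (≤-trans (rank<qt ne) (qt≤K I))
      finish : ∀ {s′} → AugmentingAt (N + positive f) f s′ × reg s′ %e ≡ 0 → Augmented f s′
      finish {s′} ((R , A) , e≡0) =
        (R , trans (sym (+-identityʳ _)) (trans (cong (λ e → matched (arr s′ #mate) + positive e) (sym e≡0)) (Augmenting.total A))) ,
        Augmenting.c≡ A

    improve-tri : ∀ {s} → MatchedAt N s →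
                  Tri improve (improveTime m) (λ s′ → ∃[ f ] (Augmented f s′ × (f ≡ 0 → Cover N))) s
    improve-tri {s} (R , N≡) =
      Tri-seq (Tri-wp (lit %D 1) {λ s → MatchedAt N s × reg s %D ≡ 1} (1≤H , (R , N≡) , refl)) λ ((R , N≡) , D≡) →
      Tri-seq (reset-tri 1≤H R D≡ N≡) λ {s₂} (J , e≡0) →
      Tri-seq (Tri-wp (lit %f 0) {λ s → InvAt s × Φ s ≤ m * 4 + m}
        (z≤n , search-start {setv %f 0 s₂} J e≡0 refl , reset-potential {s = s₂} J e≡0)) λ {s₃} (I , Φ≤) →
      Tri-seq (scan-tri forest-mono search (λ {s} → search-wp {s}) {s₃} I Φ≤) λ {s₄} (I , done) →
      Tri-seq (Tri-wp (mov %c %f) {λ s → (InvAt s × reg s %c ≡ reg s %f) × (reg s %f ≡ 0 → Cover N)}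
        (reg s₄ %f , refl , (I , refl) , search-cover {s₄} I done)) λ {s₅} ((I , c≡) , cover) →
      Tri-post (λ A → _ , A , cover) (augment-tri {s₅} I c≡)

  module Improvement (B : ℕ) (bounded : ∀ {mate owner} → Matching mate owner → matched mate ≤ B) where

    ImprovedAt : Store → Set
    ImprovedAt s = ReadyAt s × (reg s %c ≡ 0 → Cover (matched (arr s #mate)))

    -- The flag term pays for the one search that fails and leaves the matching as it is; hence D +
    -- 1 rounds for a deficit of D.
    deficit : Store → ℕ
    deficit s = (B ∸ matched (arr s #mate)) + positive (reg s %c)

    improve-step : ∀ {s v} → ImprovedAt s → reg s %c ≡ suc v →
                   Tri improve (improveTime m) (λ s′ → ImprovedAt s′ × deficit s′ < deficit s) s
    improve-step {s} {v} (R , _) c≡ = Tri-post (λ {s′} → finish {s′}) (improve-tri N (R , refl))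
      where
      N : ℕ
      N = matched (arr s #mate)
      finish : ∀ {s′} → ∃[ f ] (Augmented N f s′ × (f ≡ 0 → Cover N)) → ImprovedAt s′ × deficit s′ < deficit s
      finish {s′} (f , ((R′ , N′≡) , c′≡) , cover) = (R′ , cover′) , decrease f N′≡ c′≡
        where
        N′ : ℕ
        N′ = matched (arr s′ #mate)
        cover′ : reg s′ %c ≡ 0 → Cover N′
        cover′ c′≡0 = subst Cover (sym (trans N′≡ (trans (cong (λ k → N + positive k) f≡0) (+-identityʳ N)))) (cover f≡0)
          where
          f≡0 : f ≡ 0
          f≡0 = trans (sym c′≡) c′≡0
        decrease : ∀ f → N′ ≡ N + positive f → reg s′ %c ≡ f → (B ∸ N′) + positive (reg s′ %c) < (B ∸ N) + positive (reg s %c)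
        decrease zero N′≡ c′≡ = subst₂ _<_ (cong₂ (λ k c → (B ∸ k) + positive c) (sym (trans N′≡ (+-identityʳ N))) (sym c′≡))
                                  (cong (λ c → (B ∸ N) + positive c) (sym c≡)) (+-monoʳ-< (B ∸ N) (s≤s z≤n))
        decrease (suc f) N′≡ c′≡ = subst₂ _<_ (cong (λ c → (B ∸ N′) + positive c) (sym c′≡))
                                  (cong (λ c → (B ∸ N) + positive c) (sym c≡))
                                  (+-monoˡ-< 1 (∸-monoʳ-< {B} (≤-reflexive (trans (+-comm 1 N) (sym N′≡))) (bounded (Ready.matching R′))))

    improvement-tri : ∀ {s n} → ReadyAt s → reg s %c ≡ 1 → B ∸ matched (arr s #mate) ≤ n →
                      Tri (while %c improve) (3 + suc n * suc (improveTime m))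
                        (λ s → ReadyAt s × Cover (matched (arr s #mate))) s
    improvement-tri {s} {n} R c≡ ≤n =
      Tri-post (λ ((R , cover) , c≡0) → R , cover c≡0)
        (Tri-while (improveTime m) ImprovedAt deficit (λ {s} I c≡ → improve-step {s} I c≡)
          (R , λ c≡0 → ⊥-elim (1+n≢0 (trans (sym c≡) c≡0)))
          (≤-trans (+-mono-≤ ≤n (positive≤1 _)) (≤-reflexive (+-comm n 1))))

  Solved : Store → Set
  Solved s = ∃[ mate ] ∃[ owner ] (Matching mate owner × Cover (matched mate) × reg s %n ≡ matched mate ∸ fld col 0)

  record Counting (N : ℕ) (mate : ℕ → ℕ) (e n : ℕ) : Set where
    field
      size≡ : matched mate ≡ N
      e≤m   : e ≤ m
      n-sum : n + ∑ e (λ i → positive (mate i)) ≡ N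

  CountingAt : ℕ → Store → Set
  CountingAt N s = ReadyAt s × Counting N (arr s #mate) (reg s %e) (reg s %n)

  countStep-wp : ∀ {N s v} → CountingAt N s → reg s %e ≡ suc v →
                 wp countStep (λ s′ → CountingAt N s′ × reg s′ %e < reg s %e) s
  countStep-wp {N} {s} {v} (R , C) e≡ =
    suc v , e≡ , ≤m⇒≤H v<m , o , refl ,
    (λ o≡ → n , refl , ≤-trans (one-more o≡) (≤-trans N≤m m≤H) ,
            v , cong pred e≡ , (R , record { size≡ = size≡ ; e≤m = <⇒≤ v<m ; n-sum = counted o≡ }) , lt) ,
    (λ o≡ → v , cong pred e≡ , (R , record { size≡ = size≡ ; e≤m = <⇒≤ v<m ; n-sum = trans (cong (λ k → n + (positive k + rest)) (sym o≡)) n-sum′ }) , lt)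
    where
    open Counting C
    n o rest : ℕ
    n = reg s %n
    o = arr s #mate (suc v)
    rest = ∑ v (λ i → positive (arr s #mate i))
    v<m : suc v ≤ m
    v<m = subst (_≤ m) e≡ e≤m
    lt : v < reg s %e
    lt = ≤-reflexive (sym e≡)
    n-sum′ : n + (positive o + rest) ≡ N
    n-sum′ = trans (cong (λ e → n + ∑ e (λ i → positive (arr s #mate i))) (sym e≡)) n-sum
    N≤m : N ≤ m
    N≤m = subst (_≤ m) size≡ (≤-trans (∑-≤-* m 1 λ i _ _ → positive≤1 _) (≤-reflexive (*-identityʳ m)))
    counted : ∀ {w} → o ≡ suc w → suc n + rest ≡ N
    counted o≡ = trans (sym (+-suc n rest)) (trans (cong (λ k → n + (positive k + rest)) (sym o≡)) n-sum′)
    one-more : ∀ {w} → o ≡ suc w → suc n ≤ N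
    one-more o≡ = subst (suc n ≤_) (counted o≡) (m≤m+n (suc n) rest)

  count-tri : ∀ {N s} → MatchedAt N s →
              Tri count (3 + (3 + m * suc (cost countStep))) (λ s → MatchedAt N s × reg s %n ≡ N) s
  count-tri {N} {s} (R , N≡) =
    Tri-seq (Tri-wp (lit %n 0 ⨟ mov %e %m) {λ s → CountingAt N s × reg s %e ≤ m}
      (z≤n , m , Ready.m-reg R , (R , record { size≡ = N≡ ; e≤m = ≤-refl ; n-sum = N≡ }) , ≤-refl)) λ (C , e≤m) →
    Tri-post (λ {s} → finish {s}) (Tri-while (cost countStep) (CountingAt N) (λ s → reg s %e)
      (λ {s} C e≡ → Tri-wp countStep (countStep-wp {s = s} C e≡)) C e≤m)
    where
    finish : ∀ {s} → CountingAt N s × reg s %e ≡ 0 → MatchedAt N s × reg s %n ≡ N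
    finish {s} ((R , C) , e≡0) = (R , size≡) ,
      trans (sym (+-identityʳ _)) (trans (cong (λ e → reg s %n + ∑ e (λ i → positive (arr s #mate i))) (sym e≡0)) n-sum)
      where open Counting C

  main-tri : ∀ {D s} → Root m D → m ≤ D * D → Initial s → Tri main (mainTime m D) Solved s
  main-tri {D} {s} root m≤D² zeros =
    Tri-seq (build-tri {s} zeros) λ R →
    Tri-seq (squareRoot-tri root m≤D² R) λ (R , D≡) →
    Tri-seq (reset-tri (≤-trans (root-≤ root) (≤-trans (s≤s (m≤m+n m m)) m+m<H)) R D≡ refl) λ {s₂} (J , e≡0) →
    Tri-seq (scan-tri prices-mono auction (λ {s} → auction-wp {s}) {s₂} (auction-start {s = s₂} J e≡0)
               (reset-potential {s = s₂} J e≡0)) λ {s₃} (I , done) →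
    Tri-seq (Tri-wp (lit %c 1) {λ s → MatchedAt (matched (arr s₃ #mate)) s × reg s %c ≡ 1}
      (1≤H , (proj₁ I , refl) , refl)) λ {s₄} ((R , N≡) , c≡) →
    Tri-seq (Improvement.improvement-tri (matched (arr s₃ #mate) + D) (auction-bound {s₃} I done) {n = D} R c≡
               (≤-reflexive (trans (cong (matched (arr s₃ #mate) + D ∸_) N≡) (m+n∸m≡n (matched (arr s₃ #mate)) D))))
      λ {s₅} (R , cover) →
    Tri-seq (count-tri (R , refl)) λ {s₆} ((R , N≡) , n≡) →
    Tri-wp (lit %z 0 ⨟ inp %o col %z ⨟ minus %n %n %o)
      (z≤n , 0 , refl , z≤n , reg s₆ %n ∸ fld col 0 , refl ,
       arr s₆ #mate , arr s₆ #owner , Ready.matching R , subst Cover (sym N≡) cover ,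
       cong (_∸ fld col 0) (trans n≡ (sym N≡)))
    where
    open Auction D (root-≤ root)
    open AuctionResult D root m≤D²

-- The time bound

-- With the factor k as an index, the constant is assembled along the shape of t instead of being
-- guessed.
record Bounded (X k t : ℕ) : Set where
  constructor bounded
  field bound : t ≤ k * X
open Bounded

infixr 5 _⊞_
_⊞_ : ∀ {X k₁ k₂ t₁ t₂} → Bounded X k₁ t₁ → Bounded X k₂ t₂ → Bounded X (k₁ + k₂) (t₁ + t₂)
_⊞_ {X} {k₁} {k₂} (bounded p) (bounded q) =
  bounded (≤-trans (+-mono-≤ p q) (≤-reflexive (sym (*-distribʳ-+ X k₁ k₂))))

bounded-const : ∀ {X} k → Bounded (suc X) k k
bounded-const {X} k = bounded (m≤m*n k (suc X))

bounded-* : ∀ {X k t} a → Bounded X k t → Bounded X (a * k) (t * a)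
bounded-* {X} {k} {t} a (bounded p) =
  bounded (≤-trans (≤-reflexive (*-comm t a)) (≤-trans (*-monoʳ-≤ a p) (≤-reflexive (sym (*-assoc a k X)))))

bounded-1 : ∀ {X t} → t ≤ X → Bounded X 1 t
bounded-1 {X} p = bounded (≤-trans p (≤-reflexive (sym (*-identityˡ X))))

-- The costs of the loop bodies enter as parameters: the argument uses only that they are constants.
module TimeBound (b σ r a s g c : ℕ) where

  perImprovement factor : ℕ
  perImprovement = 1 + ((4 + (3 + r * 1)) + (1 + ((1 + (3 + s * (4 + 1))) + (2 + (2 + (3 + g * (1 + 1)))))))
  factor =
    (1 + (5 + (2 + (3 + b * 1)))) + ((3 + (3 + σ * 1)) + ((4 + (3 + r * 1)) +
    ((1 + (3 + a * (4 + 1))) + (1 + ((3 + (1 + perImprovement) * 4) + ((3 + (3 + c * 1)) + (1 + (5 + 1))))))))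

  total : ∀ {m D} → 1 ≤ D → D ≤ suc m → Bounded (suc (m * D)) factor
    ((1 + (5 + (2 + (3 + m * b)))) +
    ((3 + (3 + m * σ)) + ((4 + (3 + m * r)) + ((1 + (3 + (m * (4 * D) + m) * a)) +
    (1 + ((3 + suc D * suc (1 + ((4 + (3 + m * r)) + (1 + ((1 + (3 + (m * 4 + m) * s)) + (2 + (2 + (3 + (m + m * 1) * g)))))))) +
    ((3 + (3 + m * c)) + (1 + (5 + 1)))))))))
  total {m} {D} 1≤D D≤ =
    (↑ 1 ⊞ (↑ 5 ⊞ (↑ 2 ⊞ (↑ 3 ⊞ m* b)))) ⊞
    ((↑ 3 ⊞ (↑ 3 ⊞ m* σ)) ⊞ ((↑ 4 ⊞ (↑ 3 ⊞ m* r)) ⊞ ((↑ 1 ⊞ (↑ 3 ⊞ bounded-* a (m4D ⊞ bounded-1 m≤X))) ⊞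
    (↑ 1 ⊞ ((↑ 3 ⊞ loop) ⊞ ((↑ 3 ⊞ (↑ 3 ⊞ m* c)) ⊞ (↑ 1 ⊞ (↑ 5 ⊞ ↑ 1))))))))
    where
    X Y : ℕ
    X = suc (m * D)
    Y = suc m
    ↑ : ∀ {Z} k → Bounded (suc Z) k k
    ↑ = bounded-const
    m≤mD : m ≤ m * D
    m≤mD = m≤m*n m D {{>-nonZero 1≤D}}
    m≤X : m ≤ X
    m≤X = ≤-trans m≤mD (n≤1+n _)
    m* : ∀ k → Bounded X (k * 1) (m * k)
    m* k = bounded-* k (bounded-1 m≤X)
    m4D : Bounded X 4 (m * (4 * D))
    m4D = bounded (≤-trans (≤-reflexive (trans (sym (*-assoc m 4 D)) (trans (cong (_* D) (*-comm m 4)) (*-assoc 4 m D)))) (*-monoʳ-≤ 4 (n≤1+n _)))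
    m≤Y : Bounded Y 1 m
    m≤Y = bounded-1 (n≤1+n m)
    m4 : Bounded Y 4 (m * 4)
    m4 = bounded (≤-trans (≤-reflexive (*-comm m 4)) (*-monoʳ-≤ 4 (n≤1+n m)))
    m1 : Bounded Y 1 (m * 1)
    m1 = bounded-1 (≤-trans (≤-reflexive (*-identityʳ m)) (n≤1+n m))
    improvement : Bounded Y perImprovement
      (1 + ((4 + (3 + m * r)) + (1 + ((1 + (3 + (m * 4 + m) * s)) + (2 + (2 + (3 + (m + m * 1) * g)))))))
    improvement =
      ↑ 1 ⊞ ((↑ 4 ⊞ (↑ 3 ⊞ bounded-* r m≤Y)) ⊞ (↑ 1 ⊞ ((↑ 1 ⊞ (↑ 3 ⊞ bounded-* s (m4 ⊞ m≤Y))) ⊞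
        (↑ 2 ⊞ (↑ 2 ⊞ (↑ 3 ⊞ bounded-* g (m≤Y ⊞ m1)))))))
    -- D + 1 rounds of order m + 1 stay within O(mD + 1); `D ≤ suc m` absorbs the lone term D.
    square : suc D * Y ≤ 4 * X
    square = begin
      suc m + D * suc m          ≡⟨ cong (suc m +_) (*-suc D m) ⟩
      suc m + (D + D * m)        ≤⟨ +-mono-≤ {suc m} {X} (s≤s m≤mD) (+-mono-≤ {D} {X} (≤-trans D≤ (s≤s m≤mD)) (≤-trans (≤-reflexive (*-comm D m)) (n≤1+n _))) ⟩
      X + (X + X)                ≤⟨ +-monoʳ-≤ X (+-monoʳ-≤ X (m≤m+n X _)) ⟩
      4 * X                      ∎
      where open ≤-Reasoning
    scale : ∀ {t k} → Bounded Y k t → Bounded X (k * 4) (suc D * t)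
    scale {t} {k} (bounded p) = bounded (begin
      suc D * t         ≤⟨ *-monoʳ-≤ (suc D) p ⟩
      suc D * (k * Y)   ≡⟨ sym (*-assoc (suc D) k Y) ⟩
      suc D * k * Y     ≡⟨ cong (_* Y) (*-comm (suc D) k) ⟩
      k * suc D * Y     ≡⟨ *-assoc k (suc D) Y ⟩
      k * (suc D * Y)   ≤⟨ *-monoʳ-≤ k square ⟩
      k * (4 * X)       ≡⟨ sym (*-assoc k 4 X) ⟩
      k * 4 * X         ∎)
      where open ≤-Reasoning
    loop : Bounded X ((1 + perImprovement) * 4)
      (suc D * suc (1 + ((4 + (3 + m * r)) + (1 + ((1 + (3 + (m * 4 + m) * s)) + (2 + (2 + (3 + (m + m * 1) * g))))))))
    loop = scale (↑ 1 ⊞ improvement)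

mainFactor : ℕ
mainFactor = TimeBound.factor (suc (cost buildStep)) (suc (cost sqrtStep)) (suc (cost resetStep))
  (suc (cost (scanStep auction))) (suc (cost (scanStep search))) (suc (cost augmentStep)) (suc (cost countStep))

mainTime-bounded : ∀ {m D} → 1 ≤ D → D ≤ suc m → Bounded (suc (m * D)) mainFactor (mainTime m D)
mainTime-bounded = TimeBound.total (suc (cost buildStep)) (suc (cost sqrtStep)) (suc (cost resetStep))
  (suc (cost (scanStep auction))) (suc (cost (scanStep search))) (suc (cost augmentStep)) (suc (cost countStep))

-- For D ≥ 2, D ≤ 2(D - 1), while (D - 1)² < m; for D = 1, m ≥ 1 suffices.
root-square : ∀ {m D} → 1 ≤ m → Root m D → D * D ≤ 4 * m
root-square {m} {D} 1≤m R with Root.tight R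
... | inj₁ refl = ≤-trans 1≤m (m≤n*m m 4)
root-square {m} {suc zero}    1≤m R | inj₂ _  = ≤-trans 1≤m (m≤n*m m 4)
root-square {m} {suc (suc D)} 1≤m R | inj₂ lt = begin
  (2 + D) * (2 + D)                   ≤⟨ *-mono-≤ double double ⟩
  2 * suc D * (2 * suc D)             ≡⟨ [m*n]*[o*p]≡[m*o]*[n*p] 2 (suc D) 2 (suc D) ⟩
  4 * (suc D * suc D)                 ≤⟨ *-monoʳ-≤ 4 (<⇒≤ lt) ⟩
  4 * m                               ∎
  where
  open ≤-Reasoning
  double : 2 + D ≤ 2 * suc D
  double = s≤s (≤-trans (s≤s (m≤m+n D 0)) (m≤n+m (suc (D + 0)) D))
root-square {m} {zero} 1≤m R | inj₂ _ = z≤n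

-- For m ≥ 1, mD + 1 ≤ 2mD, and D² ≤ 4m contributes another 4 to the square, so (2k)² · 4 = (4k)²
-- gives the constant. An edge forces n ≥ 2, hence log₂ n ≥ 1. For m = 0 the maximum with 1 applies.
within : ∀ k {n m D T} → Root m D → (1 ≤ m → 2 ≤ n) → T ≤ k * suc (m * D) → WithinTime (4 * k) n m T
within k {n} {zero} {D} {T} R _ T≤ = begin
  T ^ 2                  ≤⟨ ^-monoˡ-≤ 2 T≤4k ⟩
  (4 * k) ^ 2            ≡⟨ sym (*-identityʳ ((4 * k) ^ 2)) ⟩
  (4 * k) ^ 2 * 1        ∎
  where
  open ≤-Reasoning
  T≤4k : T ≤ 4 * k
  T≤4k = ≤-trans T≤ (≤-trans (≤-reflexive (*-identityʳ k)) (m≤n*m k 4))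
within k {n} {m@(suc _)} {D} {T} R 2≤n T≤ = begin
  T ^ 2                              ≡⟨ cong (T *_) (*-identityʳ T) ⟩
  T * T                              ≤⟨ *-mono-≤ T≤2kmD T≤2kmD ⟩
  2 * k * (m * D) * (2 * k * (m * D)) ≡⟨ [m*n]*[o*p]≡[m*o]*[n*p] (2 * k) (m * D) (2 * k) (m * D) ⟩
  2 * k * (2 * k) * (m * D * (m * D)) ≡⟨ cong (2 * k * (2 * k) *_) ([m*n]*[o*p]≡[m*o]*[n*p] m D m D) ⟩
  2 * k * (2 * k) * (m * m * (D * D)) ≤⟨ *-monoʳ-≤ (2 * k * (2 * k)) (*-monoʳ-≤ (m * m) (root-square (s≤s z≤n) R)) ⟩
  2 * k * (2 * k) * (m * m * (4 * m)) ≡⟨ cong (2 * k * (2 * k) *_) (trans (sym (*-assoc (m * m) 4 m)) (trans (cong (_* m) (*-comm (m * m) 4)) (*-assoc 4 (m * m) m))) ⟩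
  2 * k * (2 * k) * (4 * (m * m * m)) ≡⟨ sym (*-assoc (2 * k * (2 * k)) 4 (m * m * m)) ⟩
  2 * k * (2 * k) * 4 * (m * m * m)   ≡⟨ cong₂ _*_ coefficient cube ⟩
  (4 * k) ^ 2 * m ^ 3                 ≤⟨ *-monoʳ-≤ ((4 * k) ^ 2) (≤-trans (m≤m*n (m ^ 3) (⌊log₂ n ⌋ ^ 2) {{>-nonZero 1≤log²}}) (m≤n⊔m 1 _)) ⟩
  (4 * k) ^ 2 * (1 ⊔ m ^ 3 * ⌊log₂ n ⌋ ^ 2) ∎
  where
  open ≤-Reasoning
  T≤2kmD : T ≤ 2 * k * (m * D)
  T≤2kmD = begin
    T                        ≤⟨ T≤ ⟩
    k * suc (m * D)          ≤⟨ *-monoʳ-≤ k (s≤s (m≤m+n (m * D) 0)) ⟩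
    k * (1 + (m * D + 0))    ≤⟨ *-monoʳ-≤ k (+-monoˡ-≤ (m * D + 0) (*-mono-≤ {1} {m} (s≤s z≤n) (Root.1≤D R))) ⟩
    k * (2 * (m * D))        ≡⟨ sym (*-assoc k 2 (m * D)) ⟩
    k * 2 * (m * D)          ≡⟨ cong (_* (m * D)) (*-comm k 2) ⟩
    2 * k * (m * D)          ∎
  coefficient : 2 * k * (2 * k) * 4 ≡ (4 * k) ^ 2
  coefficient = trans (cong (_* 4) ([m*n]*[o*p]≡[m*o]*[n*p] 2 k 2 k))
    (trans (*-comm (4 * (k * k)) 4) (trans (sym (*-assoc 4 4 (k * k)))
    (trans (sym ([m*n]*[o*p]≡[m*o]*[n*p] 4 k 4 k)) (cong (4 * k *_) (sym (*-identityʳ (4 * k)))))))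
  cube : m * m * m ≡ m ^ 3
  cube = trans (*-assoc m m m) (cong (λ x → m * (m * x)) (sym (*-identityʳ m)))
  1≤log² : 1 ≤ ⌊log₂ n ⌋ ^ 2
  1≤log² = *-mono-≤ 1≤log (*-mono-≤ 1≤log (≤-refl {1}))
    where
    1≤log : 1 ≤ ⌊log₂ n ⌋
    1≤log = ⌊log₂⌋-mono-≤ {2} (2≤n (s≤s z≤n))

-- Loading the input and reading off the answer

cell : List ℕ → ℕ → ℕ
cell xs a = fromMaybe 0 (List.head (List.drop a xs))

-- Cell 1 holds m, and the three words per edge start at cell 3.
prologue : Program
prologue = const 0 1 ∷ load 2 0 ∷ add 1 2 2 ∷ add 1 1 2 ∷ const 0 3 ∷ add 1 1 0 ∷ []

epilogue : Label → Program
epilogue ℓ = jpos (ρ %n) (2 + ℓ) ∷ halt true ∷ halt false ∷ []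

assemble : Cmd → Program
assemble c = prologue ++ (comp c 6 ++ epilogue (size c + 6))

module _ (w H m : ℕ) (xs : List ℕ) (fits : 16 * H + (20 + 3 * m) < 2 ^ w)
         (cell-m : cell xs 1 ≡ m) (end : ∀ a → 3 + 3 * m ≤ a → cell xs a ≡ 0) where

  open Semantics w H m (λ F i → cell xs (3 * i + codeF F)) fits

  blankStore : Store
  blankStore = mkStore (λ _ → 0) (λ _ _ → 0)

  -- The 8 is the six instructions of the prologue, the final jump and `halt`. Fuel that the command
  -- does not use up remains as `slack` at `halt`.
  assemble-decides : ∀ {c t Q} → Tri c t Q blankStore →
                     ∃[ s ] (Q s × run (assemble c) w (8 + t) (initial xs) ≡ just (reg s %n ≡ᵇ 0))
  assemble-decides {c} {t} {Q} h = O.s′ , O.post , answer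
    where
    P : Program
    P = assemble c
    at : At P 0 P
    at = At-self [] P
    ats₁ = At-++ P 0 prologue at
    ats₂ = At-++ P 6 (comp c 6) (proj₂ ats₁)
    below : ∀ {v} → v ≤ 3 + 3 * m → v < 2 ^ w
    below v≤ = ≤-<-trans (≤-trans v≤ (≤-trans (+-monoˡ-≤ (3 * m) (≤ᵇ⇒≤ 3 20 tt)) (m≤n+m (20 + 3 * m) (16 * H)))) fits
    start : ∃[ r ] (initial xs ↝[ P , 6 ] ⟨ 6 , r , cell xs ⟩ × Rep r (cell xs) blankStore)
    start with proj₁ ats₁
    ... | a₁ , a₂ , a₃ , a₄ , a₅ , a₆ , _ =
      _ ,
      (step-const a₁ (20<2^w (s≤s z≤n)) ⨾
       step-load a₂ cell-m ⨾
       step-add a₃ refl (below (≤-trans (+-monoʳ-≤ m (m≤m+n m _)) (m≤n+m (3 * m) 3))) ⨾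
       step-add a₄ (trans (+-assoc m m m) (cong (λ k → m + (m + k)) (sym (+-identityʳ m)))) (below (m≤n+m (3 * m) 3)) ⨾
       step-const a₅ (20<2^w (≤ᵇ⇒≤ 3 20 tt)) ⨾
       step-add a₆ (+-comm (3 * m) 3) (below ≤-refl)) ,
      mkRep (λ x → refl) refl
        (λ A i → end (addr A i) (≤-trans (m≤n+m base (16 * i)) (m≤m+n _ (codeA A))))
        (λ F i _ → refl)
    module O = Outcome (apply h (proj₁ ats₂) (proj₂ (proj₂ start)))
    ℓ : Label
    ℓ = size c + 6
    at₃ : At P ℓ (epilogue ℓ)
    at₃ = subst (λ k → At P (k + 6) (epilogue ℓ)) (length-comp c 6) (proj₂ ats₂)
    slack : ℕ
    slack = t ∸ O.time
    halting : ∀ v → reg O.s′ %n ≡ v → run P w (2 + slack) ⟨ ℓ , O.r′ , O.μ′ ⟩ ≡ just (v ≡ᵇ 0)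
    halting zero    eq = trans (run≡ (step-stay {P} {ℓ} {O.r′} {O.μ′} (proj₁ at₃) (trans (Rep.vars O.rep %n) eq)) (suc slack)) (step {P} {1 + ℓ} {O.r′} {O.μ′} (proj₁ (proj₂ at₃)) slack)
    halting (suc v) eq = trans (run≡ (step-jump {P} {ℓ} {O.r′} {O.μ′} (proj₁ at₃) (trans (Rep.vars O.rep %n) eq)) (suc slack)) (step {P} {2 + ℓ} {O.r′} {O.μ′} (proj₁ (proj₂ (proj₂ at₃))) slack)
    fuel : 8 + t ≡ 6 + (O.time + (2 + slack))
    fuel = cong (6 +_) (trans (cong (2 +_) (sym (m+[n∸m]≡n O.time≤)))
             (trans (cong suc (sym (+-suc O.time slack))) (sym (+-suc O.time (suc slack)))))
    answer : run P w (8 + t) (initial xs) ≡ just (reg O.s′ %n ≡ᵇ 0)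
    answer = trans (cong (λ f → run P w f (initial xs)) fuel)
      (trans (run≡ (proj₁ (proj₂ start)) (O.time + (2 + slack)))
      (trans (run≡ O.steps (2 + slack)) (halting _ refl)))

-- The input graph

-- The function producing the rows is local to `encode`; it enters as an arbitrary `g` with its
-- defining equation.
cell-row : ∀ {m} (g : Fin m → List ℕ) (x y z : Fin m → ℕ) → (∀ i → g i ≡ x i ∷ y i ∷ z i ∷ []) →
           ∀ i F → cell (List.concat (List.tabulate g)) (3 * toℕ i + codeF F) ≡ cell (x i ∷ y i ∷ z i ∷ []) (codeF F)
cell-row {suc m} g x y z eq fzero F rewrite eq fzero with F
... | end₁ = refl
... | end₂ = refl
... | col  = refl
cell-row {suc m} g x y z eq (fsuc i) F rewrite eq fzero =
  trans (cong (λ k → cell (x fzero ∷ y fzero ∷ z fzero ∷ List.concat (List.tabulate (λ i → g (fsuc i)))) (k + codeF F)) (*-suc 3 (toℕ i)))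
        (cell-row (λ i → g (fsuc i)) (λ i → x (fsuc i)) (λ i → y (fsuc i)) (λ i → z (fsuc i)) (λ i → eq (fsuc i)) i F)

cell-beyond : ∀ {m} (g : Fin m → List ℕ) (x y z : Fin m → ℕ) → (∀ i → g i ≡ x i ∷ y i ∷ z i ∷ []) →
              ∀ a → 3 * m ≤ a → cell (List.concat (List.tabulate g)) a ≡ 0
cell-beyond {zero}  g x y z eq zero    _ = refl
cell-beyond {zero}  g x y z eq (suc a) _ = refl
cell-beyond {suc m} g x y z eq a le rewrite eq fzero = go a (subst (_≤ a) (*-suc 3 m) le)
  where
  go : ∀ a → 3 + 3 * m ≤ a → cell (x fzero ∷ y fzero ∷ z fzero ∷ List.concat (List.tabulate (λ i → g (fsuc i)))) a ≡ 0
  go (suc (suc (suc a))) (s≤s (s≤s (s≤s le))) =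
    cell-beyond (λ i → g (fsuc i)) (λ i → x (fsuc i)) (λ i → y (fsuc i)) (λ i → z (fsuc i)) (λ i → eq (fsuc i)) a le

∑-shift : ∀ m f → ∑ (suc m) f ≡ f 1 + ∑ m (λ i → f (suc i))
∑-shift zero    f = refl
∑-shift (suc m) f = begin
  f (2 + m) + ∑ (suc m) f                       ≡⟨ cong (f (2 + m) +_) (∑-shift m f) ⟩
  f (2 + m) + (f 1 + ∑ m (λ i → f (suc i)))     ≡⟨ sym (+-assoc (f (2 + m)) (f 1) _) ⟩
  f (2 + m) + f 1 + ∑ m (λ i → f (suc i))       ≡⟨ cong (_+ ∑ m (λ i → f (suc i))) (+-comm (f (2 + m)) (f 1)) ⟩
  f 1 + f (2 + m) + ∑ m (λ i → f (suc i))       ≡⟨ +-assoc (f 1) (f (2 + m)) _ ⟩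
  f 1 + (f (2 + m) + ∑ m (λ i → f (suc i)))     ∎
  where open ≡-Reasoning

∣∣≤∑ : ∀ {m} (p : Subset m) f → (∀ i → i ∈ p → 1 ≤ f (suc (toℕ i))) → ∣ p ∣ ≤ ∑ m f
∣∣≤∑ Vec.[] f h = z≤n
∣∣≤∑ {suc m} (b Vec.∷ p) f h rewrite ∑-shift m f with b
... | true  = +-mono-≤ (h fzero Vec.here) (∣∣≤∑ p (λ i → f (suc i)) (λ i i∈p → h (fsuc i) (Vec.there i∈p)))
... | false = ≤-trans (∣∣≤∑ p (λ i → f (suc i)) (λ i i∈p → h (fsuc i) (Vec.there i∈p))) (m≤n+m _ (f 1))

indicator : ∀ {m} → Subset m → ℕ → ℕ
indicator p             zero          = 0
indicator Vec.[]        (suc e)       = 0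
indicator (b Vec.∷ p)   (suc zero)    = if b then 1 else 0
indicator (b Vec.∷ p)   (suc (suc e)) = indicator p (suc e)

∑-indicator : ∀ {m} (p : Subset m) → ∑ m (indicator p) ≡ ∣ p ∣
∑-indicator Vec.[] = refl
∑-indicator {suc m} (b Vec.∷ p) = trans (∑-shift m (indicator (b Vec.∷ p))) (head-case b)
  where
  tail≡ : ∑ m (λ i → indicator (b Vec.∷ p) (suc i)) ≡ ∣ p ∣
  tail≡ = trans (∑-cong m λ { (suc i) _ _ → refl }) (∑-indicator p)
  head-case : ∀ b′ → (if b′ then 1 else 0) + ∑ m (λ i → indicator (b Vec.∷ p) (suc i)) ≡ ∣ b′ Vec.∷ p ∣
  head-case true  = cong suc tail≡
  head-case false = tail≡

indicator-∉ : ∀ {m} (p : Subset m) i → indicator p (suc (toℕ i)) ≡ 0 → i ∉ p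
indicator-∉ (b Vec.∷ p) fzero    () Vec.here
indicator-∉ (b Vec.∷ p) (fsuc i) eq (Vec.there i∈p) = indicator-∉ p i eq i∈p

-- With H = S², the left side is at most (16 + 20 + 3)H, and 39 < 2⁶ ≤ S⁶. This is the origin of the
-- exponent 8.
capacity : ∀ {S m w} → 2 ≤ S → m ≤ S → S ^ 8 ≤ 2 ^ w → 16 * (S * S) + (20 + 3 * m) < 2 ^ w
capacity {S} {m} {w} 2≤S m≤S word = begin-strict
  16 * H + (20 + 3 * m)        ≤⟨ +-monoʳ-≤ (16 * H) (+-mono-≤ (m≤m*n 20 H) (*-monoʳ-≤ 3 (≤-trans m≤S (m≤m*n S S)))) ⟩
  16 * H + (20 * H + 3 * H)    ≡⟨ cong (16 * H +_) (sym (*-distribʳ-+ H 20 3)) ⟩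
  16 * H + 23 * H              ≡⟨ sym (*-distribʳ-+ H 16 23) ⟩
  39 * H                       <⟨ *-monoˡ-< H (≤ᵇ⇒≤ 40 64 tt) ⟩
  2 ^ 6 * H                    ≤⟨ *-monoˡ-≤ H (^-monoˡ-≤ 6 2≤S) ⟩
  S ^ 6 * (S * S)              ≡⟨ cong (S ^ 6 *_) (cong (S *_) (sym (*-identityʳ S))) ⟩
  S ^ 6 * S ^ 2                ≡⟨ sym (^-distribˡ-+-* S 6 2) ⟩
  S ^ 8                        ≤⟨ word ⟩
  2 ^ w                        ∎
  where
  open ≤-Reasoning
  H : ℕ
  H = S * S
  instance
    S≢0 : NonZero S
    S≢0 = >-nonZero (≤-trans (s≤s z≤n) 2≤S)
    H≢0 : NonZero H
    H≢0 = m*n≢0 S S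

-- The input graph and the two directions of duality

module Decision {n m : ℕ} (G : BicolouredGraph n m) (k : ℕ) where

  open BicolouredGraph G

  private
    xs : List ℕ
    xs = encode G k

  field-value : Field → ℕ → ℕ
  field-value F e = cell xs (3 * e + codeF F)

  row : ∀ (i : Fin m) F → field-value F (suc (toℕ i)) ≡
        cell (toℕ (proj₁ (ends i)) ∷ toℕ (proj₂ (ends i)) ∷ suc (toℕ (colour i)) ∷ []) (codeF F)
  row i F = trans (cong (λ a → cell xs (a + codeF F)) (*-suc 3 (toℕ i)))
    (cell-row _ (λ i → toℕ (proj₁ (ends i))) (λ i → toℕ (proj₂ (ends i))) (λ i → suc (toℕ (colour i))) (λ i → refl) i F)

  beyond : ∀ a → 3 + 3 * m ≤ a → cell xs a ≡ 0
  beyond (suc (suc (suc a))) (s≤s (s≤s (s≤s le))) =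
    cell-beyond _ (λ i → toℕ (proj₁ (ends i))) (λ i → toℕ (proj₂ (ends i))) (λ i → suc (toℕ (colour i))) (λ i → refl) a le

  open Graph m (field-value end₁) (field-value end₂) (field-value col)

  edge-at : ∀ {e} → 1 ≤ e → e ≤ m → ∃[ i ] (e ≡ suc (toℕ {m} i))
  edge-at {suc e} _ e<m = fromℕ< e<m , cong suc (sym (toℕ-fromℕ< e<m))

  end₁-< : ∀ {e} → 1 ≤ e → e ≤ m → field-value end₁ e < n
  end₁-< 1≤e e≤m with edge-at 1≤e e≤m
  ... | i , refl = subst (_< n) (sym (row i end₁)) (toℕ<n (proj₁ (ends i)))

  end₂-< : ∀ {e} → 1 ≤ e → e ≤ m → field-value end₂ e < n
  end₂-< 1≤e e≤m with edge-at 1≤e e≤m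
  ... | i , refl = subst (_< n) (sym (row i end₂)) (toℕ<n (proj₂ (ends i)))

  two-colours : ∀ {e} → 1 ≤ e → e ≤ m → field-value col e ≡ 1 ⊎ field-value col e ≡ 2
  two-colours 1≤e e≤m with edge-at 1≤e e≤m
  ... | i , refl with colour i in eq
  ...   | fzero      = inj₁ (trans (row i col) (cong (λ c → suc (toℕ c)) eq))
  ...   | fsuc fzero = inj₂ (trans (row i col) (cong (λ c → suc (toℕ c)) eq))

  to-end : ∀ {x i} → End x (suc (toℕ i)) → ∃[ v ] (x ≡ toℕ v × v EndOf i)
  to-end {i = i} (inj₁ eq) = proj₁ (ends i) , trans (sym eq) (row i end₁) , inj₁ refl
  to-end {i = i} (inj₂ eq) = proj₂ (ends i) , trans (sym eq) (row i end₂) , inj₂ refl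

  from-end : ∀ {v i} → v EndOf i → End (toℕ v) (suc (toℕ i))
  from-end {i = i} (inj₁ refl) = inj₁ (row i end₁)
  from-end {i = i} (inj₂ refl) = inj₂ (row i end₂)

  to-pair : ∀ {i j} → Conflict (suc (toℕ i)) (suc (toℕ j)) → ConflictPair i j
  to-pair {i} {j} ((_ , _ , ci) , (_ , _ , cj) , x , xi , xj) with to-end {i = i} xi | to-end {i = j} xj
  ... | v , x≡ , vi | v′ , x≡′ , vj =
    ((λ { refl → different refl }) , v , vi , subst (_EndOf j) (toℕ-injective (trans (sym x≡′) x≡)) vj) , different
    where
    different : colour i ≢ colour j
    different eq with () ← trans (sym ci) (trans (row i col) (trans (cong (λ c → suc (toℕ c)) eq) (trans (sym (row j col)) cj)))

  coloured : ∀ i {c} → colour i ≡ c → Coloured (suc (toℕ c)) (suc (toℕ i))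
  coloured i eq = s≤s z≤n , toℕ<n i , trans (row i col) (cong (λ c → suc (toℕ c)) eq)

  from-pair : ∀ {i j} → ConflictPair i j →
              Conflict (suc (toℕ i)) (suc (toℕ j)) ⊎ Conflict (suc (toℕ j)) (suc (toℕ i))
  from-pair {i} {j} ((_ , v , vi , vj) , ≢c) with colour i in ci | colour j in cj
  ... | fzero      | fzero      = ⊥-elim (≢c refl)
  ... | fsuc fzero | fsuc fzero = ⊥-elim (≢c refl)
  ... | fzero      | fsuc fzero = inj₁ (coloured i ci , coloured j cj , toℕ v , from-end vi , from-end vj)
  ... | fsuc fzero | fzero      = inj₂ (coloured j cj , coloured i ci , toℕ v , from-end vj , from-end vi)

  cover-removal : ∀ cov → ∑ m cov ≤ k → (∀ {u e} → Conflict u e → cov u ≢ 0 ⊎ cov e ≢ 0) → ConflictPairRemoval G k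
  cover-removal cov small covers = E′ , ≤-trans (∣∣≤∑ E′ cov (λ i i∈ → ∈⇒positive i i∈)) small , free
    where
    chosen : ℕ → Bool
    chosen zero    = false
    chosen (suc _) = true
    E′ : Subset m
    E′ = Vec.tabulate (λ i → chosen (cov (suc (toℕ i))))
    ∈⇒positive : ∀ i → i ∈ E′ → 1 ≤ cov (suc (toℕ i))
    ∈⇒positive i i∈ = go (cov (suc (toℕ i))) (trans (sym (lookup∘tabulate _ i)) ([]=⇒lookup i∈))
      where
      go : ∀ c → chosen c ≡ true → 1 ≤ c
      go (suc c) _ = s≤s z≤n
    positive⇒∈ : ∀ i → cov (suc (toℕ i)) ≢ 0 → i ∈ E′
    positive⇒∈ i ne = lookup⇒[]= i E′ (trans (lookup∘tabulate _ i) (go (cov (suc (toℕ i))) ne))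
      where
      go : ∀ c → c ≢ 0 → chosen c ≡ true
      go zero    ne = ⊥-elim (ne refl)
      go (suc c) _  = refl
    free : ¬ ContainsConflictPair (∁ E′)
    free (i , j , i∈ , j∈ , pair) = case (from-pair pair)
      where
      no-edge : ∀ {i j} → i ∈ ∁ E′ → j ∈ ∁ E′ → Conflict (suc (toℕ i)) (suc (toℕ j)) → ⊥
      no-edge {i} {j} i∈ j∈ conflict with covers conflict
      ... | inj₁ ne = x∈∁p⇒x∉p i∈ (positive⇒∈ i ne)
      ... | inj₂ ne = x∈∁p⇒x∉p j∈ (positive⇒∈ j ne)
      case : Conflict (suc (toℕ i)) (suc (toℕ j)) ⊎ Conflict (suc (toℕ j)) (suc (toℕ i)) → ⊥
      case (inj₁ conflict) = no-edge i∈ j∈ conflict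
      case (inj₂ conflict) = no-edge j∈ i∈ conflict

  -- A removal set meets every conflict pair, so its indicator is a vertex cover and weak duality
  -- applies with D = 1.
  matching-removal : ∀ {mate owner} → Matching mate owner → ConflictPairRemoval G k → matched mate ≤ k
  matching-removal {mate} M (E′ , small , free) = begin
    matched mate          ≡⟨ sym (*-identityˡ _) ⟩
    1 * matched mate      ≤⟨ weak-duality M 1 (indicator E′) hit ⟩
    ∑ m (indicator E′)    ≡⟨ ∑-indicator E′ ⟩
    ∣ E′ ∣                ≤⟨ small ⟩
    k                     ∎
    where
    open ≤-Reasoning
    hit : ∀ {u} → mate u ≢ 0 → 1 ≤ indicator E′ u + indicator E′ (mate u)
    hit {u} ne = n≢0⇒n>0 λ eq → avoided (m+n≡0⇒m≡0 _ eq) (m+n≡0⇒n≡0 (indicator E′ u) eq) (HalfMatching.relates (left M) ne)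
      where
      avoided : ∀ {u e} → indicator E′ u ≡ 0 → indicator E′ e ≡ 0 → Conflict u e → ⊥
      avoided u∉ e∉ conflict@((1≤u , u≤m , _) , (1≤e , e≤m , _) , _) with edge-at 1≤u u≤m | edge-at 1≤e e≤m
      ... | i , refl | j , refl =
        free (i , j , x∉p⇒x∈∁p (indicator-∉ E′ i u∉) , x∉p⇒x∈∁p (indicator-∉ E′ j e∉) , to-pair conflict)

  two-vertices : 1 ≤ m → 2 ≤ n
  two-vertices 1≤m = distinct (ends i) (loopless i)
    where
    i : Fin m
    i = fromℕ< 1≤m
    distinct : ∀ {n} (vs : Fin n × Fin n) → proj₁ vs ≢ proj₂ vs → 2 ≤ n
    distinct {suc zero}    (fzero , fzero) ne = ⊥-elim (ne refl)
    distinct {suc (suc n)} _               _  = s≤s (s≤s z≤n)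

  -- If d is 0, the cover itself is a removal set of size at most k; otherwise the matching forbids
  -- one.
  verdict : ∀ {mate owner cov d} → Matching mate owner → ∑ m cov ≤ matched mate →
            (∀ {u e} → Conflict u e → cov u ≢ 0 ⊎ cov e ≢ 0) → d ≡ matched mate ∸ k →
            Reflects (ConflictPairRemoval G k) (d ≡ᵇ 0)
  verdict {cov = cov} {zero} M small covers eq = ofʸ (cover-removal cov (≤-trans small (m∸n≡0⇒m≤n (sym eq))) covers)
  verdict {d = suc d} M small covers eq = ofⁿ λ removal → 1+n≢0 (trans eq (m≤n⇒m∸n≡0 (matching-removal M removal)))

  Answered : Store → Set
  Answered s = ∃[ mate ] ∃[ owner ] (Matching mate owner ×
    (∃[ cov ] (∑ m cov ≤ matched mate × (∀ {u e} → Conflict u e → cov u ≢ 0 ⊎ cov e ≢ 0))) ×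
    reg s %n ≡ matched mate ∸ k)

  conclude : ∀ {P w T} → ∃[ s ] (Answered s × run P w T (initial xs) ≡ just (reg s %n ≡ᵇ 0)) →
             DecidesWithin P w T xs (ConflictPairRemoval G k)
  conclude (s , (mate , owner , M , (cov , small , covers) , n≡) , answer) =
    (reg s %n ≡ᵇ 0) , answer , verdict M small covers n≡

  module _ (w H : ℕ) (fits : 16 * H + (20 + 3 * m) < 2 ^ w) (square≤H : (2 + m) * (2 + m) ≤ H) (n≤H : n ≤ H) where

    answered : ∀ {D} → Root m D → m ≤ D * D →
               Semantics.Tri w H m field-value fits main (mainTime m D) Answered
                 (blankStore w H m xs fits refl beyond)
    answered R m≤D² =
      Correctness.main-tri w H m field-value fits square≤H refl
        (λ 1≤e e≤m → ≤-trans (<⇒≤ (end₁-< 1≤e e≤m)) n≤H)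
        (λ 1≤e e≤m → ≤-trans (<⇒≤ (end₂-< 1≤e e≤m)) n≤H)
        two-colours R m≤D² (λ _ _ → refl)

    solves : ∀ {D} → Root m D → m ≤ D * D →
             DecidesWithin (assemble main) w (8 + mainTime m D) xs (ConflictPairRemoval G k)
    solves {D} R m≤D² = conclude {assemble main} {w} {8 + mainTime m D}
      (assemble-decides w H m xs fits refl beyond {main} {mainTime m D} {Answered} (answered R m≤D²))

  decides : ∀ w → WordSize 8 n m k w →
            ∃[ T ] (WithinTime (4 * (8 + mainFactor)) n m T ×
                    DecidesWithin (assemble main) w T xs (ConflictPairRemoval G k))
  decides w word =
    8 + mainTime m D ,
    within (8 + mainFactor) {n} {m} {D} {8 + mainTime m D} R two-vertices
      (bound (bounded-const {m * D} 8 ⊞ mainTime-bounded {m} {D} (Root.1≤D R) (root-≤ R))) ,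
    -- S² serves as H: it bounds both the vertex numbers and (2 + m)².
    solves w (S * S) (capacity {S} {m} {w} (s≤s (s≤s z≤n)) (≤-trans (m≤n+m m 2) 2+m≤S) word)
      (*-mono-≤ 2+m≤S 2+m≤S) n≤S² R m≤D²
    where
    D : ℕ
    D = proj₁ (ceilingRoot m)
    R : Root m D
    R = proj₁ (proj₂ (ceilingRoot m))
    m≤D² : m ≤ D * D
    m≤D² = proj₂ (proj₂ (ceilingRoot m))
    S : ℕ
    S = 2 + n + m + k
    2+m≤S : 2 + m ≤ S
    2+m≤S = s≤s (s≤s (≤-trans (m≤n+m m n) (m≤m+n (n + m) k)))
    n≤S² : n ≤ S * S
    n≤S² = ≤-trans (≤-trans (m≤n+m n 2) (≤-trans (m≤m+n (2 + n) m) (m≤m+n (2 + n + m) k))) (m≤m*n S S)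

theorem4p2 : ∃[ P ] ∃[ C ] ∃[ c ]
    (∀ (n m : ℕ) (G : BicolouredGraph n m) (k : ℕ) .{{_ : NonZero k}} (w : ℕ) →
    WordSize c n m k w →
    ∃[ T ] (WithinTime C n m T ×
    DecidesWithin P w T (encode G k) (ConflictPairRemoval G k)))
theorem4p2 = assemble main , 4 * (8 + mainFactor) , 8 , λ n m G k w word → Decision.decides G k w word
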